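{- Let $k\geq d\geq 2$ be integers, let $q$ be a power of an odd prime, and let \[ s=d-\frac{d-1}{k+1}. \] For every $c>0$ there is a constant $C>0$ (depending only on $c$ and $d$, not on $q$, $k$ or $E$) such that every $E\subset\mathbb{F}_q^d$ with $|E|\geq c\,q^s$ satisfies \[ |\Delta_k(E)|\geq C\,2^{ -k^2}|\Delta_k(\mathbb{F}_q^d)|. \]
   Context: $\mathbb{F}_q^d$ is equipped with the dot product $x\cdot y=\sum_{i=1}^d x_iy_i$, and $O(\mathbb{F}_q^d)$ denotes the group of linear maps $\theta$ of $\mathbb{F}_q^d$ with $\theta x\cdot\theta y=x\cdot y$ for all $x,y$. A $(k+1)$-point configuration is a tuple $x=(x^1,\dots,x^{k+1})\in(\mathbb{F}_q^d)^{k+1}$. Two configurations $x,y$ are congruent, $x\sim y$, if there exist $\theta\in O(\mathbb{F}_q^d)$ and $z\in\mathbb{F}_q^d$ with $y^i=\theta x^i+z$ for every $i$. For $E\subset\mathbb{F}_q^d$, $\Delta_k(E)$ is the set of congruence classes of $(k+1)$-point configurations all of whose entries lie in $E$. -}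

module Defs where

open import Level using (0ℓ)
open import Data.Rational.Base using (ℚ; _/_; _*_; _≤_; ↥_; ↧ₙ_; +-*-rawSemiring)
open import Algebra.Apartness.Structures using (IsHeytingField)
open import Algebra.Core using (Op₁; Op₂)
open import Algebra.Definitions.RawSemiring +-*-rawSemiring
  using () renaming (_^_ to _^ℚ_) public
open import Algebra.Module.Bundles.Raw using (RawLeftModule)
import Algebra.Module.Morphism.Structures as ModuleMorphisms
open import Data.Fin.Base using (Fin)
import Data.Fin.Properties as Fin
open import Data.Integer.Base using (ℤ; +_; -[1+_])
open import Data.List.Base
  using (List; []; _∷_; [_]; length; filter; deduplicate; tabulate;
         cartesianProductWith)
open import Data.List.Membership.Propositional using (_∈_; lose)
open import Data.List.Membership.Propositional.Properties
  using (∈-tabulate⁺; ∈-cartesianProductWith⁺)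
import Data.List.Relation.Unary.All as List
open import Data.List.Relation.Unary.Any using (here; there; any?; satisfied)
open import Data.Nat.Base as ℕ using (ℕ; zero; suc; _^_)
open import Data.Product.Base using (Σ; ∃; _×_; _,_; proj₁; proj₂)
open import Data.Vec.Base as Vec
  using (Vec; []; _∷_; foldr′; zipWith; replicate; lookup)
open import Data.Vec.Properties using (≡-dec)
open import Data.Vec.Relation.Unary.All as All using (All)
open import Function.Base using (const)
open import Function.Bundles using (Inverse; _↔_)
open import Function.Properties.Inverse using (↔⇒↣)
open import Relation.Binary.Definitions using (DecidableEquality)
import Relation.Binary.Definitions as Binary
open import Relation.Binary.PropositionalEquality
  using (_≡_; _≢_; refl; sym; trans; cong; cong₂; subst; _≗_)
open import Relation.Nullary.Decidable
  using (Dec; yes; no; map′; via-injection; _×-dec_)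
open import Relation.Unary using (Pred; Decidable)

-- N ≥ c · q ^ s for a rational exponent s = a / b and c > 0, with the
-- b-th root cleared:  c ^ b * q ^ a ≤ N ^ b.
infix 4 _≥_∙_↑_

_≥_∙_↑_ : ℕ → ℚ → ℕ → ℚ → Set
N ≥ c ∙ q ↑ s = bound (↥ s)
  where
  b = ↧ₙ s

  bound : ℤ → Set
  bound (+ a)    = (c ^ℚ b) * (+ (q ^ a) / 1) ≤ + (N ^ b) / 1
  bound -[1+ a ] = c ^ℚ b ≤ + (N ^ b ℕ.* q ^ suc a) / 1

-- With ≢ as the apartness relation, a Heyting field is a field in the usual
-- sense: every a ≢ 0# is invertible, and 0# ≢ 1# since 0# is not invertible.
record FiniteField (q : ℕ) : Set₁ where
  infix  8 -_
  infixl 7 _·_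
  infixl 6 _+_
  field
    Carrier        : Set
    _+_ _·_        : Op₂ Carrier
    -_             : Op₁ Carrier
    0# 1#          : Carrier
    isHeytingField : IsHeytingField _≡_ _≢_ _+_ _·_ -_ 0# 1#
    enumeration    : Carrier ↔ Fin q

private
  Listing : Set → Set
  Listing A = Σ (List A) λ xs → ∀ x → x ∈ xs

  module _ {A : Set} (X : Listing A) {P : Pred A 0ℓ} where

    ∃? : Decidable P → Dec (∃ P)
    ∃? P? = map′ satisfied (λ (x , px) → lose (proj₂ X x) px)
                 (any? P? (proj₁ X))

    ∀? : Decidable P → Dec (∀ x → P x)
    ∀? P? = map′ (λ ps x → List.lookup ps (proj₂ X x))
                 (λ f → List.universal f (proj₁ X))
                 (List.all? P? (proj₁ X))

  module _ {A B : Set} (_≟_ : DecidableEquality A) (b : B) where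

    update : A → B → (A → B) → A → B
    update a y g x with x ≟ a
    ... | yes _ = y
    ... | no  _ = g x

    functions : List A → List B → List (A → B)
    functions []       ys = [ const b ]
    functions (a ∷ as) ys =
      cartesianProductWith (update a) ys (functions as ys)

    functions-complete : ∀ as ((ys , _) : Listing B) (f : A → B) →
      ∃ λ g → g ∈ functions as ys × (∀ {x} → x ∈ as → g x ≡ f x)
    functions-complete []       _ f = const b , here refl , λ ()
    functions-complete (a ∷ as) Y@(ys , complete) f
      with g , g∈ , g≡f ← functions-complete as Y f
      = update a (f a) g
      , ∈-cartesianProductWith⁺ (update a) (complete (f a)) g∈
      , agrees
      where
      agrees : ∀ {x} → x ∈ a ∷ as → update a (f a) g x ≡ f x
      agrees {x} x∈ with x ≟ a | x∈
      ... | yes x≡a | _         = cong f (sym x≡a)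
      ... | no  x≢a | here x≡a  with () ← x≢a x≡a
      ... | no  _   | there x∈′ = g≡f x∈′

    ∃-function? : Listing A → Listing B → {P : Pred (A → B) 0ℓ} →
                  (∀ {f g} → f ≗ g → P f → P g) →
                  Decidable P → Dec (∃ P)
    ∃-function? (xs , complete) Y@(ys , _) {P} resp P? =
      map′ satisfied to (any? P? (functions xs ys))
      where
      to : ∃ P → _
      to (f , pf) with g , g∈ , g≡f ← functions-complete xs Y f
        = lose g∈ (resp (λ x → sym (g≡f (complete x))) pf)

vectors : {A : Set} → List A → ∀ n → List (Vec A n)
vectors xs zero    = [ [] ]
vectors xs (suc n) = cartesianProductWith _∷_ xs (vectors xs n)

∈-vectors : {A : Set} {xs : List A} → (∀ x → x ∈ xs) →
            ∀ {n} (v : Vec A n) → v ∈ vectors xs n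
∈-vectors complete []      = here refl
∈-vectors complete (x ∷ v) =
  ∈-cartesianProductWith⁺ _∷_ (complete x) (∈-vectors complete v)

module Space {q : ℕ} (F : FiniteField q) (d : ℕ) where

  open FiniteField F

  elements : List Carrier
  elements = tabulate (Inverse.from enumeration)

  ∈-elements : ∀ a → a ∈ elements
  ∈-elements a = subst (_∈ elements) (Inverse.strictlyInverseʳ enumeration a)
                       (∈-tabulate⁺ (Inverse.to enumeration a))

  Point : Set
  Point = Vec Carrier d

  _≟_ : DecidableEquality Point
  _≟_ = ≡-dec (via-injection (↔⇒↣ enumeration) Fin._≟_)

  points : List Point
  points = vectors elements d

  ∈-points : ∀ x → x ∈ points
  ∈-points = ∈-vectors ∈-elements

  rawLeftModule : RawLeftModule Carrier 0ℓ 0ℓ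
  rawLeftModule = record
    { Carrierᴹ = Point
    ; _≈ᴹ_     = _≡_
    ; _+ᴹ_     = zipWith _+_
    ; _*ₗ_     = λ a → Vec.map (a ·_)
    ; 0ᴹ       = replicate d 0#
    ; -ᴹ_      = Vec.map -_
    }

  open RawLeftModule rawLeftModule using (_+ᴹ_; _*ₗ_; 0ᴹ; -ᴹ_)
  open ModuleMorphisms.LeftModuleMorphisms rawLeftModule rawLeftModule
    using (IsLeftModuleHomomorphism)

  infix 7 _•_

  _•_ : Point → Point → Carrier
  x • y = foldr′ _+_ 0# (zipWith _·_ x y)

  -- Invertibility is automatic: • is nondegenerate, so such a θ is injective,
  -- hence bijective on the finite space.
  record IsOrthogonal (θ : Point → Point) : Set where
    field
      linear      : IsLeftModuleHomomorphism θ
      preserves-• : ∀ x y → θ x • θ y ≡ x • y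

  Configuration : ℕ → Set
  Configuration k = Vec Point (suc k)

  infix 4 _∼_ _∼?_

  _∼_ : ∀ {k} → Configuration k → Configuration k → Set
  x ∼ y = ∃ λ θ → IsOrthogonal θ ×
          ∃ λ z → ∀ i → lookup y i ≡ θ (lookup x i) +ᴹ z

  private
    Elements : Listing Carrier
    Elements = elements , ∈-elements

    Points : Listing Point
    Points = points , ∈-points

    IsOrthogonal′ : Pred (Point → Point) 0ℓ
    IsOrthogonal′ θ = (∀ x y → θ (x +ᴹ y) ≡ θ x +ᴹ θ y)
                    × θ 0ᴹ ≡ 0ᴹ
                    × (∀ x → θ (-ᴹ x) ≡ -ᴹ (θ x))
                    × (∀ a x → θ (a *ₗ x) ≡ a *ₗ θ x)
                    × (∀ x y → θ x • θ y ≡ x • y)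

    fold : ∀ {θ} → IsOrthogonal′ θ → IsOrthogonal θ
    fold {θ} (+-homo , 0-homo , neg-homo , *-homo , •-pres) = record
      { linear = record
        { +ᴹ-isGroupHomomorphism = record
          { isMonoidHomomorphism = record
            { isMagmaHomomorphism = record
              { isRelHomomorphism = record { cong = cong θ }
              ; homo = +-homo }
            ; ε-homo = 0-homo }
          ; ⁻¹-homo = neg-homo }
        ; *ₗ-homo = *-homo }
      ; preserves-• = •-pres }

    unfold : ∀ {θ} → IsOrthogonal θ → IsOrthogonal′ θ
    unfold o = +ᴹ-homo , 0ᴹ-homo , -ᴹ-homo , *ₗ-homo , preserves-•
      where
      open IsOrthogonal o
      open IsLeftModuleHomomorphism linear

    resp : ∀ {θ φ} → θ ≗ φ → IsOrthogonal θ → IsOrthogonal φ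
    resp {θ} {φ} e o
      with +-homo , 0-homo , neg-homo , *-homo , •-pres ← unfold o = fold
      ( (λ x y → via (+-homo x y) (cong₂ _+ᴹ_ (e x) (e y)))
      , via 0-homo refl
      , (λ x → via (neg-homo x) (cong -ᴹ_ (e x)))
      , (λ a x → via (*-homo a x) (cong (a *ₗ_) (e x)))
      , (λ x y → trans (sym (cong₂ _•_ (e x) (e y))) (•-pres x y)))
      where
      via : ∀ {x u v} → θ x ≡ u → u ≡ v → φ x ≡ v
      via {x} p r = trans (sym (e x)) (trans p r)

    isOrthogonal? : Decidable IsOrthogonal
    isOrthogonal? θ = map′ fold unfold
      (       ∀? Points (λ x → ∀? Points λ y → _ ≟ _)
      ×-dec   (_ ≟ _)
      ×-dec   ∀? Points (λ x → _ ≟ _)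
      ×-dec   ∀? Elements (λ a → ∀? Points λ x → _ ≟ _)
      ×-dec   ∀? Points (λ x → ∀? Points λ y →
                via-injection (↔⇒↣ enumeration) Fin._≟_ _ _))

  _∼?_ : ∀ {k} → Binary.Decidable (_∼_ {k})
  x ∼? y = ∃-function? _≟_ 0ᴹ Points Points
    (λ e (o , z , p) →
      resp e o , z , λ i → trans (p i) (cong (_+ᴹ z) (e (lookup x i))))
    (λ θ → isOrthogonal? θ ×-dec
      ∃? Points λ z → Fin.all? λ i → lookup y i ≟ (θ (lookup x i) +ᴹ z))

  ∣_∣ : {E : Pred Point 0ℓ} → Decidable E → ℕ
  ∣ E? ∣ = length (filter E? points)

  configurations : ∀ k {E : Pred Point 0ℓ} → Decidable E →
                   List (Configuration k)
  configurations k E? = filter (All.all? E?) (vectors points (suc k))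

  -- ∼ is an equivalence relation, so deduplicating keeps exactly one
  -- configuration from each congruence class.
  ∣Δ_∣ : ∀ k {E : Pred Point 0ℓ} → Decidable E → ℕ
  ∣Δ k ∣ E? = length (deduplicate _∼?_ (configurations k E?))

{-# OPTIONS --safe #-}

-- Let G be the group of rigid motions x ↦ θ x + z, put D = q ^ d, and for g ∈ G let
-- λ g be the number of points of E that g maps into E. By Cauchy–Schwarz
--   ∣E∣ ^ (2 (k + 1)) ≤ ∣Δ k E∣ · ∑ g, λ g ^ (k + 1),
-- and by Burnside's lemma ∣Δ k F∣ · ∣G∣ ≤ ∑ g, fix g ^ (k + 1). The latter sum is at most
-- 2 ^ d · D ^ (k + 1): if I is a coordinate complement of the space fixed by θ, then θ fixes
-- at most q ^ (d − ∣I∣) points, and θ is determined by its restriction to I, because the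
-- fixed space is the orthogonal complement of the image of θ − 1.
--
-- The mean of λ is ∣E∣² / D, and the contribution of the g with λ g above twice the mean is
-- controlled by the variance of λ. With f = 1_E − ∣E∣ / D and A w = ∑ u, f u · f (u + w),
-- this variance is the sum over θ and w of A w · A (θ w). Since the orthogonal group acts
-- transitively on the nonzero vectors of norm t, this is a weighted sum of the squares of
-- ∑ (A w : w · w = t), where the weights are bounded by a lower bound for the size of
-- spheres, obtained by reflecting one point in many hyperplanes. Finally ∑ t, (∑ A w)²
-- counts, with weights f, the solutions of ∥u − a∥ = ∥v − b∥, and is bounded by an
-- elementary second-moment argument for the incidences of (u, v) with (a, b).

module Submission where

open import Defs
open import Algebra.Apartness.Structures using (IsHeytingField)
open import Algebra.Bundles using (CommutativeRing)
import Algebra.Module.Morphism.Structures as ModuleMorphisms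
import Algebra.Properties.Ring
import Algebra.Properties.Semiring.Mult.TCOptimised
import Algebra.Solver.Ring
open import Algebra.Solver.Ring.AlmostCommutativeRing
  using (fromCommutativeRing; _-Raw-AlmostCommutative⟶_)
open import Algebra.Structures using (IsCommutativeRing)
open import Data.Bool.Base using (Bool; true; false)
import Data.Bool.Properties as Bool using (_≟_)
open import Data.Fin.Base using (Fin; zero; suc)
import Data.Fin.Properties as Fin using (_≟_; _<?_; suc-injective; toℕ-injective)
open import Data.Integer.Base as ℤ using (ℤ; +_; -[1+_]; 0ℤ; 1ℤ; +≤+; +<+; _⊖_)
import Data.Integer.Properties as ℤ
  using (_≟_; +-*-isCommutativeRing; pos-+; pos-*; +-mono-≤; *-monoˡ-≤-nonNeg;
         *-cancelˡ-≤-pos; ≤-refl; ≤-reflexive; ≤-trans; ≤-antisym; ≤-total; <-≤-trans; <⇒≤; <⇒≱;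
         ≰⇒>; i<j⇒suc[i]≤j; suc[i]≤j⇒i<j; [1+m]⊖[1+n]≡m⊖n; abs-*; neg-distribʳ-*;
         neg-distribˡ-*; module ≤-Reasoning)
open import Data.List.Base
  using (List; []; _∷_; _++_; length; filter; map; cartesianProductWith; deduplicate; tabulate)
open import Data.List.Membership.Propositional using (_∈_)
open import Data.List.Membership.Propositional.Properties using (∈-filter⁺)
import Data.List.Properties as List using (length-tabulate)
open import Data.List.Relation.Unary.Any using (here; there)
open import Data.Maybe.Base using (Maybe; just; nothing)
open import Data.Nat.Base as ℕ using (ℕ; zero; suc; z≤n; s≤s; _∸_)
open import Data.Nat.Divisibility as ℕ using (divides; ∣1⇒≡1)
open import Data.Nat.Primality using (Prime; euclidsLemma; prime⇒irreducible; prime?)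
import Data.Nat.Properties as ℕ
  using (*-comm; +-suc; <-asym; m∸n+n≡m; n≤1+n; ≤-antisym; ≤-trans; _≤?_; ≮⇒≥; ≰⇒>)
open import Data.Product.Base using (Σ; ∃; _×_; _,_; proj₁; proj₂)
import Data.Product.Properties as × using (≡-dec)
open import Data.Sum.Base using (_⊎_; inj₁; inj₂)
open import Data.Unit.Base using (⊤; tt)
open import Data.Vec.Base as Vec using (Vec; []; _∷_; zipWith; replicate; lookup)
import Data.Vec.Properties as Vec using (≡-dec; lookup-map; map-cong; map-id; map-∘)
open import Data.Vec.Relation.Unary.All as All using (All; []; _∷_)
open import Function.Base using (_∘_; const; id)
open import Function.Bundles using (Inverse)
open import Function.Properties.Inverse using (↔⇒↣)
open import Level using (0ℓ)
open import Relation.Binary.Core using (Rel)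
import Relation.Binary.Definitions as Binary
open import Relation.Binary.PropositionalEquality
  using (_≡_; _≢_; refl; sym; trans; cong; cong₂; subst; subst₂; module ≡-Reasoning)
open import Relation.Binary.Structures using (IsEquivalence)
open import Relation.Nullary.Decidable
  using (Dec; yes; no; _×-dec_; ¬?; map′; recompute; True; toWitness; fromWitness; via-injection; from-yes)
open import Relation.Nullary.Negation using (¬_; contradiction)
open import Relation.Unary using (Pred; Decidable)
open import Relation.Unary.Properties using (U?)

-- Characters and exponential sums are avoided: spheres enter only as orbits of the orthogonal
-- group, with a crude lower bound for their size, and the incidences are controlled by counting
-- affine hyperplanes. Everything is multiplied by `D` until it is an integer, so that ordered ring
-- arithmetic suffices. The exponent `s` is the one at which the two parts of the moment balance.
-- Since `s (k + 1) = d k + 1`, the hypothesis raised to the power `k + 1` bounds `q D ^ k` by a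
-- constant times `∣E∣ ^ (k + 1)`, and the ratio of the variance term to the mean term is
-- `q D ^ k / ∣E∣ ^ (k + 1)` up to constants. The condition `k ≥ d` serves the fixed-point count:
-- `d` of the `k + 1` factors are spent to compensate for the number of `θ` with a small fixed
-- space. What is lost is exponential in `k`, with a base depending on `c`. The factor `2 ^ (k ^ 2)`
-- in the theorem absorbs this loss and leaves a constant that depends on `c` and `d` only.

module Counting where

  open import Data.Integer.Base using (_≤_; _<_)

  -- Ordered ring arithmetic in ℤ

  infixl 6 _:+_ _:-_
  infixl 7 _:*_
  infix  8 :-_
  infix  4 _:=_

  -- One syntax of polynomials with integer coefficients, shared by the solvers for ℤ and for the
  -- field.
  data Expr (n : ℕ) : Set where
    var       : Fin n → Expr n
    con       : ℤ → Expr n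
    _:+_ _:*_ : Expr n → Expr n → Expr n
    :-_       : Expr n → Expr n

  _:-_ : ∀ {n} → Expr n → Expr n → Expr n
  e₁ :- e₂ = e₁ :+ (:- e₂)

  _:=_ : ∀ {n} → Expr n → Expr n → Expr n × Expr n
  _:=_ = _,_

  module RingSolver (R : CommutativeRing 0ℓ 0ℓ)
    (ℤ⟶R : ℤ.+-*-rawRing -Raw-AlmostCommutative⟶ fromCommutativeRing R) where

    open CommutativeRing R hiding (_-_)
    open _-Raw-AlmostCommutative⟶_ ℤ⟶R using () renaming (⟦_⟧ to fromℤ)

    private
      coeff≟ : ∀ m n → Maybe (fromℤ m ≈ fromℤ n)
      coeff≟ m n with m ℤ.≟ n
      ... | yes refl = just (CommutativeRing.refl R)
      ... | no _     = nothing

      module S = Algebra.Solver.Ring ℤ.+-*-rawRing (fromCommutativeRing R) ℤ⟶R coeff≟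

      poly : ∀ {n} → Expr n → S.Polynomial n
      poly (var i)    = S.var i
      poly (con c)    = S.con c
      poly (e₁ :+ e₂) = poly e₁ S.:+ poly e₂
      poly (e₁ :* e₂) = poly e₁ S.:* poly e₂
      poly (:- e)     = S.:- poly e

      ⟦_⟧ ⟦_⇓⟧ : ∀ {n} → Expr n → Vec Carrier n → Carrier
      ⟦ var i ⟧    ρ = lookup ρ i
      ⟦ con c ⟧    ρ = fromℤ c
      ⟦ e₁ :+ e₂ ⟧ ρ = ⟦ e₁ ⟧ ρ + ⟦ e₂ ⟧ ρ
      ⟦ e₁ :* e₂ ⟧ ρ = ⟦ e₁ ⟧ ρ * ⟦ e₂ ⟧ ρ
      ⟦ :- e ⟧     ρ = - ⟦ e ⟧ ρ

      ⟦ e ⇓⟧ = S.⟦ poly e ⟧↓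

      poly-correct : ∀ {n} (e : Expr n) ρ → S.⟦ poly e ⟧ ρ ≈ ⟦ e ⟧ ρ
      poly-correct (var i)    ρ = CommutativeRing.refl R
      poly-correct (con c)    ρ = CommutativeRing.refl R
      poly-correct (e₁ :+ e₂) ρ = +-cong (poly-correct e₁ ρ) (poly-correct e₂ ρ)
      poly-correct (e₁ :* e₂) ρ = *-cong (poly-correct e₁ ρ) (poly-correct e₂ ρ)
      poly-correct (:- e)     ρ = -‿cong (poly-correct e ρ)

    open import Relation.Binary.Reflection setoid var ⟦_⟧ ⟦_⇓⟧
      (λ e ρ → CommutativeRing.trans R (S.correct (poly e) ρ) (poly-correct e ρ))
      public using (solve)

  -- The integer operations are made opaque, since unification would otherwise
  -- unfold them.
  infixl 6 _+_ _-_
  infixl 7 _*_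
  infix  8 -_
  infixr 8 _^_

  opaque

    _+_ _*_ : ℤ → ℤ → ℤ
    _+_ = ℤ._+_
    _*_ = ℤ._*_

    -_ : ℤ → ℤ
    -_ = ℤ.-_

  _-_ : ℤ → ℤ → ℤ
  a - b = a + - b

  _^_ : ℤ → ℕ → ℤ
  a ^ zero  = 1ℤ
  a ^ suc n = a * a ^ n

  opaque
    unfolding _+_ _*_ -_

    isCommutativeRing : IsCommutativeRing _≡_ _+_ _*_ -_ 0ℤ 1ℤ
    isCommutativeRing = ℤ.+-*-isCommutativeRing

    pos-+ : ∀ m n → + (m ℕ.+ n) ≡ + m + + n
    pos-+ = ℤ.pos-+

    pos-* : ∀ m n → + (m ℕ.* n) ≡ + m * + n
    pos-* = ℤ.pos-*

    +-mono-≤ : ∀ {a b c d} → a ≤ b → c ≤ d → a + c ≤ b + d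
    +-mono-≤ = ℤ.+-mono-≤

    *-monoʳ : ∀ {a b c} → 0ℤ ≤ c → a ≤ b → c * a ≤ c * b
    *-monoʳ {c = c} p q = ℤ.*-monoˡ-≤-nonNeg c {{ℤ.nonNegative p}} q

    *-cancel : ∀ {a b c} → 0ℤ < c → c * a ≤ c * b → a ≤ b
    *-cancel {a} {b} {c} p q = ℤ.*-cancelˡ-≤-pos a b c {{ℤ.positive p}} q

    0≤² : ∀ a → 0ℤ ≤ a * a
    0≤² (+ a)    = subst (0ℤ ≤_) (ℤ.pos-* a a) (+≤+ z≤n)
    0≤² -[1+ a ] = +≤+ z≤n

  ℤ-ring : CommutativeRing 0ℓ 0ℓ
  ℤ-ring = record { isCommutativeRing = isCommutativeRing }

  open CommutativeRing ℤ-ring public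
    using (+-identityˡ; +-identityʳ; *-identityˡ; *-identityʳ; +-assoc; *-assoc; +-comm; *-comm;
           distribˡ; distribʳ; zeroˡ; zeroʳ; -‿inverseʳ; -‿inverseˡ)

  opaque
    unfolding _+_ _*_ -_

    +-homo : ∀ a b → a ℤ.+ b ≡ a + b
    +-homo _ _ = refl

    *-homo : ∀ a b → a ℤ.* b ≡ a * b
    *-homo _ _ = refl

    -‿homo : ∀ a → ℤ.- a ≡ - a
    -‿homo _ = refl

  ℤ⟶ℤ : ℤ.+-*-rawRing -Raw-AlmostCommutative⟶ fromCommutativeRing ℤ-ring
  ℤ⟶ℤ = record
    { ⟦_⟧ = λ a → a ; +-homo = +-homo ; *-homo = *-homo ; -‿homo = -‿homo
    ; 0-homo = refl ; 1-homo = refl }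

  open RingSolver ℤ-ring ℤ⟶ℤ public

  ≤-refl : ∀ {a} → a ≤ a
  ≤-refl = ℤ.≤-refl

  0≤+ : ∀ {n} → 0ℤ ≤ + n
  0≤+ = +≤+ z≤n

  *-monoˡ : ∀ {a b c} → 0ℤ ≤ c → a ≤ b → a * c ≤ b * c
  *-monoˡ {a} {b} {c} p q = subst₂ _≤_ (*-comm c a) (*-comm c b) (*-monoʳ p q)

  0≤-+ : ∀ {a b} → 0ℤ ≤ a → 0ℤ ≤ b → 0ℤ ≤ a + b
  0≤-+ {a} {b} p q = subst (_≤ a + b) (+-identityˡ 0ℤ) (+-mono-≤ p q)

  0≤-* : ∀ {a b} → 0ℤ ≤ a → 0ℤ ≤ b → 0ℤ ≤ a * b
  0≤-* {a} {b} p q = subst (_≤ a * b) (zeroʳ a) (*-monoʳ p q)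

  0≤-^ : ∀ {a} n → 0ℤ ≤ a → 0ℤ ≤ a ^ n
  0≤-^ zero    p = 0≤+
  0≤-^ (suc n) p = 0≤-* p (0≤-^ n p)

  *-mono : ∀ {a b c d} → 0ℤ ≤ a → 0ℤ ≤ d → a ≤ b → c ≤ d → a * c ≤ b * d
  *-mono p r s t = ℤ.≤-trans (*-monoʳ p t) (*-monoˡ r s)

  ^-mono : ∀ {a b} n → 0ℤ ≤ a → a ≤ b → a ^ n ≤ b ^ n
  ^-mono zero    p q = ≤-refl
  ^-mono (suc n) p q = *-mono p (0≤-^ n (ℤ.≤-trans p q)) q (^-mono n p q)

  ^-distrib-* : ∀ a b n → (a * b) ^ n ≡ a ^ n * b ^ n
  ^-distrib-* a b zero    = sym (*-identityˡ 1ℤ)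
  ^-distrib-* a b (suc n) = trans (cong (a * b *_) (^-distrib-* a b n))
    (solve 4 (λ a b c d → a :* b :* (c :* d) := a :* c :* (b :* d)) refl a b (a ^ n) (b ^ n))

  ^-+ : ∀ a m n → a ^ (m ℕ.+ n) ≡ a ^ m * a ^ n
  ^-+ a zero    n = sym (*-identityˡ _)
  ^-+ a (suc m) n = trans (cong (a *_) (^-+ a m n)) (sym (*-assoc a _ _))

  1^ : ∀ n → 1ℤ ^ n ≡ 1ℤ
  1^ zero    = refl
  1^ (suc n) = trans (*-identityˡ _) (1^ n)

  ^-comm : ∀ a m n → (a ^ m) ^ n ≡ (a ^ n) ^ m
  ^-comm a zero    n = 1^ n
  ^-comm a (suc m) n = trans (^-distrib-* a (a ^ m) n) (cong (a ^ n *_) (^-comm a m n))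

  pos-^ : ∀ m n → + (m ℕ.^ n) ≡ (+ m) ^ n
  pos-^ m zero    = refl
  pos-^ m (suc n) = trans (pos-* m (m ℕ.^ n)) (cong (+ m *_) (pos-^ m n))

  ≤-by : ∀ {a b} c → b ≡ a + c → 0ℤ ≤ c → a ≤ b
  ≤-by {a} {b} c e p = subst₂ _≤_ (+-identityʳ a) (sym e) (+-mono-≤ (≤-refl {a}) p)

  0≤-diff : ∀ {a b} → a ≤ b → 0ℤ ≤ b - a
  0≤-diff {a} {b} p = subst (_≤ b - a) (-‿inverseʳ a) (+-mono-≤ p (≤-refl { - a}))

  0<-* : ∀ {a b} → 0ℤ < a → 0ℤ < b → 0ℤ < a * b
  0<-* {a} {b} p r = ℤ.≰⇒> λ ab≤0 → ℤ.<⇒≱ r (*-cancel p (subst (a * b ≤_) (sym (zeroʳ a)) ab≤0))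

  0<-^ : ∀ {a} n → 0ℤ < a → 0ℤ < a ^ n
  0<-^ zero    p = +<+ (s≤s z≤n)
  0<-^ (suc n) p = 0<-* p (0<-^ n p)

  1≤⇒0< : ∀ {a} → 1ℤ ≤ a → 0ℤ < a
  1≤⇒0< = ℤ.<-≤-trans (+<+ (s≤s z≤n))

  0<⇒1≤ : ∀ {a} → 0ℤ < a → 1ℤ ≤ a
  0<⇒1≤ = ℤ.i<j⇒suc[i]≤j

  -- Either L is at most twice m, or L² is at most four times (L − m)².
  power-bound : ∀ {L M m} j → 0ℤ ≤ L → L ≤ M → 0ℤ ≤ m →
                L ^ suc (suc j) ≤ (+ 2 * m) ^ suc (suc j) + + 4 * M ^ j * ((L - m) * (L - m))
  power-bound {L} {M} {m} j 0≤L L≤M 0≤m with ℤ.≤-total L (+ 2 * m)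
  ... | inj₁ L≤2m = ℤ.≤-trans (^-mono (suc (suc j)) 0≤L L≤2m)
    (≤-by _ refl (0≤-* (0≤-* {+ 4} 0≤+ (0≤-^ j (ℤ.≤-trans 0≤L L≤M))) (0≤² (L - m))))
  ... | inj₂ 2m≤L = begin
    L * (L * L ^ j) ≡⟨ solve 2 (λ a b → a :* (a :* b) := b :* (a :* a)) refl L (L ^ j) ⟩
    L ^ j * (L * L) ≤⟨ *-mono (0≤-^ j 0≤L) (0≤-* {+ 4} 0≤+ (0≤² (L - m))) (^-mono j 0≤L L≤M) square ⟩
    M ^ j * (+ 4 * ((L - m) * (L - m)))
      ≡⟨ solve 2 (λ a b → a :* (con (+ 4) :* b) := con (+ 4) :* a :* b) refl (M ^ j) ((L - m) * (L - m)) ⟩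
    + 4 * M ^ j * ((L - m) * (L - m))
      ≤⟨ ≤-by _ (solve 2 (λ a b → b :+ a := a :+ b) refl (+ 4 * M ^ j * ((L - m) * (L - m))) ((+ 2 * m) ^ suc (suc j)))
                                                            (0≤-^ (suc (suc j)) (0≤-* {+ 2} 0≤+ 0≤m)) ⟩
    (+ 2 * m) ^ suc (suc j) + + 4 * M ^ j * ((L - m) * (L - m)) ∎
    where
    open ℤ.≤-Reasoning
    square : L * L ≤ + 4 * ((L - m) * (L - m))
    square = ≤-by ((L - + 2 * m) * (+ 2 * L + (L - + 2 * m)))
      (solve 2 (λ l m → con (+ 4) :* ((l :- m) :* (l :- m)) := l :* l :+ (l :- con (+ 2) :* m) :* (con (+ 2) :* l :+ (l :- con (+ 2) :* m))) refl L m)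
      (0≤-* (0≤-diff 2m≤L) (0≤-+ (0≤-* {+ 2} 0≤+ 0≤L) (0≤-diff 2m≤L)))

  -- Sums over finite types

  𝟙 : {P : Set} → Dec P → ℤ
  𝟙 (yes _) = 1ℤ
  𝟙 (no _)  = 0ℤ

  0≤𝟙 : {P : Set} (p : Dec P) → 0ℤ ≤ 𝟙 p
  0≤𝟙 (yes _) = 0≤+
  0≤𝟙 (no _)  = 0≤+

  𝟙-yes : {P : Set} (p : Dec P) → P → 𝟙 p ≡ 1ℤ
  𝟙-yes (yes _)  p = refl
  𝟙-yes (no ¬p)  p = contradiction p ¬p

  𝟙-no : {P : Set} (p : Dec P) → ¬ P → 𝟙 p ≡ 0ℤ
  𝟙-no (yes p) ¬p = contradiction p ¬p
  𝟙-no (no _)  _  = refl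

  𝟙-mono : {P Q : Set} (p : Dec P) (q : Dec Q) → (P → Q) → 𝟙 p ≤ 𝟙 q
  𝟙-mono (no _)  q _ = 0≤𝟙 q
  𝟙-mono (yes p) q f = ℤ.≤-reflexive (sym (𝟙-yes q (f p)))

  𝟙-cong : {P Q : Set} (p : Dec P) (q : Dec Q) → (P → Q) → (Q → P) → 𝟙 p ≡ 𝟙 q
  𝟙-cong p q f g = ℤ.≤-antisym (𝟙-mono p q f) (𝟙-mono q p g)

  𝟙≤1 : {P : Set} (p : Dec P) → 𝟙 p ≤ 1ℤ
  𝟙≤1 p = 𝟙-mono p (yes tt) (const tt)

  𝟙-× : {P Q : Set} (p : Dec P) (q : Dec Q) → 𝟙 (p ×-dec q) ≡ 𝟙 p * 𝟙 q
  𝟙-× (yes _) (yes _) = sym (*-identityˡ 1ℤ)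
  𝟙-× (yes _) (no _)  = sym (zeroʳ 1ℤ)
  𝟙-× (no _)  (yes _) = sym (zeroˡ 1ℤ)
  𝟙-× (no _)  (no _)  = sym (zeroˡ 0ℤ)

  𝟙-* : {P : Set} (p : Dec P) {a b : ℤ} → (P → a ≡ b) → 𝟙 p * a ≡ 𝟙 p * b
  𝟙-* (yes p) f = cong (_*_ 1ℤ) (f p)
  𝟙-* (no _)  {a} {b} _ = trans (zeroˡ a) (sym (zeroˡ b))

  𝟙-*-≤ : {P : Set} (p : Dec P) {a b : ℤ} → (P → a ≤ b) → 𝟙 p * a ≤ 𝟙 p * b
  𝟙-*-≤ (yes p) f = *-monoʳ {c = 1ℤ} 0≤+ (f p)
  𝟙-*-≤ (no _)  {a} {b} _ = ℤ.≤-reflexive (trans (zeroˡ a) (sym (zeroˡ b)))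

  module _ {A : Set} where

    sum : List A → (A → ℤ) → ℤ
    sum []       f = 0ℤ
    sum (x ∷ xs) f = f x + sum xs f

    sum-mono∈ : ∀ xs {f g} → (∀ x → x ∈ xs → f x ≤ g x) → sum xs f ≤ sum xs g
    sum-mono∈ []       h = ≤-refl
    sum-mono∈ (x ∷ xs) h =
      +-mono-≤ (h x (here refl)) (sum-mono∈ xs λ y y∈ → h y (there y∈))

    sum-mono : ∀ xs {f g} → (∀ x → f x ≤ g x) → sum xs f ≤ sum xs g
    sum-mono xs h = sum-mono∈ xs λ x _ → h x

    sum-cong∈ : ∀ xs {f g} → (∀ x → x ∈ xs → f x ≡ g x) → sum xs f ≡ sum xs g
    sum-cong∈ []       h = refl
    sum-cong∈ (x ∷ xs) h =
      cong₂ _+_ (h x (here refl)) (sum-cong∈ xs λ y y∈ → h y (there y∈))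

    sum-cong : ∀ xs {f g} → (∀ x → f x ≡ g x) → sum xs f ≡ sum xs g
    sum-cong xs h = sum-cong∈ xs λ x _ → h x

    sum-0 : ∀ xs → sum xs (λ _ → 0ℤ) ≡ 0ℤ
    sum-0 []       = refl
    sum-0 (x ∷ xs) = trans (+-identityˡ _) (sum-0 xs)

    sum-+ : ∀ xs f g → sum xs (λ x → f x + g x) ≡ sum xs f + sum xs g
    sum-+ []       f g = sym (+-identityˡ 0ℤ)
    sum-+ (x ∷ xs) f g = trans (cong (_+_ (f x + g x)) (sum-+ xs f g)) 
      (solve 4 (λ a b c d → (a :+ b) :+ (c :+ d) := (a :+ c) :+ (b :+ d)) refl (f x) (g x) (sum xs f) (sum xs g))

    sum-* : ∀ xs c f → sum xs (λ x → c * f x) ≡ c * sum xs f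
    sum-* []       c f = sym (zeroʳ c)
    sum-* (x ∷ xs) c f =
      trans (cong (_+_ (c * f x)) (sum-* xs c f)) (sym (distribˡ c _ _))

    0≤-sum : ∀ xs {f} → (∀ x → 0ℤ ≤ f x) → 0ℤ ≤ sum xs f
    0≤-sum xs {f} h = subst (_≤ sum xs f) (sum-0 xs) (sum-mono xs h)

    sum-++ : ∀ xs ys f → sum (xs ++ ys) f ≡ sum xs f + sum ys f
    sum-++ []       ys f = sym (+-identityˡ _)
    sum-++ (x ∷ xs) ys f =
      trans (cong (_+_ (f x)) (sum-++ xs ys f)) (sym (+-assoc (f x) _ _))

    sum-1 : ∀ xs → sum xs (λ _ → 1ℤ) ≡ + length xs
    sum-1 []       = refl
    sum-1 (x ∷ xs) = trans (cong (_+_ 1ℤ) (sum-1 xs)) (sym (pos-+ 1 (length xs)))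

    module _ {P : Pred A 0ℓ} (P? : Decidable P) where

      sum-filter : ∀ xs f → sum (filter P? xs) f ≡ sum xs (λ x → 𝟙 (P? x) * f x)
      sum-filter []       f = refl
      sum-filter (x ∷ xs) f with P? x
      ... | yes _ = cong₂ _+_ (sym (*-identityˡ (f x))) (sum-filter xs f)
      ... | no _  = trans (sum-filter xs f)
                      (sym (trans (cong (_+ _) (zeroˡ (f x))) (+-identityˡ _)))

      length-filter : ∀ xs → + length (filter P? xs) ≡ sum xs (λ x → 𝟙 (P? x))
      length-filter xs = trans (sym (sum-1 (filter P? xs)))
        (trans (sum-filter xs _) (sum-cong xs λ x → *-identityʳ _))

  sum-map : {A B : Set} (h : A → B) → ∀ xs f → sum (map h xs) f ≡ sum xs (f ∘ h)
  sum-map h []       f = refl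
  sum-map h (x ∷ xs) f = cong (_+_ (f (h x))) (sum-map h xs f)

  sum-swap : {A B : Set} (xs : List A) (ys : List B) (f : A → B → ℤ) →
             sum xs (λ x → sum ys (f x)) ≡ sum ys (λ y → sum xs λ x → f x y)
  sum-swap []       ys f = sym (sum-0 ys)
  sum-swap (x ∷ xs) ys f =
    trans (cong (_+_ (sum ys (f x))) (sum-swap xs ys f)) (sym (sum-+ ys (f x) λ y → sum xs λ z → f z y))

  sum-cartesianProductWith : {A B C : Set} (h : A → B → C) → ∀ xs ys f →
    sum (cartesianProductWith h xs ys) f ≡ sum xs (λ x → sum ys λ y → f (h x y))
  sum-cartesianProductWith h []       ys f = refl
  sum-cartesianProductWith h (x ∷ xs) ys f =
    trans (sum-++ (map (h x) ys) _ f)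
      (cong₂ _+_ (sum-map (h x) ys f) (sum-cartesianProductWith h xs ys f))

  -- Irrelevance and the absence of η keep the comparison of instance arguments cheap.
  record Finite (A : Set) : Set where
    no-eta-equality; pattern
    infix 4 _≟_
    field
      list : List A
      _≟_  : Binary.DecidableEquality A
      .once : ∀ a → sum list (λ x → 𝟙 (x ≟ a)) ≡ 1ℤ

  open Finite {{...}} public using (_≟_)

  -- The irrelevant proof is recovered by deciding the equation of integers that it asserts.
  list-once : {A : Set} (X : Finite A) → ∀ a → sum (Finite.list X) (λ x → 𝟙 (Finite._≟_ X x a)) ≡ 1ℤ
  list-once record { once = once } a = recompute (_ ℤ.≟ _) (once a)

  opaque

    ∑ : {A : Set} {{X : Finite A}} → (A → ℤ) → ℤ
    ∑ {{X}} = sum (Finite.list X)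

    ∑-def : {A : Set} {{X : Finite A}} (f : A → ℤ) → ∑ f ≡ sum (Finite.list X) f
    ∑-def f = refl

  ∣_∣ : (A : Set) {{X : Finite A}} → ℤ
  ∣ A ∣ = ∑ {A} (const 1ℤ)

  δ : {A : Set} {{X : Finite A}} → A → A → ℤ
  δ x y = 𝟙 (x ≟ y)

  δ-refl : {A : Set} {{X : Finite A}} (x : A) → δ x x ≡ 1ℤ
  δ-refl x = 𝟙-yes (x ≟ x) refl

  module _ {A : Set} {{X : Finite A}} where

    opaque
      unfolding ∑

      ∑-cong : {f g : A → ℤ} → (∀ x → f x ≡ g x) → ∑ f ≡ ∑ g
      ∑-cong = sum-cong (Finite.list X)

      ∑-mono : {f g : A → ℤ} → (∀ x → f x ≤ g x) → ∑ f ≤ ∑ g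
      ∑-mono = sum-mono (Finite.list X)

      0≤-∑ : {f : A → ℤ} → (∀ x → 0ℤ ≤ f x) → 0ℤ ≤ ∑ f
      0≤-∑ = 0≤-sum (Finite.list X)

      ∑-0 : {f : A → ℤ} → (∀ x → f x ≡ 0ℤ) → ∑ f ≡ 0ℤ
      ∑-0 h = trans (∑-cong h) (sum-0 (Finite.list X))

      ∑-+ : (f g : A → ℤ) → ∑ (λ x → f x + g x) ≡ ∑ f + ∑ g
      ∑-+ = sum-+ (Finite.list X)

      ∑-* : ∀ c (f : A → ℤ) → ∑ (λ x → c * f x) ≡ c * ∑ f
      ∑-* = sum-* (Finite.list X)

      ∑-*ʳ : ∀ c (f : A → ℤ) → ∑ (λ x → f x * c) ≡ ∑ f * c
      ∑-*ʳ c f = trans (∑-cong λ x → *-comm (f x) c) (trans (∑-* c f) (*-comm c _))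

      ∑-const : ∀ c → ∑ {A} (const c) ≡ c * ∣ A ∣
      ∑-const c = trans (∑-cong λ _ → sym (*-identityʳ c)) (∑-* c _)

      ∑-swap : {B : Set} {{Y : Finite B}} (f : A → B → ℤ) →
               ∑ (λ x → ∑ (f x)) ≡ ∑ (λ y → ∑ λ x → f x y)
      ∑-swap {{Y}} f = sum-swap (Finite.list X) (Finite.list Y) f

      ∑-δ-1ʳ : (a : A) → ∑ (λ x → δ x a) ≡ 1ℤ
      ∑-δ-1ʳ = list-once X

  module _ {A : Set} {{X : Finite A}} where

    ∑-*-∑ : {B : Set} {{Y : Finite B}} (f : A → ℤ) (g : B → ℤ) →
            ∑ f * ∑ g ≡ ∑ (λ x → ∑ λ y → f x * g y)
    ∑-*-∑ f g = trans (sym (∑-*ʳ (∑ g) f)) (∑-cong λ x → sym (∑-* (f x) g))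

    ∑-δ : ∀ a (f : A → ℤ) → ∑ (λ x → δ x a * f x) ≡ f a
    ∑-δ a f = begin
      ∑ (λ x → δ x a * f x) ≡⟨ ∑-cong (λ x → 𝟙-* (x ≟ a) (cong f)) ⟩
      ∑ (λ x → δ x a * f a) ≡⟨ ∑-*ʳ (f a) _ ⟩
      ∑ (λ x → δ x a) * f a ≡⟨ cong (_* f a) (∑-δ-1ʳ a) ⟩
      1ℤ * f a ≡⟨ *-identityˡ (f a) ⟩
      f a                   ∎
      where open ≡-Reasoning

    δ-sym : (x y : A) → δ x y ≡ δ y x
    δ-sym x y = 𝟙-cong (x ≟ y) (y ≟ x) sym sym

    ∑-δ′ : ∀ a (f : A → ℤ) → ∑ (λ x → δ a x * f x) ≡ f a
    ∑-δ′ a f = trans (∑-cong λ x → cong (_* f x) (δ-sym a x)) (∑-δ a f)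

    ∑-δ-1 : ∀ a → ∑ (λ x → δ a x) ≡ 1ℤ
    ∑-δ-1 a = trans (∑-cong λ x → sym (*-identityʳ _)) (∑-δ′ a (const 1ℤ))

    ∑-single : ∀ a {f : A → ℤ} → (∀ x → 0ℤ ≤ f x) → f a ≤ ∑ f
    ∑-single a {f} h = subst (_≤ ∑ f) (∑-δ a f) (∑-mono λ x →
      subst (δ x a * f x ≤_) (*-identityˡ (f x)) (*-monoˡ (h x) (𝟙≤1 (x ≟ a))))

  module _ {A : Set} {{X : Finite A}} where

    private L = Finite.list X

    ∑-fibre : {B : Set} {{Y : Finite B}} (h : A → B) (f : A → ℤ) →
              ∑ f ≡ ∑ (λ y → ∑ λ x → δ (h x) y * f x)
    ∑-fibre h f = trans
      (∑-cong λ x → sym (∑-δ′ (h x) (λ _ → f x)))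
      (∑-swap λ x y → δ (h x) y * f x)

    private
      search : (P : Pred A 0ℓ) → Decidable P → ∀ xs →
               ∃ P ⊎ (∀ x → x ∈ xs → ¬ P x)
      search P P? []       = inj₂ λ _ ()
      search P P? (x ∷ xs) with P? x | search P P? xs
      ... | yes p | _      = inj₁ (x , p)
      ... | no _  | inj₁ p = inj₁ p
      ... | no ¬p | inj₂ h = inj₂ λ { _ (here refl) → ¬p ; y (there y∈) → h y y∈ }

    any⊎none : {P : Pred A 0ℓ} → Decidable P → ∃ P ⊎ (∀ x → ¬ P x)
    any⊎none {P} P? with search P P? L
    ... | inj₁ p = inj₁ p
    -- If no listed element satisfies `P` but `a` does, then `a` is listed zero times instead of
    -- once.
    ... | inj₂ h = inj₂ λ a pa → contradiction
      (trans (sym (list-once X a))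
        (trans (sum-cong∈ L λ x x∈ → 𝟙-no (x ≟ a) λ { refl → h a x∈ pa }) (sum-0 L)))
      λ ()

    -- To bound a count one may assume that it is not empty.
    ∑-𝟙-≤ : {P : Pred A 0ℓ} (P? : Decidable P) {n : ℤ} → 0ℤ ≤ n →
            (∀ a → P a → ∑ (λ x → 𝟙 (P? x)) ≤ n) → ∑ (λ x → 𝟙 (P? x)) ≤ n
    ∑-𝟙-≤ P? p h with any⊎none P?
    ... | inj₁ (a , pa) = h a pa
    ... | inj₂ ¬P = subst (_≤ _) (sym (∑-0 λ x → 𝟙-no (P? x) (¬P x))) p

    ∑-𝟙-≤1 : {P : Pred A 0ℓ} (P? : Decidable P) →
             (∀ x y → P x → P y → x ≡ y) → ∑ (λ x → 𝟙 (P? x)) ≤ 1ℤ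
    ∑-𝟙-≤1 P? u = ∑-𝟙-≤ P? 0≤+ λ a pa → subst (_ ≤_) (∑-δ-1 a)
      (∑-mono λ x → 𝟙-mono (P? x) (a ≟ x) (u a x pa))

    -- Each fibre of `h` meets `P` in at most one point, so every `f y` is counted at most once;
    -- values that are not attained only enlarge the right-hand side.
    ∑-inj : {B : Set} {{Y : Finite B}} {P : Pred A 0ℓ} (P? : Decidable P) {h : A → B} →
            (∀ x y → P x → P y → h x ≡ h y → x ≡ y) →
            (f : B → ℤ) → (∀ y → 0ℤ ≤ f y) →
            ∑ (λ x → 𝟙 (P? x) * f (h x)) ≤ ∑ f
    ∑-inj P? {h} inj f 0≤f = begin
      ∑ (λ x → 𝟙 (P? x) * f (h x)) ≡⟨ ∑-fibre h _ ⟩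
      ∑ (λ y → ∑ λ x → δ (h x) y * (𝟙 (P? x) * f (h x))) ≡⟨ ∑-cong (λ y → ∑-cong λ x → step x y) ⟩
      ∑ (λ y → ∑ λ x → f y * 𝟙 (P? x ×-dec h x ≟ y)) ≡⟨ ∑-cong (λ y → ∑-* (f y) _) ⟩
      ∑ (λ y → f y * ∑ λ x → 𝟙 (P? x ×-dec h x ≟ y)) ≤⟨ ∑-mono (λ y → *-monoʳ (0≤f y)
                                                              (∑-𝟙-≤1 _ λ { x x′ (p , refl) (p′ , e) → inj x x′ p p′ (sym e) })) ⟩
      ∑ (λ y → f y * 1ℤ) ≡⟨ ∑-cong (λ y → *-identityʳ (f y)) ⟩
      ∑ f                                                 ∎
      where
      open ℤ.≤-Reasoning
      lem : ∀ a b c → a * (b * c) ≡ c * (b * a)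
      lem = solve 3 (λ a b c → a :* (b :* c) := c :* (b :* a)) refl
      step : ∀ x y → δ (h x) y * (𝟙 (P? x) * f (h x)) ≡ f y * 𝟙 (P? x ×-dec h x ≟ y)
      step x y = trans (𝟙-* (h x ≟ y) (λ { refl → refl }))
        (trans (lem (δ (h x) y) (𝟙 (P? x)) (f y)) (cong (f y *_) (sym (𝟙-× (P? x) (h x ≟ y)))))

    ∑-bij : {B : Set} {{Y : Finite B}} (h : A → B) (h⁻¹ : B → A) →
            (∀ x → h⁻¹ (h x) ≡ x) → (∀ y → h (h⁻¹ y) ≡ y) →
            (f : B → ℤ) → ∑ (λ x → f (h x)) ≡ ∑ f
    ∑-bij h h⁻¹ l r f = begin
      ∑ (λ x → f (h x)) ≡⟨ ∑-fibre h _ ⟩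
      ∑ (λ y → ∑ λ x → δ (h x) y * f (h x)) ≡⟨ ∑-cong (λ y → ∑-cong λ x →
                                                   trans (𝟙-* (h x ≟ y) (cong f)) (cong (_* f y)
                                                   (𝟙-cong (h x ≟ y) (x ≟ h⁻¹ y) (λ { refl → sym (l x) }) (λ { refl → r y })))) ⟩
      ∑ (λ y → ∑ λ x → δ x (h⁻¹ y) * f y) ≡⟨ ∑-cong (λ y → ∑-δ (h⁻¹ y) (λ _ → f y)) ⟩
      ∑ f                                    ∎
      where open ≡-Reasoning

    -- A missed value `y` could be added to the image without a collision, and summing over all
    -- targets `z` would give `1 + ∣ A ∣ ≤ ∣ A ∣`.
    injective⇒surjective : (h : A → A) → (∀ {x y} → h x ≡ h y → x ≡ y) →
                           ∀ y → ∃ λ x → h x ≡ y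
    injective⇒surjective h inj y with any⊎none (λ x → h x ≟ y)
    ... | inj₁ p = p
    ... | inj₂ ¬p = contradiction absurd (ℤ.<⇒≱ (ℤ.suc[i]≤j⇒i<j (ℤ.≤-reflexive (+-homo 1ℤ ∣ A ∣))))
      where
      open ℤ.≤-Reasoning
      one : ∀ z → ∑ (λ x → δ (h x) z) ≤ 1ℤ
      one z = ∑-𝟙-≤1 (λ x → h x ≟ z) λ { x x′ refl e → inj (sym e) }
      fibre : ∀ z → δ y z + ∑ (λ x → δ (h x) z) ≤ 1ℤ
      fibre z with y ≟ z
      ... | yes refl = ℤ.≤-reflexive (trans (cong (_+_ 1ℤ) (∑-0 λ x → 𝟙-no (h x ≟ y) (¬p x))) (+-identityʳ 1ℤ))
      ... | no _     = subst (_≤ 1ℤ) (sym (+-identityˡ _)) (one z)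
      absurd : 1ℤ + ∣ A ∣ ≤ ∣ A ∣
      absurd = begin
        1ℤ + ∣ A ∣ ≡⟨ cong₂ _+_ (sym (∑-δ-1 y))
                                                           (trans (∑-cong λ x → sym (∑-δ-1 (h x))) (∑-swap λ x z → δ (h x) z)) ⟩
        ∑ (λ z → δ y z) + ∑ (λ z → ∑ λ x → δ (h x) z) ≡⟨ sym (∑-+ (δ y) _) ⟩
        ∑ (λ z → δ y z + ∑ λ x → δ (h x) z) ≤⟨ ∑-mono fibre ⟩
        ∣ A ∣                                         ∎

  opaque
    unfolding ∑

    ∑∑-def : {A B C : Set} {{X : Finite A}} {{Y : Finite B}} (h : A → B → C) (f : C → ℤ) →
             sum (cartesianProductWith h (Finite.list X) (Finite.list Y)) f ≡ ∑ (λ x → ∑ λ y → f (h x y))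
    ∑∑-def {{X}} {{Y}} h f = sum-cartesianProductWith h (Finite.list X) (Finite.list Y) f

  instance
    Finite-× : {A B : Set} {{X : Finite A}} {{Y : Finite B}} → Finite (A × B)
    Finite-× {{X}} {{Y}} = record
      { list = cartesianProductWith _,_ (Finite.list X) (Finite.list Y)
      ; _≟_ = ×.≡-dec _≟_ _≟_
      ; once = λ (a , b) → begin
          sum (cartesianProductWith _,_ (Finite.list X) (Finite.list Y)) (λ p → 𝟙 (×.≡-dec _≟_ _≟_ p (a , b)))
            ≡⟨ ∑∑-def _,_ _ ⟩
          ∑ (λ x → ∑ λ y → 𝟙 (×.≡-dec _≟_ _≟_ (x , y) (a , b)))
            ≡⟨ ∑-cong (λ x → ∑-cong λ y → trans
                 (𝟙-cong _ (x ≟ a ×-dec y ≟ b) (λ { refl → refl , refl }) (λ { (refl , refl) → refl }))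
                 (𝟙-× (x ≟ a) (y ≟ b))) ⟩
          ∑ (λ x → ∑ λ y → δ x a * δ y b)
            ≡⟨ sym (∑-*-∑ (λ x → δ x a) (λ y → δ y b)) ⟩
          ∑ (λ x → δ x a) * ∑ (λ y → δ y b)
            ≡⟨ trans (cong₂ _*_ (∑-δ-1ʳ a) (∑-δ-1ʳ b)) (*-identityˡ 1ℤ) ⟩
          1ℤ ∎ }
      where open ≡-Reasoning

    Finite-Vec : {A : Set} {{X : Finite A}} {n : ℕ} → Finite (Vec A n)
    Finite-Vec {A} {{X}} {n} = record
      { list = vectors (Finite.list X) n ; _≟_ = Vec.≡-dec _≟_ ; once = once n }
      where
      open ≡-Reasoning
      once : ∀ n (v : Vec A n) → sum (vectors (Finite.list X) n) (λ x → 𝟙 (Vec.≡-dec _≟_ x v)) ≡ 1ℤ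
      once zero    []      = +-identityʳ 1ℤ
      once (suc n) (a ∷ v) = begin
        sum (cartesianProductWith _∷_ (Finite.list X) vs) (λ x → 𝟙 (Vec.≡-dec _≟_ x (a ∷ v)))
          ≡⟨ sum-cartesianProductWith _∷_ (Finite.list X) vs _ ⟩
        sum (Finite.list X) (λ x → sum vs λ y → 𝟙 (Vec.≡-dec _≟_ (x ∷ y) (a ∷ v)))
          ≡⟨ sum-cong (Finite.list X) (λ x → trans (sum-cong vs λ y → trans
               (𝟙-cong _ (x ≟ a ×-dec Vec.≡-dec _≟_ y v) (λ { refl → refl , refl }) (λ { (refl , refl) → refl }))
               (𝟙-× (x ≟ a) (Vec.≡-dec _≟_ y v)))
               (trans (sum-* vs (δ x a) _) (trans (cong (δ x a *_) (once n v)) (*-identityʳ (δ x a))))) ⟩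
        sum (Finite.list X) (λ x → δ x a)
          ≡⟨ list-once X a ⟩
        1ℤ ∎
        where vs = vectors (Finite.list X) n

  module _ {A B : Set} {{X : Finite A}} {{Y : Finite B}} where

    ∑-× : (f : A × B → ℤ) → ∑ f ≡ ∑ (λ x → ∑ λ y → f (x , y))
    ∑-× f = trans (∑-def f) (∑∑-def _,_ f)

  module _ {A : Set} {{X : Finite A}} where

    ∑-∷ : ∀ {n} (f : Vec A (suc n) → ℤ) → ∑ f ≡ ∑ (λ x → ∑ λ v → f (x ∷ v))
    ∑-∷ {n} f = trans (∑-def f) (∑∑-def _∷_ f)

    ∑-[] : (f : Vec A 0 → ℤ) → ∑ f ≡ f []
    ∑-[] f = trans (∑-def f) (+-identityʳ (f []))

    ∏ : ∀ {n} → (A → ℤ) → Vec A n → ℤ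
    ∏ f []      = 1ℤ
    ∏ f (x ∷ v) = f x * ∏ f v

    -- Distributivity. This is the source of all powers with exponent `suc k`: the tuples fixed by a
    -- motion, or carried by it from `E` into `E`, are counted by the power of the count for single
    -- points.
    ∑-∏ : ∀ n (f : A → ℤ) → ∑ (λ (v : Vec A n) → ∏ f v) ≡ ∑ f ^ n
    ∑-∏ zero    f = ∑-[] (∏ f)
    ∑-∏ (suc n) f = begin
      ∑ {Vec A (suc n)} (∏ f) ≡⟨ ∑-∷ (∏ f) ⟩
      ∑ (λ x → ∑ {Vec A n} λ v → f x * ∏ f v) ≡⟨ sym (∑-*-∑ f (∏ f)) ⟩
      ∑ f * ∑ {Vec A n} (∏ f) ≡⟨ cong (∑ f *_) (∑-∏ n f) ⟩
      ∑ f * ∑ f ^ n                            ∎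
      where open ≡-Reasoning

    ∣Vec∣ : ∀ n → ∣ Vec A n ∣ ≡ ∣ A ∣ ^ n
    ∣Vec∣ n = trans (∑-cong (λ v → ones v)) (∑-∏ n (const 1ℤ))
      where
      ones : ∀ {n} (v : Vec A n) → 1ℤ ≡ ∏ (const 1ℤ) v
      ones []      = refl
      ones (_ ∷ v) = trans (ones v) (sym (*-identityˡ _))

  -- True makes membership proof-irrelevant.
  Sub : {A : Set} {P : Pred A 0ℓ} → Decidable P → Set
  Sub P? = Σ _ λ a → True (P? a)

  private
    True-irr : {P : Set} (p : Dec P) (x y : True p) → x ≡ y
    True-irr (yes _) tt tt = refl

    True? : {P : Set} (p : Dec P) → Dec (True p)
    True? (yes _) = yes tt
    True? (no _)  = no λ ()

  module _ {A : Set} {P : Pred A 0ℓ} (P? : Decidable P) where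

    Sub-≡ : {x y : Sub P?} → proj₁ x ≡ proj₁ y → x ≡ y
    Sub-≡ {a , p} {.a , r} refl = cong (a ,_) (True-irr (P? a) p r)

    private
      single : ∀ x → Dec (True (P? x)) → List (Sub P?)
      single x (yes p) = (x , p) ∷ []
      single x (no _)  = []

      attach : List A → List (Sub P?)
      attach []       = []
      attach (x ∷ xs) = single x (True? (P? x)) ++ attach xs

      sum-single : ∀ x t (f : A → ℤ) → sum (single x t) (λ y → f (proj₁ y)) ≡ 𝟙 t * f x
      sum-single x (yes _) f = trans (+-identityʳ (f x)) (sym (*-identityˡ (f x)))
      sum-single x (no _)  f = sym (zeroˡ (f x))

      sum-attach : ∀ xs (f : A → ℤ) →
                   sum (attach xs) (λ y → f (proj₁ y)) ≡ sum xs (λ x → 𝟙 (P? x) * f x)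
      sum-attach []       f = refl
      sum-attach (x ∷ xs) f = trans (sum-++ (single x (True? (P? x))) _ _)
        (cong₂ _+_
          (trans (sum-single x (True? (P? x)) f) (cong (_* f x)
            (𝟙-cong (True? (P? x)) (P? x) toWitness fromWitness)))
          (sum-attach xs f))

    module _ {{X : Finite A}} where

      Finite-Sub : Finite (Sub P?)
      Finite-Sub = record
        { list = attach (Finite.list X)
        ; _≟_ = λ x y → map′ Sub-≡ (cong proj₁) (proj₁ x ≟ proj₁ y)
        ; once = λ (a , p) → begin
            sum (attach (Finite.list X)) (λ x → 𝟙 (map′ Sub-≡ (cong proj₁) (proj₁ x ≟ a)))
              ≡⟨ sum-cong (attach (Finite.list X)) (λ x → 𝟙-cong _ (proj₁ x ≟ a) (cong proj₁) Sub-≡) ⟩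
            sum (attach (Finite.list X)) (λ x → δ (proj₁ x) a)
              ≡⟨ trans (sum-attach (Finite.list X) (λ x → δ x a)) (sym (∑-def _)) ⟩
            ∑ (λ x → 𝟙 (P? x) * δ x a)
              ≡⟨ ∑-cong (λ x → *-comm (𝟙 (P? x)) (δ x a)) ⟩
            ∑ (λ x → δ x a * 𝟙 (P? x))
              ≡⟨ ∑-δ a (λ x → 𝟙 (P? x)) ⟩
            𝟙 (P? a)
              ≡⟨ 𝟙-yes (P? a) (toWitness p) ⟩
            1ℤ ∎ }
        where open ≡-Reasoning

  instance
    Finite-Bool : Finite Bool
    Finite-Bool = record
      { list = true ∷ false ∷ [] ; _≟_ = Bool._≟_
      ; once = λ { true  → solve 0 (con 1ℤ :+ (con 0ℤ :+ con 0ℤ) := con 1ℤ) refl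
                 ; false → solve 0 (con 0ℤ :+ (con 1ℤ :+ con 0ℤ) := con 1ℤ) refl } }

  ∣Bool∣ : ∣ Bool ∣ ≡ + 2
  ∣Bool∣ = trans (∑-def _) (solve 0 (con 1ℤ :+ (con 1ℤ :+ con 0ℤ) := con (+ 2)) refl)

  -- Vectors supported on a set of coordinates

  module Support {A : Set} {{_ : Finite A}} (a₀ : A) where

    -- `J` marks the free coordinates. The entries are of arbitrary type because the notion serves
    -- twice: for vectors over the field, and for matrices seen as vectors of columns.
    Supp : ∀ {n} → Vec Bool n → Vec A n → Set
    Supp []          []      = ⊤
    Supp (true ∷ J)  (a ∷ x) = Supp J x
    Supp (false ∷ J) (a ∷ x) = a ≡ a₀ × Supp J x

    supp? : ∀ {n} (J : Vec Bool n) → Decidable (Supp J)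
    supp? []          []      = yes tt
    supp? (true ∷ J)  (a ∷ x) = supp? J x
    supp? (false ∷ J) (a ∷ x) = a ≟ a₀ ×-dec supp? J x

    ∥_∥ : ∀ {n} → Vec Bool n → ℕ
    ∥ [] ∥        = 0
    ∥ true ∷ J ∥  = suc ∥ J ∥
    ∥ false ∷ J ∥ = ∥ J ∥

    ∣Supp∣ : ∀ {n} (J : Vec Bool n) → ∑ (λ x → 𝟙 (supp? J x)) ≡ ∣ A ∣ ^ ∥ J ∥
    ∣Supp∣ []          = ∑-[] _
    ∣Supp∣ (true ∷ J)  = trans (∑-∷ _) (trans (∑-cong λ a → ∣Supp∣ J) (trans (∑-const _) (*-comm _ ∣ A ∣)))
    ∣Supp∣ (false ∷ J) = trans (∑-∷ _) (trans
      (∑-cong λ a → trans (∑-cong λ x → 𝟙-× (a ≟ a₀) (supp? J x)) (trans (∑-* (δ a a₀) _) (cong (δ a a₀ *_) (∣Supp∣ J))))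
      (∑-δ a₀ λ _ → ∣ A ∣ ^ ∥ J ∥))

    mask : ∀ {n} → Vec Bool n → Vec A n → Vec A n
    mask []          []      = []
    mask (true ∷ J)  (a ∷ x) = a ∷ mask J x
    mask (false ∷ J) (a ∷ x) = a₀ ∷ mask J x

    mask-Supp : ∀ {n} (J : Vec Bool n) x → Supp J (mask J x)
    mask-Supp []          []      = tt
    mask-Supp (true ∷ J)  (a ∷ x) = mask-Supp J x
    mask-Supp (false ∷ J) (a ∷ x) = refl , mask-Supp J x

  -- Cauchy-Schwarz and representatives of classes

  sum-*ʳ : {A : Set} (xs : List A) (c : ℤ) (f : A → ℤ) → sum xs (λ x → f x * c) ≡ sum xs f * c
  sum-*ʳ xs c f = trans (sum-cong xs λ x → *-comm (f x) c) (trans (sum-* xs c f) (*-comm c _))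

  -- The double sum `E` of the squares of `f x - f y` is twice the difference of the two sides.
  cauchy-schwarz : {A : Set} (xs : List A) (f : A → ℤ) →
                   sum xs f * sum xs f ≤ + length xs * sum xs (λ x → f x * f x)
  cauchy-schwarz xs f = *-cancel {c = + 2} (+<+ (s≤s z≤n)) (≤-by E identity
      (0≤-sum xs λ x → 0≤-sum xs λ y → 0≤² (f x - f y)))
    where
    open ≡-Reasoning
    E  = sum xs λ x → sum xs λ y → (f x - f y) * (f x - f y)
    S  = sum xs f
    S₂ = sum xs λ x → f x * f x
    N  = + length xs
    sum-const : ∀ c → sum xs (λ _ → c) ≡ c * N
    sum-const c = trans (sum-cong xs λ _ → sym (*-identityʳ c)) (trans (sum-* xs c _) (cong (c *_) (sum-1 xs)))
    row : ∀ x → sum xs (λ y → (f x - f y) * (f x - f y)) ≡ N * (f x * f x) + (- (+ 2 * S)) * f x + S₂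
    row x = begin
      sum xs (λ y → (f x - f y) * (f x - f y))
        ≡⟨ sum-cong xs (λ y → solve 2 (λ a b → (a :- b) :* (a :- b) := a :* a :+ :- (con (+ 2) :* a) :* b :+ b :* b) refl (f x) (f y)) ⟩
      sum xs (λ y → f x * f x + (- (+ 2 * f x)) * f y + f y * f y)
        ≡⟨ trans (sum-+ xs (λ y → f x * f x + (- (+ 2 * f x)) * f y) _) (cong (_+ S₂) (trans (sum-+ xs (λ _ → f x * f x) _)
             (cong₂ _+_ (sum-const (f x * f x)) (sum-* xs (- (+ 2 * f x)) f)))) ⟩
      f x * f x * N + (- (+ 2 * f x)) * S + S₂
        ≡⟨ solve 4 (λ a m s t → a :* a :* m :+ :- (con (+ 2) :* a) :* s :+ t := m :* (a :* a) :+ :- (con (+ 2) :* s) :* a :+ t) refl (f x) N S S₂ ⟩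
      N * (f x * f x) + (- (+ 2 * S)) * f x + S₂ ∎
    total : E ≡ N * S₂ + (- (+ 2 * S)) * S + S₂ * N
    total = trans (sum-cong xs row) (trans (sum-+ xs (λ x → N * (f x * f x) + (- (+ 2 * S)) * f x) _)
      (cong₂ _+_ (trans (sum-+ xs (λ x → N * (f x * f x)) _) (cong₂ _+_ (sum-* xs N _) (sum-* xs (- (+ 2 * S)) f))) (sum-const S₂)))
    identity : + 2 * (N * S₂) ≡ + 2 * (S * S) + E
    identity = trans (solve 3 (λ m s t → con (+ 2) :* (m :* t) := con (+ 2) :* (s :* s) :+ (m :* t :+ :- (con (+ 2) :* s) :* s :+ t :* m)) refl N S S₂)
      (cong (_+_ (+ 2 * (S * S))) (sym total))

  module Representatives {X : Set} {_≈_ : Rel X 0ℓ} (≈? : Binary.Decidable _≈_) (equivalence : IsEquivalence _≈_) where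

    private module E = IsEquivalence equivalence

    reps : List X → List X
    reps = deduplicate ≈?

    -- If the head `x` is related to `y`, the later representatives, which are unrelated to `x`, are
    -- unrelated to `y` by transitivity.
    reps-≤1 : ∀ xs y → sum (reps xs) (λ r → 𝟙 (≈? r y)) ≤ 1ℤ
    reps-≤1 []       y = 0≤+
    reps-≤1 (x ∷ xs) y = subst (_≤ 1ℤ) (cong (_+_ (𝟙 (≈? x y))) (sym (sum-filter (λ r → ¬? (≈? x r)) (reps xs) _))) (go (≈? x y))
      where
      go : (d : Dec (x ≈ y)) → 𝟙 d + sum (reps xs) (λ r → 𝟙 (¬? (≈? x r)) * 𝟙 (≈? r y)) ≤ 1ℤ
      go (yes x≈y) = ℤ.≤-reflexive (trans (cong (_+_ 1ℤ) (trans
        (sum-cong (reps xs) λ r → trans (sym (𝟙-× (¬? (≈? x r)) (≈? r y)))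
          (𝟙-no (¬? (≈? x r) ×-dec ≈? r y) λ (x≉r , r≈y) → x≉r (E.trans x≈y (E.sym r≈y))))
        (sum-0 (reps xs)))) (+-identityʳ 1ℤ))
      go (no _) = subst (_≤ 1ℤ) (sym (+-identityˡ _)) (ℤ.≤-trans
        (sum-mono (reps xs) λ r → subst (𝟙 (¬? (≈? x r)) * 𝟙 (≈? r y) ≤_) (*-identityˡ _) (*-monoˡ (0≤𝟙 (≈? r y)) (𝟙≤1 (¬? (≈? x r)))))
        (reps-≤1 xs y))

    reps-≥1 : ∀ xs y → y ∈ xs → 1ℤ ≤ sum (reps xs) (λ r → 𝟙 (≈? r y))
    reps-≥1 (x ∷ xs) y y∈ = subst (1ℤ ≤_) (cong (_+_ (𝟙 (≈? x y))) (sym (sum-filter (λ r → ¬? (≈? x r)) (reps xs) _))) (go (≈? x y) y∈)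
      where
      rest = sum (reps xs) (λ r → 𝟙 (¬? (≈? x r)) * 𝟙 (≈? r y))
      go : (d : Dec (x ≈ y)) → y ∈ x ∷ xs → 1ℤ ≤ 𝟙 d + rest
      go (yes _)  _          = ≤-by rest refl (0≤-sum (reps xs) λ r → 0≤-* (0≤𝟙 (¬? (≈? x r))) (0≤𝟙 (≈? r y)))
      go (no x≉y) (here e)   = contradiction (subst (x ≈_) (sym e) E.refl) x≉y
      -- The filter removes no representative of `y`: one related to `x` would relate `x` to `y`.
      go (no x≉y) (there y∈) = subst (1ℤ ≤_) (trans (sum-cong (reps xs) λ r →
        trans (sym (*-identityˡ _)) (trans (*-comm 1ℤ _) (trans (𝟙-* (≈? r y) λ r≈y →
          sym (𝟙-yes (¬? (≈? x r)) λ x≈r → x≉y (E.trans x≈r r≈y))) (*-comm (𝟙 (≈? r y)) _)))) (sym (+-identityˡ rest))) (reps-≥1 xs y y∈)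

  -- The expander mixing lemma for the incidence relation Ψ p h ≡ b₀, when any two
  -- distinct points agree under Ψ in the expected number of blocks.
  module _ {P : Set} {{_ : Finite P}} {B : Set} {{_ : Finite B}} (Ψ : P → P → B) (b₀ : B)
           (g : P → ℤ) (∑g≡0 : ∑ g ≡ 0ℤ) (m q : ℤ) (0<m : 0ℤ < m) (0<q : 0ℤ < q)
           (agree : ∀ p p′ → q * ∑ (λ h → δ (Ψ p h) (Ψ p′ h)) ≡ m * m + (q - 1ℤ) * (m * m * δ p p′))
           where

    private
      i : P → B → ℤ
      i h c = ∑ λ p → g p * δ (Ψ p h) c

      G = ∑ λ p → g p * g p

      -- Expanding the square reduces this to `agree` for each pair of points. The part `m * m` of
      -- `agree` is the same for all pairs and drops out because `g` has sum zero; only the diagonal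
      -- survives.
      second-moment : q * ∑ (λ h → ∑ λ c → i h c * i h c) ≡ (q - 1ℤ) * (m * m) * G
      second-moment = begin
        q * ∑ (λ h → ∑ λ c → i h c * i h c) ≡⟨ cong (q *_) (∑-cong inner) ⟩
        q * ∑ (λ h → ∑ λ p → ∑ λ p′ → g p * (g p′ * δ (Ψ p h) (Ψ p′ h)))
          ≡⟨ cong (q *_) (trans (∑-swap λ h p → ∑ λ p′ → g p * (g p′ * δ (Ψ p h) (Ψ p′ h)))
                                                                          (∑-cong λ p → ∑-swap λ h p′ → g p * (g p′ * δ (Ψ p h) (Ψ p′ h)))) ⟩
        q * ∑ (λ p → ∑ λ p′ → ∑ λ h → g p * (g p′ * δ (Ψ p h) (Ψ p′ h)))
          ≡⟨ trans (sym (∑-* q _)) (∑-cong λ p → trans (sym (∑-* q _)) (∑-cong λ p′ → count p p′)) ⟩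
        ∑ (λ p → ∑ λ p′ → m * m * (g p * g p′) + (q - 1ℤ) * (m * m) * (δ p p′ * (g p * g p′)))
          ≡⟨ ∑-cong (λ p → trans (∑-+ (λ p′ → m * m * (g p * g p′)) _)
               (cong₂ _+_ (trans (∑-* (m * m) _) (trans (cong (m * m *_) (trans (∑-* (g p) g) (cong (g p *_) ∑g≡0))) (solve 2 (λ a b → a :* (b :* con 0ℤ) := con 0ℤ) refl (m * m) (g p))))
                 (trans (∑-* ((q - 1ℤ) * (m * m)) _) (cong ((q - 1ℤ) * (m * m) *_) (∑-δ′ p λ p′ → g p * g p′))))) ⟩
        ∑ (λ p → 0ℤ + (q - 1ℤ) * (m * m) * (g p * g p)) ≡⟨ ∑-cong (λ p → +-identityˡ _) ⟩
        ∑ (λ p → (q - 1ℤ) * (m * m) * (g p * g p)) ≡⟨ ∑-* ((q - 1ℤ) * (m * m)) (λ p → g p * g p) ⟩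
        (q - 1ℤ) * (m * m) * G                                       ∎
        where
        open ≡-Reasoning
        inner : ∀ h → ∑ (λ c → i h c * i h c) ≡ ∑ λ p → ∑ λ p′ → g p * (g p′ * δ (Ψ p h) (Ψ p′ h))
        inner h = begin
          ∑ (λ c → i h c * i h c)
            ≡⟨ ∑-cong (λ c → ∑-*-∑ (λ p → g p * δ (Ψ p h) c) (λ p → g p * δ (Ψ p h) c)) ⟩
          ∑ (λ c → ∑ λ p → ∑ λ p′ → g p * δ (Ψ p h) c * (g p′ * δ (Ψ p′ h) c))
            ≡⟨ trans (∑-swap λ c p → ∑ λ p′ → g p * δ (Ψ p h) c * (g p′ * δ (Ψ p′ h) c))
                 (∑-cong λ p → ∑-swap λ c p′ → g p * δ (Ψ p h) c * (g p′ * δ (Ψ p′ h) c)) ⟩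
          ∑ (λ p → ∑ λ p′ → ∑ λ c → g p * δ (Ψ p h) c * (g p′ * δ (Ψ p′ h) c))
            ≡⟨ ∑-cong (λ p → ∑-cong λ p′ → trans
                 (∑-cong λ c → solve 4 (λ a b c d → a :* b :* (c :* d) := b :* (a :* (c :* d))) refl (g p) (δ (Ψ p h) c) (g p′) (δ (Ψ p′ h) c))
                 (trans (∑-δ′ (Ψ p h) λ c → g p * (g p′ * δ (Ψ p′ h) c)) (cong (λ t → g p * (g p′ * t)) (δ-sym (Ψ p′ h) (Ψ p h))))) ⟩
          ∑ (λ p → ∑ λ p′ → g p * (g p′ * δ (Ψ p h) (Ψ p′ h))) ∎
        count : ∀ p p′ → q * ∑ (λ h → g p * (g p′ * δ (Ψ p h) (Ψ p′ h)))
                       ≡ m * m * (g p * g p′) + (q - 1ℤ) * (m * m) * (δ p p′ * (g p * g p′))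
        count p p′ = begin
          q * ∑ (λ h → g p * (g p′ * δ (Ψ p h) (Ψ p′ h)))
            ≡⟨ cong (q *_) (trans (∑-* (g p) _) (cong (g p *_) (∑-* (g p′) _))) ⟩
          q * (g p * (g p′ * ∑ λ h → δ (Ψ p h) (Ψ p′ h)))
            ≡⟨ solve 4 (λ q a b s → q :* (a :* (b :* s)) := a :* b :* (q :* s)) refl q (g p) (g p′) _ ⟩
          g p * g p′ * (q * ∑ λ h → δ (Ψ p h) (Ψ p′ h))
            ≡⟨ cong (g p * g p′ *_) (agree p p′) ⟩
          g p * g p′ * (m * m + (q - 1ℤ) * (m * m * δ p p′))
            ≡⟨ solve 4 (λ a m r d → a :* (m :+ r :* (m :* d)) := m :* a :+ r :* m :* (d :* a)) refl (g p * g p′) (m * m) (q - 1ℤ) (δ p p′) ⟩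
          m * m * (g p * g p′) + (q - 1ℤ) * (m * m) * (δ p p′ * (g p * g p′)) ∎

      0≤m = ℤ.<⇒≤ 0<m

      0≤G : 0ℤ ≤ G
      0≤G = 0≤-∑ λ p → 0≤² (g p)

      second-moment-≤ : ∑ (λ h → ∑ λ c → i h c * i h c) ≤ m * m * G
      second-moment-≤ = *-cancel 0<q (≤-by (m * m * G)
        (trans (solve 2 (λ q a → q :* a := (q :- con 1ℤ) :* a :+ a) refl q (m * m * G))
          (cong (_+ m * m * G) (trans (sym (*-assoc _ _ G)) (sym second-moment))))
        (0≤-* (0≤-* 0≤m 0≤m) 0≤G))

    -- Expanding the squares of `m * g h - i h b₀` bounds `2 m X` by `m² G` plus the second moment
    -- at `b₀`, which is at most the one over all blocks. This replaces Cauchy-Schwarz and avoids a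
    -- square root.
    mixing : ∑ (λ p → ∑ λ h → g p * g h * δ (Ψ p h) b₀) ≤ m * G
    mixing = *-cancel {c = + 2 * m} (0<-* (+<+ (s≤s z≤n)) 0<m) (begin
      + 2 * m * X
        ≤⟨ ≤-by _ refl (0≤-∑ λ h → 0≤² (m * g h - i h b₀)) ⟩
      + 2 * m * X + ∑ (λ h → (m * g h - i h b₀) * (m * g h - i h b₀))
        ≡⟨ cong (_+_ (+ 2 * m * X)) square ⟩
      + 2 * m * X + (m * m * G + (- (+ 2 * m)) * X + ∑ λ h → i h b₀ * i h b₀)
        ≤⟨ +-mono-≤ (≤-refl {+ 2 * m * X}) (+-mono-≤ (≤-refl {m * m * G + (- (+ 2 * m)) * X})
             (ℤ.≤-trans (∑-mono λ h → ∑-single b₀ λ c → 0≤² (i h c)) second-moment-≤)) ⟩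
      + 2 * m * X + (m * m * G + (- (+ 2 * m)) * X + m * m * G)
        ≡⟨ solve 3 (λ m x g → con (+ 2) :* m :* x :+ (m :* m :* g :+ :- (con (+ 2) :* m) :* x :+ m :* m :* g) := con (+ 2) :* m :* (m :* g)) refl m X G ⟩
      + 2 * m * (m * G) ∎)
      where
      open ℤ.≤-Reasoning
      X = ∑ (λ p → ∑ λ h → g p * g h * δ (Ψ p h) b₀)
      X≡ : ∑ (λ h → g h * i h b₀) ≡ X
      X≡ = trans (∑-cong λ h → trans (sym (∑-* (g h) _)) (∑-cong λ p →
          solve 3 (λ a b d → a :* (b :* d) := b :* a :* d) refl (g h) (g p) (δ (Ψ p h) b₀)))
        (∑-swap λ h p → g p * g h * δ (Ψ p h) b₀)
      square : ∑ (λ h → (m * g h - i h b₀) * (m * g h - i h b₀)) ≡ m * m * G + (- (+ 2 * m)) * X + ∑ λ h → i h b₀ * i h b₀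
      square = trans (∑-cong λ h → solve 3 (λ m g i → (m :* g :- i) :* (m :* g :- i) := m :* m :* (g :* g) :+ :- (con (+ 2) :* m) :* (g :* i) :+ i :* i) refl m (g h) (i h b₀))
        (trans (∑-+ (λ h → m * m * (g h * g h) + (- (+ 2 * m)) * (g h * i h b₀)) _) (cong (_+ ∑ (λ h → i h b₀ * i h b₀))
          (trans (∑-+ (λ h → m * m * (g h * g h)) _) (cong₂ _+_ (∑-* (m * m) _) (trans (∑-* (- (+ 2 * m)) _) (cong ((- (+ 2 * m)) *_) X≡))))))

  -- Finite fields of odd order

  module FromℤHom (R : CommutativeRing 0ℓ 0ℓ) where

    open CommutativeRing R using (Carrier; 0#; 1#; _≈_; ring; semiring; setoid; +-cong; +-congˡ; +-congʳ; *-cong; -‿cong)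
      renaming (_+_ to _+ᴿ_; _*_ to _*ᴿ_; -_ to -ᴿ_)
    private module R = CommutativeRing R
    open Algebra.Properties.Ring ring
    open Algebra.Properties.Semiring.Mult.TCOptimised semiring renaming (_×_ to _×ᴿ_)
    open import Relation.Binary.Reasoning.Setoid setoid

    -- With the optimised multiples `fromℤ (+ 2)` computes to `1# + 1#`, so that `con (+ 2)` in a
    -- solver equation over the field denotes `2F`.
    fromℤ : ℤ → Carrier
    fromℤ (+ n)    = n ×ᴿ 1#
    fromℤ -[1+ n ] = -ᴿ (suc n ×ᴿ 1#)

    private
      neg : ∀ a → fromℤ (ℤ.- a) ≈ -ᴿ (fromℤ a)
      neg (+ 0)     = R.sym -0#≈0#
      neg (+ suc n) = R.refl
      neg -[1+ n ]  = R.sym (-‿involutive _)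

      ⊖-homo : ∀ m n → fromℤ (m ⊖ n) ≈ (m ×ᴿ 1#) +ᴿ (-ᴿ (n ×ᴿ 1#))
      ⊖-homo m       zero    = R.sym (R.trans (+-congˡ -0#≈0#) (R.+-identityʳ _))
      ⊖-homo zero    (suc n) = R.sym (R.+-identityˡ _)
      ⊖-homo (suc m) (suc n) = begin
        fromℤ (suc m ⊖ suc n) ≡⟨ cong fromℤ (ℤ.[1+m]⊖[1+n]≡m⊖n m n) ⟩
        fromℤ (m ⊖ n) ≈⟨ ⊖-homo m n ⟩
        (m ×ᴿ 1#) +ᴿ (-ᴿ (n ×ᴿ 1#)) ≈⟨ +-congʳ (R.+-identityˡ _) ⟨
        (0# +ᴿ (m ×ᴿ 1#)) +ᴿ (-ᴿ (n ×ᴿ 1#)) ≈⟨ +-congʳ (+-congʳ (R.-‿inverseʳ 1#)) ⟨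
        ((1# +ᴿ (-ᴿ 1#)) +ᴿ (m ×ᴿ 1#)) +ᴿ (-ᴿ (n ×ᴿ 1#))
          ≈⟨ +-congʳ (R.trans (R.+-assoc _ _ _) (R.trans (+-congˡ (R.+-comm _ _)) (R.sym (R.+-assoc _ _ _)))) ⟩
        ((1# +ᴿ (m ×ᴿ 1#)) +ᴿ (-ᴿ 1#)) +ᴿ (-ᴿ (n ×ᴿ 1#)) ≈⟨ R.+-assoc _ _ _ ⟩
        (1# +ᴿ (m ×ᴿ 1#)) +ᴿ ((-ᴿ 1#) +ᴿ (-ᴿ (n ×ᴿ 1#)))
          ≈⟨ +-cong (1+× m 1#) (R.trans (-‿cong (1+× n 1#)) (R.sym (-‿+-comm _ _))) ⟨
        (suc m ×ᴿ 1#) +ᴿ (-ᴿ (suc n ×ᴿ 1#))                 ∎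

      add : ∀ a b → fromℤ (a ℤ.+ b) ≈ fromℤ a +ᴿ fromℤ b
      add (+ m)    (+ n)    = ×-homo-+ 1# m n
      add (+ m)    -[1+ n ] = ⊖-homo m (suc n)
      add -[1+ m ] (+ n)    = R.trans (⊖-homo n (suc m)) (R.+-comm _ _)
      add -[1+ m ] -[1+ n ] = begin
        -ᴿ (suc (suc (m ℕ.+ n)) ×ᴿ 1#) ≡⟨ cong (λ k → -ᴿ (suc k ×ᴿ 1#)) (ℕ.+-suc m n) ⟨
        -ᴿ ((suc m ℕ.+ suc n) ×ᴿ 1#) ≈⟨ -‿cong (×-homo-+ 1# (suc m) (suc n)) ⟩
        -ᴿ ((suc m ×ᴿ 1#) +ᴿ (suc n ×ᴿ 1#)) ≈⟨ -‿+-comm _ _ ⟨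
        (-ᴿ (suc m ×ᴿ 1#)) +ᴿ (-ᴿ (suc n ×ᴿ 1#))  ∎

      mul⁺ : ∀ m b → fromℤ (+ m ℤ.* b) ≈ fromℤ (+ m) *ᴿ fromℤ b
      mul⁺ m (+ n) = R.trans (R.reflexive (cong fromℤ (sym (ℤ.pos-* m n)))) (×1-homo-* m n)
      mul⁺ m -[1+ n ] = begin
        fromℤ (+ m ℤ.* (ℤ.- + suc n)) ≡⟨ cong fromℤ (ℤ.neg-distribʳ-* (+ m) (+ suc n)) ⟨
        fromℤ (ℤ.- (+ m ℤ.* + suc n)) ≈⟨ neg (+ m ℤ.* + suc n) ⟩
        -ᴿ fromℤ (+ m ℤ.* + suc n) ≈⟨ -‿cong (mul⁺ m (+ suc n)) ⟩
        -ᴿ (fromℤ (+ m) *ᴿ fromℤ (+ suc n)) ≈⟨ -‿distribʳ-* _ _ ⟩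
        fromℤ (+ m) *ᴿ fromℤ -[1+ n ]          ∎

      mul : ∀ a b → fromℤ (a ℤ.* b) ≈ fromℤ a *ᴿ fromℤ b
      mul (+ m)    b = mul⁺ m b
      mul -[1+ m ] b = begin
        fromℤ (ℤ.- + suc m ℤ.* b) ≡⟨ cong fromℤ (ℤ.neg-distribˡ-* (+ suc m) b) ⟨
        fromℤ (ℤ.- (+ suc m ℤ.* b)) ≈⟨ neg (+ suc m ℤ.* b) ⟩
        -ᴿ fromℤ (+ suc m ℤ.* b) ≈⟨ -‿cong (mul⁺ (suc m) b) ⟩
        -ᴿ (fromℤ (+ suc m) *ᴿ fromℤ b) ≈⟨ -‿distribˡ-* _ _ ⟩
        fromℤ -[1+ m ] *ᴿ fromℤ b              ∎

    fromℤ-hom : ℤ.+-*-rawRing -Raw-AlmostCommutative⟶ fromCommutativeRing R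
    fromℤ-hom = record
      { ⟦_⟧ = fromℤ ; +-homo = add ; *-homo = mul ; -‿homo = neg
      ; 0-homo = R.refl ; 1-homo = R.refl }

  2∣p^n⇒2∣p : ∀ p n → 2 ℕ.∣ p ℕ.^ n → 2 ℕ.∣ p
  2∣p^n⇒2∣p p zero    2∣1 = contradiction (∣1⇒≡1 2∣1) λ ()
  2∣p^n⇒2∣p p (suc n) 2∣ with euclidsLemma p (p ℕ.^ n) (from-yes (prime? 2)) 2∣
  ... | inj₁ 2∣p = 2∣p
  ... | inj₂ 2∣  = 2∣p^n⇒2∣p p n 2∣

  odd : ∀ {q p n} → Prime p → p ≢ 2 → q ≡ p ℕ.^ n → ¬ 2 ℕ.∣ q
  odd {p = p} {n} p-prime p≢2 refl 2∣q
    with prime⇒irreducible p-prime (2∣p^n⇒2∣p p n 2∣q)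
  ... | inj₂ 2≡p = p≢2 (sym 2≡p)

  tabulate-once : ∀ {A : Set} {n} (_≟_ : (x y : A) → Dec (x ≡ y)) (g : Fin n → A) →
    (∀ {i j} → g i ≡ g j → i ≡ j) → ∀ i →
    sum (tabulate g) (λ x → 𝟙 (x ≟ g i)) ≡ 1ℤ
  tabulate-once _≟_ g inj zero    =
    trans (cong₂ _+_ (𝟙-yes (g zero ≟ g zero) refl) (rest (λ j → g (suc j)) λ j e → contradiction (inj e) λ ()))
      (+-identityʳ 1ℤ)
    where
    rest : ∀ {m} (h : Fin m → _) → (∀ j → h j ≢ g zero) → sum (tabulate h) (λ x → 𝟙 (x ≟ g zero)) ≡ 0ℤ
    rest {zero}  h ne = refl
    rest {suc m} h ne = trans (cong₂ _+_ (𝟙-no (h zero ≟ g zero) (ne zero)) (rest (λ j → h (suc j)) λ j → ne (suc j)))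
      (+-identityʳ 0ℤ)
  tabulate-once _≟_ g inj (suc i) =
    trans (cong₂ _+_ (𝟙-no (g zero ≟ g (suc i)) λ e → contradiction (inj e) λ ())
                     (tabulate-once _≟_ (λ j → g (suc j)) (λ e → Fin.suc-injective (inj e)) i))
      (+-identityˡ 1ℤ)

  module Field {q : ℕ} (F : FiniteField q) where

    open FiniteField F public using (_·_; enumeration)
      renaming (Carrier to K; _+_ to _⊞_; -_ to ⊟_; 0# to 0F; 1# to 1F)
    private module H = IsHeytingField (FiniteField.isHeytingField F) using (isCommutativeRing; #⇒invertible; invertible⇒#)

    K-ring : CommutativeRing 0ℓ 0ℓ
    K-ring = record { isCommutativeRing = H.isCommutativeRing }

    private module K = CommutativeRing K-ring
              using (+-assoc; +-identityʳ; -‿inverseˡ; *-assoc; *-comm; *-identityˡ; zeroʳ)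

    open RingSolver K-ring (FromℤHom.fromℤ-hom K-ring) public renaming (solve to solveᴷ)

    instance
      Finite-K : Finite K
      Finite-K = record
        { list = tabulate (Inverse.from enumeration)
        ; _≟_  = via-injection (↔⇒↣ enumeration) Fin._≟_
        ; once = λ a → subst (λ b → sum (tabulate (Inverse.from enumeration))
                   (λ x → 𝟙 (via-injection (↔⇒↣ enumeration) Fin._≟_ x b)) ≡ 1ℤ)
                 (Inverse.strictlyInverseʳ enumeration a)
                 (tabulate-once (via-injection (↔⇒↣ enumeration) Fin._≟_) (Inverse.from enumeration)
                   (λ {i} {j} e → trans (sym (Inverse.strictlyInverseˡ enumeration i))
                      (trans (cong (Inverse.to enumeration) e) (Inverse.strictlyInverseˡ enumeration j)))
                   (Inverse.to enumeration a)) }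

    ∣K∣ : ∣ K ∣ ≡ + q
    ∣K∣ = trans (∑-def _) (trans (sum-1 (tabulate (Inverse.from enumeration))) (cong +_ (List.length-tabulate _)))

    inverse : ∀ {x} → x ≢ 0F → ∃ λ y → y · x ≡ 1F
    -- A Heyting field inverts the difference `x - 0`; the zero has to be removed.
    inverse {x} x≢0 with y , yx≡1 , _ ← H.#⇒invertible x≢0
      = y , trans (solveᴷ 2 (λ x y → y :* x := y :* (x :- con 0ℤ)) refl x y) yx≡1

    1≢0 : 1F ≢ 0F
    1≢0 = H.invertible⇒# (1F , lem , trans (K.*-comm _ 1F) lem)
      where
      lem : 1F · (1F ⊞ ⊟ 0F) ≡ 1F
      lem = solveᴷ 0 (con 1ℤ :* (con 1ℤ :- con 0ℤ) := con 1ℤ) refl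

    cancel : ∀ {x y z} → x ≢ 0F → x · y ≡ x · z → y ≡ z
    cancel {x} {y} {z} x≢0 e with x⁻¹ , inv ← inverse x≢0 = begin
      y ≡⟨ sym (*-identityˡ′ y) ⟩
      1F · y ≡⟨ cong (_· y) (sym inv) ⟩
      x⁻¹ · x · y ≡⟨ K.*-assoc _ _ _ ⟩
      x⁻¹ · (x · y) ≡⟨ cong (x⁻¹ ·_) e ⟩
      x⁻¹ · (x · z) ≡⟨ sym (K.*-assoc _ _ _) ⟩
      x⁻¹ · x · z ≡⟨ cong (_· z) inv ⟩
      1F · z ≡⟨ *-identityˡ′ z ⟩
      z              ∎
      where
      open ≡-Reasoning
      *-identityˡ′ = K.*-identityˡ

    ·-≢0 : ∀ {x y} → x ≢ 0F → y ≢ 0F → x · y ≢ 0F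
    ·-≢0 {x} {y} x≢0 y≢0 e = y≢0 (cancel x≢0 (trans e (sym (K.zeroʳ x))))

    ≡0-zero-product : ∀ {x y} → x · y ≡ 0F → y ≢ 0F → x ≡ 0F
    ≡0-zero-product {x} e y≢0 with x ≟ 0F
    ... | yes x≡0 = x≡0
    ... | no x≢0  = contradiction e (·-≢0 x≢0 y≢0)

    2F : K
    2F = 1F ⊞ 1F

    -- If 1 + 1 = 0, then x ↦ x + 1 is an involution without fixed points.
    2≢0 : ¬ 2 ℕ.∣ q → 2F ≢ 0F
    2≢0 q-odd 2≡0 = q-odd (divides ℤ.∣ m ∣ (begin
      q ≡⟨ cong ℤ.∣_∣ (trans (sym ∣K∣) count) ⟩
      ℤ.∣ + 2 * m ∣ ≡⟨ cong ℤ.∣_∣ (sym (*-homo (+ 2) m)) ⟩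
      ℤ.∣ + 2 ℤ.* m ∣ ≡⟨ ℤ.abs-* (+ 2) m ⟩
      2 ℕ.* ℤ.∣ m ∣ ≡⟨ ℕ.*-comm 2 ℤ.∣ m ∣ ⟩
      ℤ.∣ m ∣ ℕ.* 2     ∎))
      where
      open ≡-Reasoning
      idx : K → Fin q
      idx = Inverse.to enumeration
      σ : K → K
      σ x = x ⊞ 1F
      σσ : ∀ x → σ (σ x) ≡ x
      σσ x = trans (K.+-assoc x 1F 1F) (trans (cong (x ⊞_) 2≡0) (K.+-identityʳ x))
      σ≢ : ∀ x → σ x ≢ x
      σ≢ x e = 1≢0 (trans (solveᴷ 1 (λ x → con 1ℤ := :- x :+ (x :+ con 1ℤ)) refl x)
                   (trans (cong (⊟ x ⊞_) e) (K.-‿inverseˡ x)))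
      -- Of each pair `x`, `σ x` exactly one precedes the other in the enumeration, so `m` counts
      -- the pairs.
      less : K → K → ℤ
      less x y = 𝟙 (idx x Fin.<? idx y)
      m = ∑ λ x → less x (σ x)
      split : ∀ x → 1ℤ ≡ less x (σ x) + less (σ x) x
      split x with idx x Fin.<? idx (σ x) | idx (σ x) Fin.<? idx x
      ... | yes p | yes r = contradiction p (ℕ.<-asym r)
      ... | yes p | no _  = sym (+-identityʳ 1ℤ)
      ... | no _  | yes r = sym (+-identityˡ 1ℤ)
      ... | no ¬p | no ¬r = contradiction
        (trans (sym (Inverse.strictlyInverseʳ enumeration (σ x)))
          (trans (cong (Inverse.from enumeration) (Fin.toℕ-injective (ℕ.≤-antisym (ℕ.≮⇒≥ ¬p) (ℕ.≮⇒≥ ¬r))))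
            (Inverse.strictlyInverseʳ enumeration x))) (σ≢ x)
      count : ∣ K ∣ ≡ + 2 * m
      count = begin
        ∣ K ∣ ≡⟨ ∑-cong split ⟩
        ∑ (λ x → less x (σ x) + less (σ x) x) ≡⟨ ∑-+ (λ x → less x (σ x)) (λ x → less (σ x) x) ⟩
        m + ∑ (λ x → less (σ x) x) ≡⟨ cong (_+_ m) (∑-cong λ x → cong (less (σ x)) (sym (σσ x))) ⟩
        m + ∑ (λ x → less (σ x) (σ (σ x))) ≡⟨ cong (_+_ m) (∑-bij σ σ σσ σσ (λ x → less x (σ x))) ⟩
        m + m ≡⟨ solve 1 (λ m → m :+ m := con (+ 2) :* m) refl m ⟩
        + 2 * m                                       ∎

    -- Quadratic spaces

    infixl 6 _⊕_ _⊝_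
    infixl 9 _✶_
    infix  8 _•_

    _⊕_ _⊝_ : ∀ {n} → Vec K n → Vec K n → Vec K n
    _⊕_ = zipWith _⊞_
    _⊝_ = zipWith λ a b → a ⊞ ⊟ b

    _✶_ : ∀ {n} → K → Vec K n → Vec K n
    a ✶ x = Vec.map (a ·_) x

    𝟎 : ∀ {n} → Vec K n
    𝟎 = replicate _ 0F

    _•_ : ∀ {n} → Vec K n → Vec K n → K
    _•_ {n} = Space._•_ F n

    Q : ∀ {n} → Vec K n → K
    Q x = x • x

    ⊕-comm : ∀ {n} (x y : Vec K n) → x ⊕ y ≡ y ⊕ x
    ⊕-comm []      []      = refl
    ⊕-comm (a ∷ x) (b ∷ y) = cong₂ _∷_ (solveᴷ 2 (λ a b → a :+ b := b :+ a) refl a b) (⊕-comm x y)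

    ⊕-assoc : ∀ {n} (x y z : Vec K n) → (x ⊕ y) ⊕ z ≡ x ⊕ (y ⊕ z)
    ⊕-assoc []      []      []      = refl
    ⊕-assoc (a ∷ x) (b ∷ y) (c ∷ z) =
      cong₂ _∷_ (solveᴷ 3 (λ a b c → a :+ b :+ c := a :+ (b :+ c)) refl a b c) (⊕-assoc x y z)

    ⊕-identityʳ : ∀ {n} (x : Vec K n) → x ⊕ 𝟎 ≡ x
    ⊕-identityʳ []      = refl
    ⊕-identityʳ (a ∷ x) = cong₂ _∷_ (solveᴷ 1 (λ a → a :+ con 0ℤ := a) refl a) (⊕-identityʳ x)

    ⊕-identityˡ : ∀ {n} (x : Vec K n) → 𝟎 ⊕ x ≡ x
    ⊕-identityˡ x = trans (⊕-comm 𝟎 x) (⊕-identityʳ x)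

    ⊝-⊕ : ∀ {n} (x y : Vec K n) → (x ⊝ y) ⊕ y ≡ x
    ⊝-⊕ []      []      = refl
    ⊝-⊕ (a ∷ x) (b ∷ y) = cong₂ _∷_ (solveᴷ 2 (λ a b → a :- b :+ b := a) refl a b) (⊝-⊕ x y)

    ⊕-⊝ : ∀ {n} (x y : Vec K n) → (x ⊕ y) ⊝ y ≡ x
    ⊕-⊝ []      []      = refl
    ⊕-⊝ (a ∷ x) (b ∷ y) = cong₂ _∷_ (solveᴷ 2 (λ a b → a :+ b :- b := a) refl a b) (⊕-⊝ x y)

    ⊝-self : ∀ {n} (x : Vec K n) → x ⊝ x ≡ 𝟎
    ⊝-self []      = refl
    ⊝-self (a ∷ x) = cong₂ _∷_ (solveᴷ 1 (λ a → a :- a := con 0ℤ) refl a) (⊝-self x)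

    ⊝-⊝ : ∀ {n} (x y : Vec K n) → x ⊝ (x ⊝ y) ≡ y
    ⊝-⊝ []      []      = refl
    ⊝-⊝ (a ∷ x) (b ∷ y) = cong₂ _∷_ (solveᴷ 2 (λ a b → a :- (a :- b) := b) refl a b) (⊝-⊝ x y)

    ⊝-def : ∀ {n} (x y : Vec K n) → x ⊝ y ≡ x ⊕ (⊟ 1F) ✶ y
    ⊝-def []      []      = refl
    ⊝-def (a ∷ x) (b ∷ y) =
      cong₂ _∷_ (solveᴷ 2 (λ a b → a :- b := a :+ :- con 1ℤ :* b) refl a b) (⊝-def x y)

    ⊝≡𝟎 : ∀ {n} {x y : Vec K n} → x ⊝ y ≡ 𝟎 → x ≡ y
    ⊝≡𝟎 {x = x} {y} e = trans (sym (⊝-⊕ x y)) (trans (cong (_⊕ y) e) (⊕-identityˡ y))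

    ⊕-cancelʳ : ∀ {n} {x y : Vec K n} z → x ⊕ z ≡ y ⊕ z → x ≡ y
    ⊕-cancelʳ {x = x} {y} z e = trans (sym (⊕-⊝ x z)) (trans (cong (_⊝ z) e) (⊕-⊝ y z))

    neg-✶ : ∀ {n} (x : Vec K n) → Vec.map ⊟_ x ≡ (⊟ 1F) ✶ x
    neg-✶ []      = refl
    neg-✶ (a ∷ x) = cong₂ _∷_ (solveᴷ 1 (λ a → :- a := :- con 1ℤ :* a) refl a) (neg-✶ x)

    0✶ : ∀ {n} (x : Vec K n) → 0F ✶ x ≡ 𝟎
    0✶ []      = refl
    0✶ (a ∷ x) = cong₂ _∷_ (solveᴷ 1 (λ a → con 0ℤ :* a := con 0ℤ) refl a) (0✶ x)

    1✶ : ∀ {n} (x : Vec K n) → 1F ✶ x ≡ x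
    1✶ []      = refl
    1✶ (a ∷ x) = cong₂ _∷_ (solveᴷ 1 (λ a → con 1ℤ :* a := a) refl a) (1✶ x)

    ✶-𝟎 : ∀ {n} a → a ✶ 𝟎 {n} ≡ 𝟎
    ✶-𝟎 {zero}  a = refl
    ✶-𝟎 {suc n} a = cong₂ _∷_ (solveᴷ 1 (λ a → a :* con 0ℤ := con 0ℤ) refl a) (✶-𝟎 a)

    ✶-✶ : ∀ {n} a b (x : Vec K n) → a ✶ (b ✶ x) ≡ (a · b) ✶ x
    ✶-✶ a b []      = refl
    ✶-✶ a b (c ∷ x) = cong₂ _∷_ (solveᴷ 3 (λ a b c → a :* (b :* c) := a :* b :* c) refl a b c) (✶-✶ a b x)

    ✶-⊕ : ∀ {n} a (x y : Vec K n) → a ✶ (x ⊕ y) ≡ a ✶ x ⊕ a ✶ y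
    ✶-⊕ a []      []      = refl
    ✶-⊕ a (b ∷ x) (c ∷ y) = cong₂ _∷_ (solveᴷ 3 (λ a b c → a :* (b :+ c) := a :* b :+ a :* c) refl a b c) (✶-⊕ a x y)

    ✶-⊞ : ∀ {n} a b (x : Vec K n) → (a ⊞ b) ✶ x ≡ a ✶ x ⊕ b ✶ x
    ✶-⊞ a b []      = refl
    ✶-⊞ a b (c ∷ x) = cong₂ _∷_ (solveᴷ 3 (λ a b c → (a :+ b) :* c := a :* c :+ b :* c) refl a b c) (✶-⊞ a b x)

    •-comm : ∀ {n} (x y : Vec K n) → x • y ≡ y • x
    •-comm []      []      = refl
    •-comm (a ∷ x) (b ∷ y) = trans (cong (a · b ⊞_) (•-comm x y))
      (solveᴷ 3 (λ a b s → a :* b :+ s := b :* a :+ s) refl a b (y • x))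

    •-⊕ : ∀ {n} (x y z : Vec K n) → (x ⊕ y) • z ≡ x • z ⊞ y • z
    •-⊕ []      []      []      = solveᴷ 0 (con 0ℤ := con 0ℤ :+ con 0ℤ) refl
    •-⊕ (a ∷ x) (b ∷ y) (c ∷ z) = trans (cong ((a ⊞ b) · c ⊞_) (•-⊕ x y z))
      (solveᴷ 5 (λ a b c s t → (a :+ b) :* c :+ (s :+ t) := a :* c :+ s :+ (b :* c :+ t)) refl a b c (x • z) (y • z))

    •-✶ : ∀ {n} a (x z : Vec K n) → (a ✶ x) • z ≡ a · (x • z)
    •-✶ a []      []      = solveᴷ 1 (λ a → con 0ℤ := a :* con 0ℤ) refl a
    •-✶ a (b ∷ x) (c ∷ z) = trans (cong (a · b · c ⊞_) (•-✶ a x z))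
      (solveᴷ 4 (λ a b c s → a :* b :* c :+ a :* s := a :* (b :* c :+ s)) refl a b c (x • z))

    •-⊝ : ∀ {n} (x y z : Vec K n) → (x ⊝ y) • z ≡ x • z ⊞ ⊟ (y • z)
    •-⊝ x y z = trans (cong (_• z) (⊝-def x y)) (trans (•-⊕ x _ z) (trans (cong (x • z ⊞_) (•-✶ _ y z))
      (solveᴷ 2 (λ s t → s :+ :- con 1ℤ :* t := s :- t) refl (x • z) (y • z))))

    •-𝟎 : ∀ {n} (z : Vec K n) → 𝟎 • z ≡ 0F
    •-𝟎 z = trans (cong (_• z) (sym (0✶ 𝟎))) (trans (•-✶ 0F 𝟎 z)
      (solveᴷ 1 (λ t → con 0ℤ :* t := con 0ℤ) refl (𝟎 • z)))

    Q-⊝ : ∀ {n} (x y : Vec K n) → Q (x ⊝ y) ≡ Q x ⊞ Q y ⊞ ⊟ (2F · (x • y))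
    Q-⊝ x y = trans (•-⊝ x y _)
      (trans (cong₂ (λ s t → s ⊞ ⊟ t) (trans (•-comm x _) (•-⊝ x y x)) (trans (•-comm y _) (•-⊝ x y y)))
      (trans (cong (λ t → Q x ⊞ ⊟ t ⊞ ⊟ (x • y ⊞ ⊟ Q y)) (•-comm y x))
        (solveᴷ 3 (λ a b c → a :- c :- (c :- b) := a :+ b :- (con (+ 2) :* c)) refl (Q x) (Q y) (x • y))))

    Q-✶ : ∀ {n} a (x : Vec K n) → Q (a ✶ x) ≡ a · a · Q x
    Q-✶ a x = trans (•-✶ a x _) (trans (cong (a ·_) (trans (•-comm x _) (•-✶ a x x)))
      (solveᴷ 2 (λ a b → a :* (a :* b) := a :* a :* b) refl a (Q x)))

    ⊕-as-⊝ : ∀ {n} (x y : Vec K n) → x ⊕ y ≡ x ⊝ (⊟ 1F) ✶ y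
    ⊕-as-⊝ []      []      = refl
    ⊕-as-⊝ (a ∷ x) (b ∷ y) =
      cong₂ _∷_ (solveᴷ 2 (λ a b → a :+ b := a :- (:- con 1ℤ :* b)) refl a b) (⊕-as-⊝ x y)

    Q-neg : ∀ {n} (x : Vec K n) → Q ((⊟ 1F) ✶ x) ≡ Q x
    Q-neg x = trans (Q-✶ _ x) (solveᴷ 1 (λ t → :- con 1ℤ :* :- con 1ℤ :* t := t) refl (Q x))

    •-neg : ∀ {n} (x y : Vec K n) → x • ((⊟ 1F) ✶ y) ≡ ⊟ (x • y)
    •-neg x y = trans (•-comm x _) (trans (•-✶ _ y x) (trans (cong (⊟ 1F ·_) (•-comm y x))
      (solveᴷ 1 (λ t → :- con 1ℤ :* t := :- t) refl (x • y))))

    Q-⊕ : ∀ {n} (x y : Vec K n) → Q (x ⊕ y) ≡ Q x ⊞ Q y ⊞ 2F · (x • y)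
    Q-⊕ x y = trans (cong Q (⊕-as-⊝ x y)) (trans (Q-⊝ x _)
      (trans (cong₂ (λ s t → Q x ⊞ s ⊞ ⊟ (2F · t)) (Q-neg y) (•-neg x y))
        (solveᴷ 3 (λ a b c → a :+ b :- (con (+ 2) :* :- c) := a :+ b :+ con (+ 2) :* c) refl (Q x) (Q y) (x • y))))

    -- `e` is the standard basis vector at a non-zero coordinate of `x`. Besides nondegeneracy this
    -- supplies directions with `Q e ≡ 1F`, along which `Q` is a monic quadratic polynomial.
    detect : ∀ {n} (x : Vec K n) → x ≢ 𝟎 → ∃ λ e → Q e ≡ 1F × x • e ≢ 0F
    detect []      x≢0 = contradiction refl x≢0
    detect {suc n} (a ∷ x) x≢0 with a ≟ 0F
    ... | no a≢0 = 1F ∷ 𝟎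
      , trans (cong (1F · 1F ⊞_) (•-𝟎 {n} 𝟎)) (solveᴷ 0 (con 1ℤ :* con 1ℤ :+ con 0ℤ := con 1ℤ) refl)
      , λ e → a≢0 (trans (solveᴷ 1 (λ a → a := a :* con 1ℤ :+ con 0ℤ) refl a)
                   (trans (cong (a · 1F ⊞_) (sym (trans (•-comm x 𝟎) (•-𝟎 x)))) e))
    ... | yes refl with e , Qe≡1 , xe≢0 ← detect x (λ { refl → x≢0 refl })
      = 0F ∷ e
      , trans (cong (0F · 0F ⊞_) Qe≡1) (solveᴷ 0 (con 0ℤ :* con 0ℤ :+ con 1ℤ := con 1ℤ) refl)
      , λ eq → xe≢0 (trans (solveᴷ 1 (λ s → s := con 0ℤ :* con 0ℤ :+ s) refl (x • e)) eq)

    -- Orthogonal maps, reflections and transitivity on spheres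

    record Orth {n} (θ : Vec K n → Vec K n) : Set where
      field
        θ-⊕ : ∀ x y → θ (x ⊕ y) ≡ θ x ⊕ θ y
        θ-✶ : ∀ a x → θ (a ✶ x) ≡ a ✶ θ x
        θ-• : ∀ x y → θ x • θ y ≡ x • y

      θ-𝟎 : θ 𝟎 ≡ 𝟎
      θ-𝟎 = trans (cong θ (sym (0✶ 𝟎))) (trans (θ-✶ 0F 𝟎) (0✶ (θ 𝟎)))

      θ-⊝ : ∀ x y → θ (x ⊝ y) ≡ θ x ⊝ θ y
      θ-⊝ x y = trans (cong θ (⊝-def x y)) (trans (θ-⊕ x _)
        (trans (cong (θ x ⊕_) (θ-✶ _ y)) (sym (⊝-def (θ x) (θ y)))))

      -- Nondegeneracy: if `θ` kills `x ⊝ y`, then `x ⊝ y` is orthogonal to every vector, since `θ`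
      -- preserves the products.
      injective : ∀ {x y} → θ x ≡ θ y → x ≡ y
      injective {x} {y} e with (x ⊝ y) ≟ 𝟎
      ... | yes d≡0 = ⊝≡𝟎 d≡0
      ... | no d≢0 with e′ , _ , ne ← detect (x ⊝ y) d≢0 = contradiction
        (trans (sym (θ-• (x ⊝ y) e′)) (trans (cong (_• θ e′)
          (trans (θ-⊝ x y) (trans (cong (_⊝ θ y) e) (⊝-self (θ y))))) (•-𝟎 (θ e′)))) ne

      surjective : ∀ y → ∃ λ x → θ x ≡ y
      surjective = injective⇒surjective θ injective

      inv : Vec K n → Vec K n
      inv y = proj₁ (surjective y)

      θ-inv : ∀ y → θ (inv y) ≡ y
      θ-inv y = proj₂ (surjective y)

      inv-θ : ∀ x → inv (θ x) ≡ x
      inv-θ x = injective (θ-inv (θ x))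

      ≢𝟎 : ∀ {x} → x ≢ 𝟎 → θ x ≢ 𝟎
      ≢𝟎 x≢0 e = x≢0 (injective (trans e (sym θ-𝟎)))

    Orth-id : ∀ {n} → Orth {n} id
    Orth-id = record { θ-⊕ = λ _ _ → refl ; θ-✶ = λ _ _ → refl ; θ-• = λ _ _ → refl }

    Orth-∘ : ∀ {n} {θ φ : Vec K n → Vec K n} → Orth θ → Orth φ → Orth (θ ∘ φ)
    Orth-∘ {θ = θ} {φ} o p = record
      { θ-⊕ = λ x y → trans (cong θ (P.θ-⊕ x y)) (O.θ-⊕ _ _)
      ; θ-✶ = λ a x → trans (cong θ (P.θ-✶ a x)) (O.θ-✶ a _)
      ; θ-• = λ x y → trans (O.θ-• _ _) (P.θ-• x y) }
      where
      module O = Orth o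
      module P = Orth p

    Orth-inv : ∀ {n} {θ : Vec K n → Vec K n} (o : Orth θ) → Orth (Orth.inv o)
    Orth-inv {θ = θ} o = record
      { θ-⊕ = λ x y → injective (trans (θ-inv _) (sym (trans (θ-⊕ _ _) (cong₂ _⊕_ (θ-inv x) (θ-inv y)))))
      ; θ-✶ = λ a x → injective (trans (θ-inv _) (sym (trans (θ-✶ a _) (cong (a ✶_) (θ-inv x)))))
      ; θ-• = λ x y → trans (sym (θ-• _ _)) (cong₂ _•_ (θ-inv x) (θ-inv y)) }
      where open Orth o

    Orth-neg : ∀ {n} → Orth {n} ((⊟ 1F) ✶_)
    Orth-neg = record
      { θ-⊕ = ✶-⊕ _
      ; θ-✶ = λ a x → trans (✶-✶ _ a x) (trans (cong (_✶ x) (solveᴷ 1 (λ a → :- con 1ℤ :* a := a :* :- con 1ℤ) refl a)) (sym (✶-✶ a _ x)))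
      ; θ-• = λ x y → trans (•-✶ _ x _) (trans (cong (⊟ 1F ·_) (•-neg x y))
          (solveᴷ 1 (λ t → :- con 1ℤ :* :- t := t) refl (x • y))) }

    -- Here i = 1 / Q v.
    module _ {n} (v : Vec K n) (i : K) where

      reflect : Vec K n → Vec K n
      reflect x = x ⊝ (2F · (x • v) · i) ✶ v

      module _ (i-inv : i · Q v ≡ 1F) where

        Orth-reflect : Orth reflect
        Orth-reflect = record { θ-⊕ = add ; θ-✶ = mul ; θ-• = dot }
          where
          open ≡-Reasoning
          c : Vec K n → K
          c x = 2F · (x • v) · i
          c-norm : ∀ x → c x · Q v ≡ 2F · (x • v)
          c-norm x = trans (solveᴷ 3 (λ s i w → s :* i :* w := s :* (i :* w)) refl (2F · (x • v)) i (Q v))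
            (trans (cong (2F · (x • v) ·_) i-inv) (solveᴷ 1 (λ s → s :* con 1ℤ := s) refl _))
          add : ∀ x y → reflect (x ⊕ y) ≡ reflect x ⊕ reflect y
          add x y = trans (cong (λ t → (x ⊕ y) ⊝ t ✶ v) (trans (cong (λ t → 2F · t · i) (•-⊕ x y v))
              (solveᴷ 3 (λ s t i → con (+ 2) :* (s :+ t) :* i := con (+ 2) :* s :* i :+ con (+ 2) :* t :* i) refl (x • v) (y • v) i)))
            (pointwise x y v (c x) (c y))
            where
            pointwise : ∀ {m} (x y v : Vec K m) s t → (x ⊕ y) ⊝ (s ⊞ t) ✶ v ≡ (x ⊝ s ✶ v) ⊕ (y ⊝ t ✶ v)
            pointwise []      []      []      s t = refl
            pointwise (a ∷ x) (b ∷ y) (c ∷ v) s t = cong₂ _∷_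
              (solveᴷ 5 (λ a b c s t → a :+ b :- (s :+ t) :* c := (a :- s :* c) :+ (b :- t :* c)) refl a b c s t)
              (pointwise x y v s t)
          mul : ∀ a x → reflect (a ✶ x) ≡ a ✶ reflect x
          mul a x = trans (cong (λ t → a ✶ x ⊝ t ✶ v) (trans (cong (λ t → 2F · t · i) (•-✶ a x v))
              (solveᴷ 3 (λ a s i → con (+ 2) :* (a :* s) :* i := a :* (con (+ 2) :* s :* i)) refl a (x • v) i)))
            (pointwise x v (c x))
            where
            pointwise : ∀ {m} (x v : Vec K m) s → a ✶ x ⊝ (a · s) ✶ v ≡ a ✶ (x ⊝ s ✶ v)
            pointwise []      []      s = refl
            pointwise (b ∷ x) (c ∷ v) s = cong₂ _∷_
              (solveᴷ 4 (λ a b c s → a :* b :- a :* s :* c := a :* (b :- s :* c)) refl a b c s)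
              (pointwise x v s)
          dot : ∀ x y → reflect x • reflect y ≡ x • y
          dot x y = begin
            reflect x • reflect y ≡⟨ •-⊝ x _ (reflect y) ⟩
            x • reflect y ⊞ ⊟ ((c x ✶ v) • reflect y) ≡⟨ cong (λ t → x • reflect y ⊞ ⊟ t) (•-✶ _ v _) ⟩
            x • reflect y ⊞ ⊟ (c x · (v • reflect y))
              ≡⟨ cong₂ (λ s t → s ⊞ ⊟ (c x · t)) (expand x) (expand v) ⟩
            (y • x ⊞ ⊟ (c y · (v • x))) ⊞ ⊟ (c x · (y • v ⊞ ⊟ (c y · Q v)))
              ≡⟨ cong₂ (λ s t → (s ⊞ ⊟ (c y · t)) ⊞ ⊟ (c x · (y • v ⊞ ⊟ (c y · Q v)))) (•-comm y x) (•-comm v x) ⟩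
            (x • y ⊞ ⊟ (c y · (x • v))) ⊞ ⊟ (c x · (y • v ⊞ ⊟ (c y · Q v)))
              ≡⟨ cong (λ t → (x • y ⊞ ⊟ (c y · (x • v))) ⊞ ⊟ (c x · (y • v ⊞ ⊟ t))) (c-norm y) ⟩
            (x • y ⊞ ⊟ (c y · (x • v))) ⊞ ⊟ (c x · (y • v ⊞ ⊟ (2F · (y • v))))
              ≡⟨ solveᴷ 4 (λ p s t i →
                   p :- con (+ 2) :* t :* i :* s :- con (+ 2) :* s :* i :* (t :- con (+ 2) :* t) := p) refl (x • y) (x • v) (y • v) i ⟩
            x • y ∎
            where
            expand : ∀ z → z • reflect y ≡ y • z ⊞ ⊟ (c y · (v • z))
            expand z = trans (•-comm z _) (trans (•-⊝ y _ z) (cong (λ t → y • z ⊞ ⊟ t) (•-✶ _ v z)))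

    module _ (two≢0 : 2F ≢ 0F) {n : ℕ} where

      private V = Vec K n

      -- The reflection in x − y exchanges x and y.
      move-by-reflection : (x y : V) → Q x ≡ Q y → Q (x ⊝ y) ≢ 0F → ∃ λ ρ → Orth ρ × ρ x ≡ y
      move-by-reflection x y e ne with i , i-inv ← inverse ne
        = reflect (x ⊝ y) i , Orth-reflect (x ⊝ y) i i-inv , (begin
          x ⊝ (2F · (x • (x ⊝ y)) · i) ✶ (x ⊝ y) ≡⟨ cong (λ t → x ⊝ t ✶ (x ⊝ y)) coeff ⟩
          x ⊝ 1F ✶ (x ⊝ y) ≡⟨ cong (x ⊝_) (1✶ (x ⊝ y)) ⟩
          x ⊝ (x ⊝ y) ≡⟨ ⊝-⊝ x y ⟩
          y                                       ∎)
        where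
        open ≡-Reasoning
        -- Because `Q x ≡ Q y`, the norm `Q (x ⊝ y)` equals twice the product of `x` and `x ⊝ y`.
        coeff : 2F · (x • (x ⊝ y)) · i ≡ 1F
        coeff = begin
          2F · (x • (x ⊝ y)) · i ≡⟨ cong (λ t → 2F · t · i) (trans (•-comm x _) (•-⊝ x y x)) ⟩
          2F · (Q x ⊞ ⊟ (y • x)) · i ≡⟨ cong (λ t → 2F · (Q x ⊞ ⊟ t) · i) (•-comm y x) ⟩
          2F · (Q x ⊞ ⊟ (x • y)) · i
            ≡⟨ solveᴷ 3 (λ a s i → con (+ 2) :* (a :- s) :* i := i :* (a :+ a :- con (+ 2) :* s)) refl (Q x) (x • y) i ⟩
          i · (Q x ⊞ Q x ⊞ ⊟ (2F · (x • y))) ≡⟨ cong (λ t → i · (Q x ⊞ t ⊞ ⊟ (2F · (x • y)))) e ⟩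
          i · (Q x ⊞ Q y ⊞ ⊟ (2F · (x • y))) ≡⟨ cong (i ·_) (sym (Q-⊝ x y)) ⟩
          i · Q (x ⊝ y) ≡⟨ i-inv ⟩
          1F                                      ∎

      private
        -- Here `x - y` and `x + y` are both isotropic, so neither defines a reflection. The way
        -- leads through an isotropic `z′` that is orthogonal neither to `x` nor to `y`: then
        -- `Q (x ⊝ z′)` and `Q (z′ ⊝ y)` are non-zero, and two reflections carry `x` to `z′` and
        -- `z′` to `y`.
        isotropic : (x y : V) → x ≢ 𝟎 → y ≢ 𝟎 → Q x ≡ 0F → Q y ≡ 0F → x • y ≡ 0F →
                    ∃ λ ρ → Orth ρ × ρ x ≡ y
        isotropic x y x≢0 y≢0 Qx Qy xy = compose common
          where
          common : ∃ λ z → x • z ≢ 0F × y • z ≢ 0F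
          common with z₁ , _ , xz₁ ← detect x x≢0 | z₂ , _ , yz₂ ← detect y y≢0
            with y • z₁ ≟ 0F | x • z₂ ≟ 0F
          ... | no yz₁  | _       = z₁ , xz₁ , yz₁
          ... | yes _   | no xz₂  = z₂ , xz₂ , yz₂
          -- Each of `z₁`, `z₂` is orthogonal to exactly one of `x`, `y`, so their sum is orthogonal
          -- to neither.
          ... | yes yz₁ | yes xz₂ = z₁ ⊕ z₂
            , (λ e → xz₁ (trans (solveᴷ 1 (λ s → s := s :+ con 0ℤ) refl _)
                 (trans (cong (x • z₁ ⊞_) (sym xz₂)) (trans (sym (split x)) e))))
            , (λ e → yz₂ (trans (solveᴷ 1 (λ s → s := con 0ℤ :+ s) refl _)
                 (trans (cong (_⊞ y • z₂) (sym yz₁)) (trans (sym (split y)) e))))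
            where
            split : ∀ w → w • (z₁ ⊕ z₂) ≡ w • z₁ ⊞ w • z₂
            split w = trans (•-comm w _) (trans (•-⊕ z₁ z₂ w) (cong₂ _⊞_ (•-comm z₁ w) (•-comm z₂ w)))
          compose : (∃ λ z → x • z ≢ 0F × y • z ≢ 0F) → ∃ λ ρ → Orth ρ × ρ x ≡ y
          compose (z , xz , yz) = result
            where
            open ≡-Reasoning
            j = proj₁ (inverse (·-≢0 two≢0 xz))
            j-inv = proj₂ (inverse (·-≢0 two≢0 xz))
            -- This multiple of `x` makes `z` isotropic. As `x` is orthogonal to itself and to `y`,
            -- the products of `z` with `x` and `y` do not change.
            z′ = z ⊝ (j · Q z) ✶ x
            Qz′ : Q z′ ≡ 0F
            Qz′ = begin
              Q z′ ≡⟨ Q-⊝ z _ ⟩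
              Q z ⊞ Q ((j · Q z) ✶ x) ⊞ ⊟ (2F · (z • ((j · Q z) ✶ x)))
                ≡⟨ cong₂ (λ s t → Q z ⊞ s ⊞ ⊟ (2F · t)) (trans (Q-✶ _ x) (cong (j · Q z · (j · Q z) ·_) Qx))
                     (trans (•-comm z _) (•-✶ _ x z)) ⟩
              Q z ⊞ (j · Q z · (j · Q z)) · 0F ⊞ ⊟ (2F · (j · Q z · (x • z)))
                ≡⟨ solveᴷ 3 (λ j a s → a :+ j :* a :* (j :* a) :* con 0ℤ :- con (+ 2) :* (j :* a :* s) := a :- a :* (j :* (con (+ 2) :* s))) refl j (Q z) (x • z) ⟩
              Q z ⊞ ⊟ (Q z · (j · (2F · (x • z)))) ≡⟨ cong (λ t → Q z ⊞ ⊟ (Q z · t)) j-inv ⟩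
              Q z ⊞ ⊟ (Q z · 1F) ≡⟨ solveᴷ 1 (λ a → a :- a :* con 1ℤ := con 0ℤ) refl (Q z) ⟩
              0F ∎
            pair : ∀ w → w • x ≡ 0F → w • z′ ≡ w • z
            pair w wx = begin
              w • z′ ≡⟨ trans (•-comm w z′) (•-⊝ z _ w) ⟩
              z • w ⊞ ⊟ ((j · Q z) ✶ x • w)
                ≡⟨ cong₂ (λ s t → s ⊞ ⊟ t) (•-comm z w) (trans (•-✶ _ x w) (cong (j · Q z ·_) (trans (•-comm x w) wx))) ⟩
              w • z ⊞ ⊟ (j · Q z · 0F)
                ≡⟨ solveᴷ 2 (λ a b → a :- b :* con 0ℤ := a) refl (w • z) (j · Q z) ⟩
              w • z                           ∎
            apart : ∀ a b → Q a ≡ 0F → Q b ≡ 0F → a • b ≢ 0F → Q (a ⊝ b) ≢ 0F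
            apart a b Qa Qb ab e = ·-≢0 two≢0 ab (begin
              2F · (a • b) ≡⟨ solveᴷ 2 (λ s t → s := t :- (t :- s)) refl (2F · (a • b)) (Q a ⊞ Q b) ⟩
              (Q a ⊞ Q b) ⊞ ⊟ (Q a ⊞ Q b ⊞ ⊟ (2F · (a • b)))
                ≡⟨ cong₂ (λ s t → s ⊞ ⊟ t) (cong₂ _⊞_ Qa Qb) (trans (sym (Q-⊝ a b)) e) ⟩
              (0F ⊞ 0F) ⊞ ⊟ 0F ≡⟨ solveᴷ 0 (con 0ℤ :+ con 0ℤ :- con 0ℤ := con 0ℤ) refl ⟩
              0F                                    ∎)
            result : ∃ λ ρ → Orth ρ × ρ x ≡ y
            result =
              let ρ₁ , o₁ , e₁ = move-by-reflection x z′ (trans Qx (sym Qz′))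
                     (apart x z′ Qx Qz′ (λ e → xz (trans (sym (pair x Qx)) e)))
                  ρ₂ , o₂ , e₂ = move-by-reflection z′ y (trans Qz′ (sym Qy))
                     (apart z′ y Qz′ Qy (λ e → yz (trans (sym (pair y (trans (•-comm y x) xy))) (trans (•-comm y z′) e))))
              in ρ₂ ∘ ρ₁ , Orth-∘ o₂ o₁ , trans (cong ρ₂ e₁) e₂

      -- Witt's theorem for single vectors. If `x - y` is isotropic, the reflection in `x + y`
      -- carries `x` to `- y`, and a change of sign follows. If `x + y` is isotropic too, the sum
      -- and the difference of the two norms are four times `Q x` and, up to sign, four times
      -- `x • y`, so both vanish.
      transitive : (x y : V) → x ≢ 𝟎 → y ≢ 𝟎 → Q x ≡ Q y → ∃ λ ρ → Orth ρ × ρ x ≡ y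
      transitive x y x≢0 y≢0 e with Q (x ⊝ y) ≟ 0F | Q (x ⊝ (⊟ 1F) ✶ y) ≟ 0F
      ... | no ne | _ = move-by-reflection x y e ne
      ... | yes _ | no ne =
        let ρ , o , e′ = move-by-reflection x ((⊟ 1F) ✶ y) (trans e (sym (Q-neg y))) ne
        in ((⊟ 1F) ✶_) ∘ ρ , Orth-∘ Orth-neg o
        , trans (cong ((⊟ 1F) ✶_) e′) (trans (✶-✶ _ _ y) (trans (cong (_✶ y)
            (solveᴷ 0 (:- con 1ℤ :* :- con 1ℤ := con 1ℤ) refl)) (1✶ y)))
      ... | yes d | yes s = isotropic x y x≢0 y≢0 Qx≡0 (trans (sym e) Qx≡0) xy≡0
        where
        open ≡-Reasoning
        d′ : Q x ⊞ Q x ⊞ ⊟ (2F · (x • y)) ≡ 0F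
        d′ = trans (cong (λ t → Q x ⊞ t ⊞ ⊟ (2F · (x • y))) e) (trans (sym (Q-⊝ x y)) d)
        s′ : Q x ⊞ Q x ⊞ 2F · (x • y) ≡ 0F
        s′ = trans (cong (λ t → Q x ⊞ t ⊞ 2F · (x • y)) e)
               (trans (sym (Q-⊕ x y)) (trans (cong Q (⊕-as-⊝ x y)) s))
        zero-by-2 : ∀ {a b c} → 2F · (2F · a) ≡ b ⊞ c → b ≡ 0F → c ≡ 0F → a ≡ 0F
        zero-by-2 {a} p refl refl with a ≟ 0F
        ... | yes a≡0 = a≡0
        ... | no a≢0  = contradiction (trans p (solveᴷ 0 (con 0ℤ :+ con 0ℤ := con 0ℤ) refl)) (·-≢0 two≢0 (·-≢0 two≢0 a≢0))
        Qx≡0 : Q x ≡ 0F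
        Qx≡0 = zero-by-2 (solveᴷ 2 (λ a t → con (+ 2) :* (con (+ 2) :* a) := a :+ a :- con (+ 2) :* t :+ (a :+ a :+ con (+ 2) :* t)) refl (Q x) (x • y)) d′ s′
        xy≡0 : x • y ≡ 0F
        xy≡0 = zero-by-2 (solveᴷ 2 (λ a t → con (+ 2) :* (con (+ 2) :* t) := a :+ a :+ con (+ 2) :* t :+ :- (a :+ a :- con (+ 2) :* t)) refl (Q x) (x • y)) s′
                 (trans (cong ⊟_ d′) (solveᴷ 0 (:- con 0ℤ := con 0ℤ) refl))

    -- The orthogonal group

    -- A matrix is the vector of its columns, the images of the standard basis.
    act : ∀ {n m} → Vec (Vec K n) m → Vec K m → Vec K n
    act []      []      = 𝟎
    act (c ∷ M) (a ∷ x) = a ✶ c ⊕ act M x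

    private
      ⊕-interchange : ∀ {n} (x y z w : Vec K n) → (x ⊕ y) ⊕ (z ⊕ w) ≡ (x ⊕ z) ⊕ (y ⊕ w)
      ⊕-interchange []      []      []      []      = refl
      ⊕-interchange (a ∷ x) (b ∷ y) (c ∷ z) (d ∷ w) = cong₂ _∷_
        (solveᴷ 4 (λ a b c d → a :+ b :+ (c :+ d) := a :+ c :+ (b :+ d)) refl a b c d) (⊕-interchange x y z w)

    act-⊕ : ∀ {n m} (M : Vec (Vec K n) m) x y → act M (x ⊕ y) ≡ act M x ⊕ act M y
    act-⊕ []      []      []      = sym (⊕-identityʳ 𝟎)
    act-⊕ (c ∷ M) (a ∷ x) (b ∷ y) =
      trans (cong₂ _⊕_ (✶-⊞ a b c) (act-⊕ M x y)) (⊕-interchange (a ✶ c) (b ✶ c) (act M x) (act M y))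

    act-✶ : ∀ {n m} (M : Vec (Vec K n) m) a x → act M (a ✶ x) ≡ a ✶ act M x
    act-✶ []      a []      = sym (✶-𝟎 a)
    act-✶ (c ∷ M) a (b ∷ x) =
      trans (cong₂ _⊕_ (sym (✶-✶ a b c)) (act-✶ M a x)) (sym (✶-⊕ a (b ✶ c) (act M x)))

    act-𝟎 : ∀ {n m} (M : Vec (Vec K n) m) → act M 𝟎 ≡ 𝟎
    act-𝟎 M = trans (cong (act M) (sym (0✶ 𝟎))) (trans (act-✶ M 0F 𝟎) (0✶ _))

    Orthonormal : ∀ {n m} → Vec (Vec K n) m → Set
    Orthonormal []      = ⊤
    Orthonormal (c ∷ M) = Q c ≡ 1F × All (λ c′ → c • c′ ≡ 0F) M × Orthonormal M

    orthonormal? : ∀ {n m} (M : Vec (Vec K n) m) → Dec (Orthonormal M)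
    orthonormal? []      = yes tt
    orthonormal? (c ∷ M) = Q c ≟ 1F ×-dec All.all? (λ c′ → c • c′ ≟ 0F) M ×-dec orthonormal? M

    private
      •-act : ∀ {n m} (c : Vec K n) (M : Vec (Vec K n) m) x → All (λ c′ → c • c′ ≡ 0F) M → c • act M x ≡ 0F
      •-act c []       []      []       = trans (•-comm c 𝟎) (•-𝟎 c)
      •-act c (c′ ∷ M) (a ∷ x) (e ∷ es) = begin
        c • (a ✶ c′ ⊕ act M x) ≡⟨ trans (•-comm c _) (•-⊕ (a ✶ c′) (act M x) c) ⟩
        (a ✶ c′) • c ⊞ act M x • c
          ≡⟨ cong₂ _⊞_ (trans (•-✶ a c′ c) (cong (a ·_) (trans (•-comm c′ c) e)))
                                            (trans (•-comm _ c) (•-act c M x es)) ⟩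
        a · 0F ⊞ 0F ≡⟨ solveᴷ 1 (λ a → a :* con 0ℤ :+ con 0ℤ := con 0ℤ) refl a ⟩
        0F                             ∎
        where open ≡-Reasoning

    act-• : ∀ {n m} (M : Vec (Vec K n) m) → Orthonormal M → ∀ x y → act M x • act M y ≡ x • y
    act-• {n} []  _              []      []      = •-𝟎 {n} 𝟎
    act-• (c ∷ M) (Qc , cM , oM) (a ∷ x) (b ∷ y) = begin
      (a ✶ c ⊕ X) • (b ✶ c ⊕ Y) ≡⟨ •-⊕ (a ✶ c) X _ ⟩
      (a ✶ c) • (b ✶ c ⊕ Y) ⊞ X • (b ✶ c ⊕ Y)
        ≡⟨ cong₂ _⊞_ (trans (•-✶ a c _) (cong (a ·_) (•-comm c _))) (•-comm X _) ⟩
      a · ((b ✶ c ⊕ Y) • c) ⊞ (b ✶ c ⊕ Y) • X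
        ≡⟨ cong₂ (λ s t → a · s ⊞ t) (•-⊕ (b ✶ c) Y c) (•-⊕ (b ✶ c) Y X) ⟩
      a · ((b ✶ c) • c ⊞ Y • c) ⊞ ((b ✶ c) • X ⊞ Y • X) ≡⟨ cong₂ (λ s t → a · s ⊞ t)
                                                              (cong₂ _⊞_ (trans (•-✶ b c c) (cong (b ·_) Qc)) (trans (•-comm Y c) (•-act c M y cM)))
                                                              (cong₂ _⊞_ (trans (•-✶ b c X) (cong (b ·_) (•-act c M x cM)))
                                                                (trans (•-comm Y X) (act-• M oM x y))) ⟩
      a · (b · 1F ⊞ 0F) ⊞ (b · 0F ⊞ x • y)
        ≡⟨ solveᴷ 3 (λ a b s → a :* (b :* con 1ℤ :+ con 0ℤ) :+ (b :* con 0ℤ :+ s)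
                                                                              := a :* b :+ s) refl a b (x • y) ⟩
      a · b ⊞ x • y                                      ∎
      where
      open ≡-Reasoning
      X = act M x
      Y = act M y

    basis : ∀ n → Vec (Vec K n) n
    basis zero    = []
    basis (suc n) = (1F ∷ 𝟎) ∷ Vec.map (0F ∷_) (basis n)

    act-basis : ∀ {n} (x : Vec K n) → act (basis n) x ≡ x
    act-basis {zero}  []      = refl
    act-basis {suc n} (a ∷ x) = trans (cong ((a ✶ (1F ∷ 𝟎)) ⊕_) (lift (basis n) x))
      (cong₂ _∷_ (solveᴷ 1 (λ a → a :* con 1ℤ :+ con 0ℤ := a) refl a)
        (trans (cong₂ _⊕_ (✶-𝟎 a) (act-basis x)) (⊕-identityˡ x)))
      where
      lift : ∀ {n m} (M : Vec (Vec K n) m) x → act (Vec.map (0F ∷_) M) x ≡ 0F ∷ act M x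
      lift []      []      = refl
      lift (c ∷ M) (a ∷ x) = trans (cong ((a ✶ (0F ∷ c)) ⊕_) (lift M x))
        (cong (_∷ (a ✶ c ⊕ act M x)) (solveᴷ 1 (λ a → a :* con 0ℤ :+ con 0ℤ := con 0ℤ) refl a))

    basis-orthonormal : ∀ n → Orthonormal (basis n)
    basis-orthonormal zero    = tt
    basis-orthonormal (suc n) =
        trans (cong (1F · 1F ⊞_) (•-𝟎 {n} 𝟎)) (solveᴷ 0 (con 1ℤ :* con 1ℤ :+ con 0ℤ := con 1ℤ) refl)
      , first (basis n) , rest (basis n) (basis-orthonormal n)
      where
      first : ∀ {m n} (M : Vec (Vec K n) m) → All (λ c → (1F ∷ 𝟎) • c ≡ 0F) (Vec.map (0F ∷_) M)
      first []      = []
      first (c ∷ M) = trans (cong (1F · 0F ⊞_) (•-𝟎 c)) (solveᴷ 0 (con 1ℤ :* con 0ℤ :+ con 0ℤ := con 0ℤ) refl) ∷ first M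
      drop0 : ∀ {n} (c c′ : Vec K n) → (0F ∷ c) • (0F ∷ c′) ≡ c • c′
      drop0 c c′ = solveᴷ 1 (λ s → con 0ℤ :* con 0ℤ :+ s := s) refl (c • c′)
      shift : ∀ {m n} (c : Vec K n) (M : Vec (Vec K n) m) → All (λ c′ → c • c′ ≡ 0F) M →
              All (λ c′ → (0F ∷ c) • c′ ≡ 0F) (Vec.map (0F ∷_) M)
      shift c []       []       = []
      shift c (c′ ∷ M) (e ∷ es) = trans (drop0 c c′) e ∷ shift c M es
      rest : ∀ {m n} (M : Vec (Vec K n) m) → Orthonormal M → Orthonormal (Vec.map (0F ∷_) M)
      rest []      _            = tt
      rest (c ∷ M) (e , es , o) = trans (drop0 c c) e , shift c M es , rest M o

    columns : ∀ {n m} (M : Vec (Vec K n) m) → Vec.map (act M) (basis m) ≡ M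
    columns []      = refl
    columns {m = suc m} (c ∷ M) = cong₂ _∷_
      (trans (cong₂ _⊕_ (1✶ c) (act-𝟎 M)) (⊕-identityʳ c))
      (trans (sym (Vec.map-∘ (act (c ∷ M)) (0F ∷_) (basis m)))
        (trans (Vec.map-cong (λ x → trans (cong (_⊕ act M x) (0✶ c)) (⊕-identityˡ _)) (basis m)) (columns M)))

    module _ {n} {θ : Vec K n → Vec K n} (o : Orth θ) where

      open Orth o

      act-map : ∀ {m} (M : Vec (Vec K n) m) x → act (Vec.map θ M) x ≡ θ (act M x)
      act-map []      []      = sym θ-𝟎
      act-map (c ∷ M) (a ∷ x) =
        trans (cong₂ _⊕_ (sym (θ-✶ a c)) (act-map M x)) (sym (θ-⊕ (a ✶ c) (act M x)))

      map-orthonormal : ∀ {m} (M : Vec (Vec K n) m) → Orthonormal M → Orthonormal (Vec.map θ M)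
      map-orthonormal []      _            = tt
      map-orthonormal (c ∷ M) (e , es , r) = trans (θ-• c c) e , move M es , map-orthonormal M r
        where
        move : ∀ {m} (M : Vec (Vec K n) m) → All (λ c′ → c • c′ ≡ 0F) M → All (λ c′ → θ c • c′ ≡ 0F) (Vec.map θ M)
        move []       []       = []
        move (c′ ∷ M) (e ∷ es) = trans (θ-• c c′) e ∷ move M es

    -- Equality of functions is not decidable, so the group is counted through matrices with
    -- orthonormal columns; `orth` and `fromOrth` translate between the two descriptions.
    O : ℕ → Set
    O n = Sub (orthonormal? {n} {n})

    ⟦_⟧ : ∀ {n} → O n → Vec K n → Vec K n
    ⟦ M , _ ⟧ = act M

    orth : ∀ {n} (o : O n) → Orth ⟦ o ⟧
    orth (M , p) = record { θ-⊕ = act-⊕ M ; θ-✶ = act-✶ M ; θ-• = act-• M (toWitness p) }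

    fromOrth : ∀ {n} {θ : Vec K n → Vec K n} → Orth θ → O n
    fromOrth {n} {θ} o = Vec.map θ (basis n) , fromWitness (map-orthonormal o (basis n) (basis-orthonormal n))

    ⟦fromOrth⟧ : ∀ {n} {θ : Vec K n → Vec K n} (o : Orth θ) x → ⟦ fromOrth o ⟧ x ≡ θ x
    ⟦fromOrth⟧ {n} {θ} o x = trans (act-map o (basis n) x) (cong θ (act-basis x))

    O-ext : ∀ {n} {o p : O n} → (∀ x → ⟦ o ⟧ x ≡ ⟦ p ⟧ x) → o ≡ p
    O-ext {n} {M , _} {N , _} e = Sub-≡ orthonormal?
      (trans (sym (columns M)) (trans (Vec.map-cong e (basis n)) (columns N)))

    instance
      Finite-O : ∀ {n} → Finite (O n)
      Finite-O = Finite-Sub orthonormal?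

    infixr 9 _⋆_

    _⋆_ : ∀ {n} → O n → O n → O n
    o ⋆ p = fromOrth (Orth-∘ (orth o) (orth p))

    ⟦⋆⟧ : ∀ {n} (o p : O n) x → ⟦ o ⋆ p ⟧ x ≡ ⟦ o ⟧ (⟦ p ⟧ x)
    ⟦⋆⟧ o p = ⟦fromOrth⟧ (Orth-∘ (orth o) (orth p))

    _⁻¹ : ∀ {n} → O n → O n
    o ⁻¹ = fromOrth (Orth-inv (orth o))

    ⟦⁻¹⟧ˡ : ∀ {n} (o : O n) x → ⟦ o ⁻¹ ⟧ (⟦ o ⟧ x) ≡ x
    ⟦⁻¹⟧ˡ o x = trans (⟦fromOrth⟧ (Orth-inv (orth o)) _) (Orth.inv-θ (orth o) x)

    ⟦⁻¹⟧ʳ : ∀ {n} (o : O n) x → ⟦ o ⟧ (⟦ o ⁻¹ ⟧ x) ≡ x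
    ⟦⁻¹⟧ʳ o x = trans (cong ⟦ o ⟧ (⟦fromOrth⟧ (Orth-inv (orth o)) x)) (Orth.θ-inv (orth o) x)

    -- Cardinalities, lines and spheres

    ∣V∣ : ∀ n → ∣ Vec K n ∣ ≡ (+ q) ^ n
    ∣V∣ n = trans (∣Vec∣ n) (cong (_^ n) ∣K∣)

    1≤q : 1ℤ ≤ + q
    1≤q = subst (1ℤ ≤_) ∣K∣ (∑-single 0F (λ _ → 0≤+))

    0<q : 0ℤ < + q
    0<q = 1≤⇒0< 1≤q

    0<∣V∣ : ∀ {n} → 0ℤ < ∣ Vec K n ∣
    0<∣V∣ = 1≤⇒0< (∑-single 𝟎 λ _ → 0≤+)

    0≤∣V∣ : ∀ {n} → 0ℤ ≤ ∣ Vec K n ∣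
    0≤∣V∣ = ℤ.<⇒≤ 0<∣V∣

    0<∣O∣ : ∀ {n} → 0ℤ < ∣ O n ∣
    0<∣O∣ = 1≤⇒0< (∑-single (fromOrth Orth-id) λ _ → 0≤+)

    0≤∣O∣ : ∀ {n} → 0ℤ ≤ ∣ O n ∣
    0≤∣O∣ = ℤ.<⇒≤ 0<∣O∣

    1≤4^ : ∀ n → 1ℤ ≤ (+ 4) ^ n
    1≤4^ n = 0<⇒1≤ (0<-^ {+ 4} n (+<+ (s≤s z≤n)))

    ∑-translate : ∀ {n} (φ : Vec K n → ℤ) v → ∑ (λ x → φ (x ⊕ v)) ≡ ∑ φ
    ∑-translate φ v = ∑-bij (_⊕ v) (_⊝ v) (λ x → ⊕-⊝ x v) (λ x → ⊝-⊕ x v) φ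

    -- All translates of `φ` have the same sum. A bound on every line in direction `e` thereby
    -- becomes a bound on the whole sum.
    ∑-lines : ∀ {n} (φ : Vec K n → ℤ) e → + q * ∑ φ ≡ ∑ (λ x → ∑ λ s → φ (x ⊕ s ✶ e))
    ∑-lines φ e = begin
      + q * ∑ φ ≡⟨ trans (*-comm (+ q) (∑ φ)) (cong (∑ φ *_) (sym ∣K∣)) ⟩
      ∑ φ * ∣ K ∣ ≡⟨ sym (∑-const (∑ φ)) ⟩
      ∑ (λ s → ∑ φ) ≡⟨ ∑-cong (λ s → sym (∑-translate φ (s ✶ e))) ⟩
      ∑ (λ s → ∑ λ x → φ (x ⊕ s ✶ e)) ≡⟨ ∑-swap (λ s x → φ (x ⊕ s ✶ e)) ⟩
      ∑ (λ x → ∑ λ s → φ (x ⊕ s ✶ e))       ∎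
      where open ≡-Reasoning

    -- The origin is excluded so that also the sphere of norm zero is a single orbit, if it is not
    -- empty.
    Sphere : ∀ {n} → K → Vec K n → Set
    Sphere t x = x ≢ 𝟎 × Q x ≡ t

    sphere? : ∀ {n} t → Decidable (Sphere {n} t)
    sphere? t x = ¬? (x ≟ 𝟎) ×-dec Q x ≟ t

    ∣S∣ : ∀ n → K → ℤ
    ∣S∣ n t = ∑ {Vec K n} λ x → 𝟙 (sphere? t x)

    transporters : ∀ {n} → Vec K n → Vec K n → ℤ
    transporters {n} x y = ∑ λ (o : O n) → δ (⟦ o ⟧ x) y

    module _ (two≢0 : 2F ≢ 0F) where

      private
        -- Left multiplication by an element that carries `y` to `z` is a bijection between the two
        -- sets of transporters.
        transporters-≡ : ∀ {n t} x y z → Sphere {n} t y → Sphere t z → transporters x y ≡ transporters x z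
        transporters-≡ {n} x y z (y≢0 , Qy) (z≢0 , Qz) = begin
          ∑ (λ o → δ (⟦ o ⟧ x) y) ≡⟨ ∑-cong (λ o → 𝟙-cong (⟦ o ⟧ x ≟ y) (⟦ ρ′ ⋆ o ⟧ x ≟ z)
                                                (λ e → trans (⟦⋆⟧ ρ′ o x) (trans (cong ⟦ ρ′ ⟧ e) ρ′y))
                                                (λ e → Orth.injective (orth ρ′) (trans (sym (⟦⋆⟧ ρ′ o x)) (trans e (sym ρ′y))))) ⟩
          ∑ (λ o → δ (⟦ ρ′ ⋆ o ⟧ x) z) ≡⟨ ∑-bij (ρ′ ⋆_) (ρ′ ⁻¹ ⋆_)
                                                (λ o → O-ext λ w → trans (⟦⋆⟧ (ρ′ ⁻¹) (ρ′ ⋆ o) w) (trans (cong ⟦ ρ′ ⁻¹ ⟧ (⟦⋆⟧ ρ′ o w)) (⟦⁻¹⟧ˡ ρ′ (⟦ o ⟧ w))))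
                                                (λ o → O-ext λ w → trans (⟦⋆⟧ ρ′ (ρ′ ⁻¹ ⋆ o) w) (trans (cong ⟦ ρ′ ⟧ (⟦⋆⟧ (ρ′ ⁻¹) o w)) (⟦⁻¹⟧ʳ ρ′ (⟦ o ⟧ w))))
                                                (λ o → δ (⟦ o ⟧ x) z) ⟩
          ∑ (λ o → δ (⟦ o ⟧ x) z)          ∎
          where
          open ≡-Reasoning
          t = transitive two≢0 y z y≢0 z≢0 (trans Qy (sym Qz))
          ρ′ = fromOrth (proj₁ (proj₂ t))
          ρ′y : ⟦ ρ′ ⟧ y ≡ z
          ρ′y = trans (⟦fromOrth⟧ (proj₁ (proj₂ t)) y) (proj₂ (proj₂ t))

      -- Each group element carries `x` to one point of the sphere, and all points are reached
      -- equally often.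
      orbit-stabilizer : ∀ {n t} x y → Sphere {n} t x → Sphere t y → ∣S∣ n t * transporters x y ≡ ∣ O n ∣
      orbit-stabilizer {n} {t} x y (x≢0 , Qx) y∈ = begin
        ∣S∣ n t * transporters x y ≡⟨ sym (∑-*ʳ (transporters x y) (λ z → 𝟙 (sphere? t z))) ⟩
        ∑ (λ z → 𝟙 (sphere? t z) * transporters x y)
          ≡⟨ ∑-cong (λ z → 𝟙-* (sphere? t z) (transporters-≡ x y z y∈)) ⟩
        ∑ (λ z → 𝟙 (sphere? t z) * transporters x z)
          ≡⟨ ∑-cong (λ z → trans (sym (∑-* (𝟙 (sphere? t z)) (λ o → δ (⟦ o ⟧ x) z))) (∑-cong (inside z))) ⟩
        ∑ (λ z → ∑ λ o → δ (⟦ o ⟧ x) z) ≡⟨ ∑-swap (λ z o → δ (⟦ o ⟧ x) z) ⟩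
        ∑ (λ o → ∑ λ z → δ (⟦ o ⟧ x) z) ≡⟨ ∑-cong (λ o → ∑-δ-1 (⟦ o ⟧ x)) ⟩
        ∣ O n ∣                                            ∎
        where
        open ≡-Reasoning
        inside : ∀ z (o : O n) → 𝟙 (sphere? t z) * δ (⟦ o ⟧ x) z ≡ δ (⟦ o ⟧ x) z
        inside z o = trans (*-comm (𝟙 (sphere? t z)) _) (trans
          (𝟙-* (⟦ o ⟧ x ≟ z) λ { refl → 𝟙-yes (sphere? t _) (Orth.≢𝟎 (orth o) x≢0 , trans (Orth.θ-• (orth o) x x) Qx) })
          (*-identityʳ _))

      private
        module _ {n t} (w : Vec K n) (w∈ : Sphere t w) where

          -- The vectors `v` for which the reflection in `v` exists and moves `w`.
          Good? : ∀ v → Dec (w • v ≢ 0F × Q v ≢ 0F)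
          Good? v = ¬? (w • v ≟ 0F) ×-dec ¬? (Q v ≟ 0F)

          -- If `y` is the mirror image of `w` in a good `v`, then `w ⊝ y` is a non-zero multiple of
          -- `v`. So `v` is determined by `y`, a point of the sphere, and a scalar.
          good-≤ : ∑ (λ v → 𝟙 (Good? v)) ≤ + q * ∣S∣ n t
          good-≤ = begin
            ∑ (λ v → 𝟙 (Good? v)) ≤⟨ ∑-mono hit ⟩
            ∑ (λ v → ∑ λ a → ∑ λ y → g a y v) ≡⟨ ∑-swap (λ v a → ∑ λ y → g a y v) ⟩
            ∑ (λ a → ∑ λ v → ∑ λ y → g a y v)
              ≡⟨ ∑-cong (λ a → trans (∑-swap (λ v y → g a y v)) (∑-cong λ y → collapse a y)) ⟩
            ∑ {K} (λ a → ∣S∣ n t) ≡⟨ ∑-const (∣S∣ n t) ⟩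
            ∣S∣ n t * ∣ K ∣ ≡⟨ trans (cong (∣S∣ n t *_) ∣K∣) (*-comm (∣S∣ n t) (+ q)) ⟩
            + q * ∣S∣ n t                            ∎
            where
            open ℤ.≤-Reasoning
            g : K → Vec K n → Vec K n → ℤ
            g a y v = 𝟙 (sphere? t y) * δ v (a ✶ (w ⊝ y))
            0≤g : ∀ a y v → 0ℤ ≤ g a y v
            0≤g a y v = 0≤-* (0≤𝟙 (sphere? t y)) (0≤𝟙 (v ≟ a ✶ (w ⊝ y)))
            collapse : ∀ a y → ∑ (g a y) ≡ 𝟙 (sphere? t y)
            collapse a y = trans (∑-* (𝟙 (sphere? t y)) (λ v → δ v (a ✶ (w ⊝ y))))
              (trans (cong (𝟙 (sphere? t y) *_) (∑-δ-1ʳ (a ✶ (w ⊝ y)))) (*-identityʳ _))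
            hit : ∀ v → 𝟙 (Good? v) ≤ ∑ λ a → ∑ λ y → g a y v
            hit v = go (Good? v)
              where
              go : (d : Dec (w • v ≢ 0F × Q v ≢ 0F)) → 𝟙 d ≤ ∑ λ a → ∑ λ y → g a y v
              go (no _) = 0≤-∑ λ a → 0≤-∑ λ y → 0≤g a y v
              go (yes (wv , Qv)) = ℤ.≤-trans (ℤ.≤-reflexive (sym value))
                (ℤ.≤-trans (∑-single y (λ y → 0≤g a y v)) (∑-single a (λ a → 0≤-∑ λ y → 0≤g a y v)))
                where
                i = proj₁ (inverse Qv)
                i-inv = proj₂ (inverse Qv)
                i≢0 : i ≢ 0F
                i≢0 e = 1≢0 (trans (sym i-inv) (trans (cong (_· Q v) e) (solveᴷ 1 (λ s → con 0ℤ :* s := con 0ℤ) refl (Q v))))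
                c = 2F · (w • v) · i
                c⁻¹ = inverse (·-≢0 (·-≢0 two≢0 wv) i≢0)
                a = proj₁ c⁻¹
                o = Orth-reflect v i i-inv
                y = reflect v i w
                value : g a y v ≡ 1ℤ
                value = trans (cong₂ _*_
                  (𝟙-yes (sphere? t y) (Orth.≢𝟎 o (proj₁ w∈) , trans (Orth.θ-• o w w) (proj₂ w∈)))
                  (𝟙-yes (v ≟ a ✶ (w ⊝ y)) (sym (trans (cong (a ✶_) (⊝-⊝ w (c ✶ v)))
                    (trans (✶-✶ a c v) (trans (cong (_✶ v) (proj₂ c⁻¹)) (1✶ v)))))))
                  (*-identityˡ 1ℤ)

          -- A line in a direction e with w • e ≠ 0 and Q e = 1 contains at most
          -- three vectors that are orthogonal to w or isotropic.
          good-≥ : + q * ∣ Vec K n ∣ ≤ + q * ∑ (λ v → 𝟙 (Good? v)) + + 3 * ∣ Vec K n ∣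
          good-≥ = begin
            + q * D ≤⟨ *-monoʳ 0≤+ (∑-mono cover) ⟩
            + q * ∑ (λ v → 𝟙 (Good? v) + (δ (w • v) 0F + δ (Q v) 0F))
              ≡⟨ cong (+ q *_) (trans (∑-+ (λ v → 𝟙 (Good? v)) _) (cong (_+_ G) (∑-+ (λ v → δ (w • v) 0F) (λ v → δ (Q v) 0F)))) ⟩
            + q * (G + (∑ (λ v → δ (w • v) 0F) + ∑ (λ v → δ (Q v) 0F)))
              ≡⟨ solve 4 (λ q a b c → q :* (a :+ (b :+ c)) := q :* a :+ (q :* b :+ q :* c)) refl (+ q) G _ _ ⟩
            + q * G + (+ q * ∑ (λ v → δ (w • v) 0F) + + q * ∑ (λ v → δ (Q v) 0F))
              ≤⟨ +-mono-≤ (≤-refl {+ q * G}) (+-mono-≤ linear quadratic) ⟩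
            + q * G + (1ℤ * D + + 2 * D)
              ≡⟨ solve 2 (λ g d → g :+ (con 1ℤ :* d :+ con (+ 2) :* d) := g :+ con (+ 3) :* d) refl (+ q * G) D ⟩
            + q * G + + 3 * D                            ∎
            where
            open ℤ.≤-Reasoning
            D = ∣ Vec K n ∣
            G = ∑ (λ v → 𝟙 (Good? v))
            direction = detect w (proj₁ w∈)
            e = proj₁ direction
            Qe = proj₁ (proj₂ direction)
            we = proj₂ (proj₂ direction)
            cover : ∀ v → 1ℤ ≤ 𝟙 (Good? v) + (δ (w • v) 0F + δ (Q v) 0F)
            cover v with w • v ≟ 0F | Q v ≟ 0F
            ... | yes _ | yes _ = ≤-by 1ℤ (solve 0 (con 0ℤ :+ (con 1ℤ :+ con 1ℤ) := con 1ℤ :+ con 1ℤ) refl) 0≤+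
            ... | yes _ | no _  = ≤-by 0ℤ (solve 0 (con 0ℤ :+ (con 1ℤ :+ con 0ℤ) := con 1ℤ :+ con 0ℤ) refl) 0≤+
            ... | no _  | yes _ = ≤-by 0ℤ (solve 0 (con 0ℤ :+ (con 0ℤ :+ con 1ℤ) := con 1ℤ :+ con 0ℤ) refl) 0≤+
            ... | no _  | no _  = ≤-by 0ℤ (solve 0 (con 1ℤ :+ (con 0ℤ :+ con 0ℤ) := con 1ℤ :+ con 0ℤ) refl) 0≤+
            line : ∀ k (φ : Vec K n → ℤ) → (∀ x → ∑ (λ s → φ (x ⊕ s ✶ e)) ≤ k) → + q * ∑ φ ≤ k * D
            line k φ h = subst₂ _≤_ (sym (∑-lines φ e)) (∑-const k) (∑-mono h)
            linear : + q * ∑ (λ v → δ (w • v) 0F) ≤ 1ℤ * D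
            linear = line 1ℤ _ λ x → ∑-𝟙-≤1 (λ s → w • (x ⊕ s ✶ e) ≟ 0F) λ s s′ p p′ →
              cancel we (shift-cancel (trans (sym (expand x s)) (trans (trans p (sym p′)) (expand x s′))))
              where
              expand : ∀ x s → w • (x ⊕ s ✶ e) ≡ w • x ⊞ w • e · s
              expand x s = trans (•-comm w _) (trans (•-⊕ x _ w) (cong₂ _⊞_ (•-comm x w)
                (trans (•-✶ s e w) (trans (cong (s ·_) (•-comm e w)) (solveᴷ 2 (λ s t → s :* t := t :* s) refl s (w • e))))))
              shift-cancel : ∀ {a b c} → a ⊞ b ≡ a ⊞ c → b ≡ c
              shift-cancel {a} {b} {c} p = trans (solveᴷ 2 (λ a b → b := :- a :+ (a :+ b)) refl a b)
                (trans (cong (⊟ a ⊞_) p) (solveᴷ 2 (λ a b → :- a :+ (a :+ b) := b) refl a c))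
            quadratic : + q * ∑ (λ v → δ (Q v) 0F) ≤ + 2 * D
            quadratic = line (+ 2) _ λ x → ∑-𝟙-≤ (λ s → Q (x ⊕ s ✶ e) ≟ 0F) 0≤+ λ s₀ p₀ →
              subst (_ ≤_) (trans (∑-+ (δ s₀) (δ (r x s₀))) (trans (cong₂ _+_ (∑-δ-1 s₀) (∑-δ-1 (r x s₀)))
                (solve 0 (con 1ℤ :+ con 1ℤ := con (+ 2)) refl)))
                (∑-mono λ s → two x s₀ s p₀)
              where
              -- By Vieta, the second root of the monic quadratic polynomial `Q (x ⊕ s ✶ e)` in `s`,
              -- given the root `s₀`.
              r : Vec K n → K → K
              r x s₀ = ⊟ s₀ ⊞ ⊟ (2F · (x • e))
              expand : ∀ x s → Q (x ⊕ s ✶ e) ≡ Q x ⊞ s · s ⊞ 2F · (s · (x • e))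
              expand x s = trans (Q-⊕ x _) (cong₂ (λ a b → Q x ⊞ a ⊞ 2F · b)
                (trans (Q-✶ s e) (trans (cong (s · s ·_) Qe) (solveᴷ 1 (λ a → a :* con 1ℤ := a) refl (s · s))))
                (trans (•-comm x _) (trans (•-✶ s e x) (cong (s ·_) (•-comm e x)))))
              two : ∀ x s₀ s → Q (x ⊕ s₀ ✶ e) ≡ 0F → δ (Q (x ⊕ s ✶ e)) 0F ≤ δ s₀ s + δ (r x s₀) s
              two x s₀ s p₀ with Q (x ⊕ s ✶ e) ≟ 0F
              ... | no _  = 0≤-+ (0≤𝟙 (s₀ ≟ s)) (0≤𝟙 (r x s₀ ≟ s))
              ... | yes p with s₀ ≟ s
              ...   | yes _ = ≤-by (δ (r x s₀) s) refl (0≤𝟙 (r x s₀ ≟ s))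
              ...   | no ne = ℤ.≤-reflexive (sym (trans (+-identityˡ _) (𝟙-yes (r x s₀ ≟ s) root)))
                where
                factor : (s ⊞ s₀ ⊞ 2F · (x • e)) · (s ⊞ ⊟ s₀) ≡ 0F
                factor = trans (solveᴷ 4 (λ s t b a → (s :+ t :+ con (+ 2) :* b) :* (s :- t)
                             := (a :+ s :* s :+ con (+ 2) :* (s :* b)) :- (a :+ t :* t :+ con (+ 2) :* (t :* b))) refl s s₀ (x • e) (Q x))
                  (trans (cong₂ (λ a b → a ⊞ ⊟ b) (trans (sym (expand x s)) p) (trans (sym (expand x s₀)) p₀))
                    (solveᴷ 0 (con 0ℤ :- con 0ℤ := con 0ℤ) refl))
                root : r x s₀ ≡ s
                root = trans (solveᴷ 3 (λ s t b → :- t :- con (+ 2) :* b := s :- (s :+ t :+ con (+ 2) :* b)) refl s s₀ (x • e))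
                  (trans (cong (λ a → s ⊞ ⊟ a) (≡0-zero-product factor
                    λ d → ne (trans (solveᴷ 2 (λ s t → t := s :- (s :- t)) refl s s₀) (trans (cong (λ a → s ⊞ ⊟ a) d)
                      (solveᴷ 1 (λ s → s :- con 0ℤ := s) refl s)))))
                    (solveᴷ 1 (λ s → s :- con 0ℤ := s) refl s))

      -- Reflections give `(q - 3) D ≤ q² ∣S∣`, and `q ≤ 4 (q - 3)` as soon as `q ≥ 4`. For `q ≤ 3`
      -- that estimate says nothing, but then `q ^ n ≤ 4 ^ n` and the sphere has at least the point
      -- `w`; this case dictates the factor `4 ^ n`.
      sphere-large : ∀ {n t} (w : Vec K n) → Sphere t w → 1 ℕ.≤ n → ∣ Vec K n ∣ ≤ (+ 4) ^ n * + q * ∣S∣ n t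
      sphere-large {suc n} {t} w w∈ _ with q ℕ.≤? 3
      ... | yes q≤3 = begin
        ∣ Vec K (suc n) ∣ ≡⟨ ∣V∣ (suc n) ⟩
        (+ q) ^ suc n ≤⟨ ^-mono (suc n) 0≤+ (+≤+ (ℕ.≤-trans q≤3 (ℕ.n≤1+n 3))) ⟩
        (+ 4) ^ suc n ≡⟨ solve 1 (λ a → a := a :* con 1ℤ :* con 1ℤ) refl ((+ 4) ^ suc n) ⟩
        (+ 4) ^ suc n * 1ℤ * 1ℤ
          ≤⟨ *-mono (0≤-* (0≤-^ {+ 4} (suc n) 0≤+) 0≤+) 0≤S (*-monoʳ (0≤-^ {+ 4} (suc n) 0≤+) 1≤q) 1≤S ⟩
        (+ 4) ^ suc n * + q * S          ∎
        where
        open ℤ.≤-Reasoning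
        S = ∣S∣ (suc n) t
        1≤S : 1ℤ ≤ S
        1≤S = subst (_≤ S) (𝟙-yes (sphere? t w) w∈) (∑-single w λ x → 0≤𝟙 (sphere? t x))
        0≤S : 0ℤ ≤ S
        0≤S = 0≤-∑ λ x → 0≤𝟙 (sphere? t x)
      ... | no q≰3 = *-cancel 0<q (begin
        + q * D
          ≤⟨ ≤-by ((+ q - + 4) * (+ 3 * D)) (solve 2 (λ q d → con (+ 4) :* (q :* d :- con (+ 3) :* d) := q :* d :+ (q :- con (+ 4)) :* (con (+ 3) :* d)) refl (+ q) D)
                                                        (0≤-* (0≤-diff (+≤+ (ℕ.≰⇒> q≰3))) (0≤-* {+ 3} 0≤+ 0≤∣V∣)) ⟩
        + 4 * (+ q * D - + 3 * D)
          ≤⟨ *-monoʳ {c = + 4} 0≤+ (subst (+ q * D - + 3 * D ≤_) (solve 2 (λ a b → a :+ b :- b := a) refl (+ q * ∑ (λ v → 𝟙 (Good? w w∈ v))) (+ 3 * D))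
                                                        (+-mono-≤ (good-≥ w w∈) (≤-refl { - (+ 3 * D)}))) ⟩
        + 4 * (+ q * ∑ (λ v → 𝟙 (Good? w w∈ v)))
          ≤⟨ *-monoʳ {c = + 4} 0≤+ (*-monoʳ {c = + q} 0≤+ (good-≤ w w∈)) ⟩
        + 4 * (+ q * (+ q * S))
          ≡⟨ solve 2 (λ q s → con (+ 4) :* (q :* (q :* s)) := q :* (con (+ 4) :* con 1ℤ :* (q :* s))) refl (+ q) S ⟩
        + q * (+ 4 * 1ℤ * (+ q * S))
          ≤⟨ *-monoʳ {c = + q} 0≤+ (*-monoˡ (0≤-* {+ q} 0≤+ 0≤S) (*-monoʳ {c = + 4} 0≤+ (1≤4^ n))) ⟩
        + q * ((+ 4) ^ suc n * (+ q * S)) ≡⟨ cong (+ q *_) (sym (*-assoc _ (+ q) S)) ⟩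
        + q * ((+ 4) ^ suc n * + q * S)            ∎)
        where
        open ℤ.≤-Reasoning
        D = ∣ Vec K (suc n) ∣
        S = ∣S∣ (suc n) t
        0≤S : 0ℤ ≤ S
        0≤S = 0≤-∑ λ x → 0≤𝟙 (sphere? t x)

    -- Second moments

    module _ (two≢0 : 2F ≢ 0F) {n : ℕ} where

      private
        V = Vec K n
        D = ∣ V ∣

      ∑-linear : ∀ {α} → α ≢ 0F → ∀ β → ∑ (λ s → δ (α · s) β) ≡ 1ℤ
      ∑-linear {α} α≢0 β = trans
        (∑-cong λ s → 𝟙-cong (α · s ≟ β) (s ≟ β · α⁻¹)
          (λ { refl → trans (solveᴷ 1 (λ s → s := s :* con 1ℤ) refl s) (trans (cong (s ·_) (sym inv)) (solveᴷ 3 (λ s a b → s :* (b :* a) := a :* s :* b) refl s α α⁻¹)) })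
          (λ { refl → trans (solveᴷ 3 (λ a b c → a :* (b :* c) := c :* a :* b) refl α β α⁻¹) (trans (cong (_· β) inv) (solveᴷ 1 (λ s → con 1ℤ :* s := s) refl β)) }))
        (∑-δ-1ʳ (β · α⁻¹))
        where
        α⁻¹ = proj₁ (inverse α≢0)
        inv = proj₂ (inverse α≢0)

      -- The terms quadratic in `a` cancel, which leaves the equation of an affine hyperplane. With
      -- `e` not orthogonal to `x ⊝ x′`, every line in direction `e` meets it exactly once.
      bisector : ∀ (x x′ : V) → x ≢ x′ → ∀ κ κ′ →
                 + q * ∑ (λ a → δ (Q (x ⊝ a) ⊞ κ) (Q (x′ ⊝ a) ⊞ κ′)) ≡ D
      bisector x x′ x≢x′ κ κ′ = trans (∑-lines (λ a → δ (Q (x ⊝ a) ⊞ κ) (Q (x′ ⊝ a) ⊞ κ′)) e)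
        (∑-cong λ a → trans (∑-cong λ s → 𝟙-cong _ (α · s ≟ β a) (to a s) (from a s)) (∑-linear α≢0 (β a)))
        where
        found = detect (x ⊝ x′) (λ p → x≢x′ (⊝≡𝟎 p))
        e = proj₁ found
        α = 2F · (x • e ⊞ ⊟ (x′ • e))
        α≢0 : α ≢ 0F
        α≢0 = ·-≢0 two≢0 (λ p → proj₂ (proj₂ found) (trans (•-⊝ x x′ e) p))
        β : V → K
        β a = Q (x ⊝ a) ⊞ κ ⊞ ⊟ (Q (x′ ⊝ a) ⊞ κ′)
        ⊝-⊕-assoc : ∀ {m} (x a b : Vec K m) → x ⊝ (a ⊕ b) ≡ (x ⊝ a) ⊝ b
        ⊝-⊕-assoc []      []      []      = refl
        ⊝-⊕-assoc (c ∷ x) (d ∷ a) (f ∷ b) = cong₂ _∷_ (solveᴷ 3 (λ c d f → c :- (d :+ f) := c :- d :- f) refl c d f) (⊝-⊕-assoc x a b)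
        expand : ∀ y a s c → Q (y ⊝ (a ⊕ s ✶ e)) ⊞ c ≡ (Q (y ⊝ a) ⊞ c) ⊞ Q (s ✶ e) ⊞ ⊟ (2F · (s · (y • e ⊞ ⊟ (a • e))))
        expand y a s c = trans (cong (_⊞ c) (trans (cong Q (⊝-⊕-assoc y a (s ✶ e))) (trans (Q-⊝ (y ⊝ a) (s ✶ e))
          (cong (λ t → Q (y ⊝ a) ⊞ Q (s ✶ e) ⊞ ⊟ (2F · t)) (trans (•-comm (y ⊝ a) (s ✶ e)) (trans (•-✶ s e _)
            (cong (s ·_) (trans (•-comm e (y ⊝ a)) (•-⊝ y a e)))))))))
          (solveᴷ 4 (λ a b c t → a :+ b :- t :+ c := a :+ c :+ b :- t) refl (Q (y ⊝ a)) (Q (s ✶ e)) c _)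
        difference : ∀ a s → (Q (x ⊝ (a ⊕ s ✶ e)) ⊞ κ) ⊞ ⊟ (Q (x′ ⊝ (a ⊕ s ✶ e)) ⊞ κ′) ≡ β a ⊞ ⊟ (α · s)
        difference a s = trans (cong₂ (λ u v → u ⊞ ⊟ v) (expand x a s κ) (expand x′ a s κ′))
          (solveᴷ 7 (λ p c s u y r v → p :+ c :- con (+ 2) :* (s :* (u :- y)) :- (r :+ c :- con (+ 2) :* (s :* (v :- y)))
                                    := p :- r :- con (+ 2) :* (u :- v) :* s)
            refl (Q (x ⊝ a) ⊞ κ) (Q (s ✶ e)) s (x • e) (a • e) (Q (x′ ⊝ a) ⊞ κ′) (x′ • e))
        ≡⇒⊟≡0 : ∀ {a b} → a ≡ b → a ⊞ ⊟ b ≡ 0F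
        ≡⇒⊟≡0 {a} refl = solveᴷ 1 (λ a → a :- a := con 0ℤ) refl a
        ⊟≡0⇒≡ : ∀ {a b} → a ⊞ ⊟ b ≡ 0F → a ≡ b
        ⊟≡0⇒≡ {a} {b} p = trans (solveᴷ 2 (λ a b → a := a :- b :+ b) refl a b)
          (trans (cong (_⊞ b) p) (solveᴷ 1 (λ b → con 0ℤ :+ b := b) refl b))
        to : ∀ a s → Q (x ⊝ (a ⊕ s ✶ e)) ⊞ κ ≡ Q (x′ ⊝ (a ⊕ s ✶ e)) ⊞ κ′ → α · s ≡ β a
        to a s p = sym (⊟≡0⇒≡ (trans (sym (difference a s)) (≡⇒⊟≡0 p)))
        from : ∀ a s → α · s ≡ β a → Q (x ⊝ (a ⊕ s ✶ e)) ⊞ κ ≡ Q (x′ ⊝ (a ⊕ s ✶ e)) ⊞ κ′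
        from a s p = ⊟≡0⇒≡ (trans (difference a s) (≡⇒⊟≡0 (sym p)))

      private
        0<D = 0<∣V∣ {n}

        -- The value `0F` is the incidence `∥u - a∥ = ∥v - b∥`. The other values are kept because
        -- `mixing` asks how often two points share a value, whichever it is.
        Ψ : V × V → V × V → K
        Ψ (u , v) (a , b) = Q (u ⊝ a) ⊞ ⊟ Q (v ⊝ b)

        -- If `u` and `u′` differ, `b` is held fixed; otherwise `v` and `v′` differ and `a` is held
        -- fixed. In both cases what remains is a `bisector`.
        agree : ∀ p p′ → + q * ∑ (λ h → δ (Ψ p h) (Ψ p′ h)) ≡ D * D + (+ q - 1ℤ) * (D * D * δ p p′)
        agree (u , v) (u′ , v′) = go ((u , v) ≟ (u′ , v′))
          where
          open ≡-Reasoning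
          φ : V × V → ℤ
          φ h = δ (Ψ (u , v) h) (Ψ (u′ , v′) h)
          swap-sides : ∀ {a b c d} → a ⊞ ⊟ b ≡ c ⊞ ⊟ d → b ⊞ c ≡ d ⊞ a
          swap-sides {a} {b} {c} {d} p = trans (solveᴷ 3 (λ b c d → b :+ c := c :- d :+ (b :+ d)) refl b c d)
            (trans (cong (_⊞ (b ⊞ d)) (sym p)) (solveᴷ 3 (λ a b d → a :- b :+ (b :+ d) := d :+ a) refl a b d))
          swap-back : ∀ {a b c d} → b ⊞ c ≡ d ⊞ a → a ⊞ ⊟ b ≡ c ⊞ ⊟ d
          swap-back {a} {b} {c} {d} p = trans (solveᴷ 3 (λ a b d → a :- b := d :+ a :- (b :+ d)) refl a b d)
            (trans (cong (_⊞ ⊟ (b ⊞ d)) (sym p)) (solveᴷ 3 (λ b c d → b :+ c :- (b :+ d) := c :- d) refl b c d))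
          main : (u , v) ≢ (u′ , v′) → Dec (u ≡ u′) → + q * ∑ (λ a → ∑ λ b → φ (a , b)) ≡ D * D
          main ne (no u≢u′) = trans (cong (+ q *_) (∑-swap λ a b → φ (a , b)))
            (trans (sym (∑-* (+ q) λ b → ∑ λ a → φ (a , b))) (trans (∑-cong λ b → bisector u u′ u≢u′ (⊟ Q (v ⊝ b)) (⊟ Q (v′ ⊝ b))) (∑-const D)))
          main ne (yes refl) = trans (sym (∑-* (+ q) λ a → ∑ λ b → φ (a , b))) (trans (∑-cong λ a →
            trans (cong (+ q *_) (∑-cong λ b → 𝟙-cong (_ ≟ _) (_ ≟ _) swap-sides swap-back))
              (bisector v v′ (λ { refl → ne refl }) (Q (u ⊝ a)) (Q (u ⊝ a)))) (∑-const D))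
          go : (d : Dec ((u , v) ≡ (u′ , v′))) → + q * ∑ φ ≡ D * D + (+ q - 1ℤ) * (D * D * 𝟙 d)
          go (yes refl) = begin
            + q * ∑ φ
              ≡⟨ cong (+ q *_) (trans (∑-cong λ h → δ-refl (Ψ (u , v) h)) (trans (∑-× {V} {V} (λ _ → 1ℤ)) (∑-const D))) ⟩
            + q * (D * D)
              ≡⟨ solve 2 (λ q d → q :* d := d :+ (q :- con 1ℤ) :* (d :* con 1ℤ)) refl (+ q) (D * D) ⟩
            D * D + (+ q - 1ℤ) * (D * D * 1ℤ)               ∎
          go (no ne) = begin
            + q * ∑ φ ≡⟨ cong (+ q *_) (∑-× φ) ⟩
            + q * ∑ (λ a → ∑ λ b → φ (a , b)) ≡⟨ main ne (u ≟ u′) ⟩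
            D * D ≡⟨ solve 2 (λ q d → d := d :+ (q :- con 1ℤ) :* (d :* con 0ℤ)) refl (+ q) (D * D) ⟩
            D * D + (+ q - 1ℤ) * (D * D * 0ℤ)               ∎

      module _ (f : V → ℤ) (∑f≡0 : ∑ f ≡ 0ℤ) where

        ‖f‖² : ℤ
        ‖f‖² = ∑ λ x → f x * f x

        autocorrelation : V → ℤ
        autocorrelation w = ∑ λ u → f u * f (u ⊕ w)

        private
          A = autocorrelation

          F² = ‖f‖² * ‖f‖²

          S′ : K → ℤ
          S′ t = ∑ λ w → δ (Q w) t * A w

          S′-pairs : ∀ t → S′ t ≡ ∑ λ u → ∑ λ a → δ (Q (u ⊝ a)) t * (f u * f a)
          S′-pairs t = begin
            ∑ (λ w → δ (Q w) t * ∑ λ a → f a * f (a ⊕ w))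
              ≡⟨ ∑-cong (λ w → sym (∑-* (δ (Q w) t) λ a → f a * f (a ⊕ w))) ⟩
            ∑ (λ w → ∑ λ a → δ (Q w) t * (f a * f (a ⊕ w)))
              ≡⟨ ∑-swap (λ w a → δ (Q w) t * (f a * f (a ⊕ w))) ⟩
            ∑ (λ a → ∑ λ w → δ (Q w) t * (f a * f (a ⊕ w)))
              ≡⟨ ∑-cong (λ a → sym (∑-bij (_⊝ a) (_⊕ a) (λ x → ⊝-⊕ x a) (λ x → ⊕-⊝ x a) λ w → δ (Q w) t * (f a * f (a ⊕ w)))) ⟩
            ∑ (λ a → ∑ λ u → δ (Q (u ⊝ a)) t * (f a * f (a ⊕ (u ⊝ a))))
              ≡⟨ ∑-cong (λ a → ∑-cong λ u → cong (δ (Q (u ⊝ a)) t *_)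
                                                                             (trans (cong (λ x → f a * f x) (trans (⊕-comm a _) (⊝-⊕ u a))) (*-comm (f a) (f u)))) ⟩
            ∑ (λ a → ∑ λ u → δ (Q (u ⊝ a)) t * (f u * f a))
              ≡⟨ ∑-swap (λ a u → δ (Q (u ⊝ a)) t * (f u * f a)) ⟩
            ∑ (λ u → ∑ λ a → δ (Q (u ⊝ a)) t * (f u * f a))             ∎
            where open ≡-Reasoning

          g : V × V → ℤ
          g (u , v) = f u * f v

          ∑S′² : ∑ (λ t → S′ t * S′ t) ≤ D * F²
          ∑S′² = begin
            ∑ (λ t → S′ t * S′ t) ≡⟨ ∑-cong (λ t → cong₂ _*_ (pairs t) (pairs t)) ⟩
            ∑ (λ t → ∑ (λ p → T t p) * ∑ (λ p → T t p)) ≡⟨ ∑-cong (λ t → ∑-*-∑ (T t) (T t)) ⟩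
            ∑ (λ t → ∑ λ p → ∑ λ p′ → T t p * T t p′)
              ≡⟨ trans (∑-swap λ t p → ∑ λ p′ → T t p * T t p′) (∑-cong λ p → trans (∑-swap λ t p′ → T t p * T t p′) (∑-cong λ p′ → join p p′)) ⟩
            ∑ (λ p → ∑ λ p′ → J p p′)
              ≡⟨ trans (∑-× _) (∑-cong λ u → ∑-cong λ a → ∑-× λ p′ → J (u , a) p′) ⟩
            ∑ (λ u → ∑ λ a → ∑ λ v → ∑ λ b → J (u , a) (v , b))
              -- The norms pair `u` with `a` and `v` with `b`. Regrouping as `(u , v)` and `(a , b)`
              -- makes the weights factor into `g` of a point times `g` of a block.
              ≡⟨ ∑-cong (λ u → ∑-swap λ a v → ∑ λ b → J (u , a) (v , b)) ⟩
            ∑ (λ u → ∑ λ v → ∑ λ a → ∑ λ b → J (u , a) (v , b))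
              ≡⟨ ∑-cong (λ u → ∑-cong λ v → ∑-cong λ a → ∑-cong λ b → recast u a v b) ⟩
            ∑ (λ u → ∑ λ v → ∑ λ a → ∑ λ b → g (u , v) * g (a , b) * δ (Ψ (u , v) (a , b)) 0F)
              ≡⟨ sym (trans (∑-× λ p → ∑ λ h → g p * g h * δ (Ψ p h) 0F) (∑-cong λ u → ∑-cong λ v → ∑-× λ h → g (u , v) * g h * δ (Ψ (u , v) h) 0F)) ⟩
            ∑ (λ p → ∑ λ h → g p * g h * δ (Ψ p h) 0F) ≤⟨ mixing Ψ 0F g ∑g D (+ q) 0<D 0<q agree ⟩
            D * ∑ (λ p → g p * g p) ≡⟨ cong (D *_) ∑g² ⟩
            D * F²                                                           ∎
            where
            open ℤ.≤-Reasoning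
            T : K → V × V → ℤ
            T t (u , a) = δ (Q (u ⊝ a)) t * (f u * f a)
            J : V × V → V × V → ℤ
            J (u , a) (v , b) = f u * f a * (f v * f b) * δ (Q (v ⊝ b)) (Q (u ⊝ a))
            pairs : ∀ t → S′ t ≡ ∑ (T t)
            pairs t = trans (S′-pairs t) (sym (∑-× (T t)))
            join : ∀ p p′ → ∑ (λ t → T t p * T t p′) ≡ J p p′
            join (u , a) (v , b) = trans (∑-cong λ t → solve 4 (λ d x e y → d :* x :* (e :* y) := d :* (x :* y :* e)) refl (δ (Q (u ⊝ a)) t) (f u * f a) (δ (Q (v ⊝ b)) t) (f v * f b))
              (∑-δ′ (Q (u ⊝ a)) λ t → f u * f a * (f v * f b) * δ (Q (v ⊝ b)) t)
            recast : ∀ u a v b → J (u , a) (v , b) ≡ g (u , v) * g (a , b) * δ (Ψ (u , v) (a , b)) 0F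
            recast u a v b = cong₂ _*_
              (solve 4 (λ u a v b → u :* a :* (v :* b) := u :* v :* (a :* b)) refl (f u) (f a) (f v) (f b))
              (𝟙-cong (Q (v ⊝ b) ≟ Q (u ⊝ a)) (Ψ (u , v) (a , b) ≟ 0F)
                (λ e → trans (cong (λ t → Q (u ⊝ a) ⊞ ⊟ t) e) (solveᴷ 1 (λ a → a :- a := con 0ℤ) refl (Q (u ⊝ a))))
                (λ e → trans (solveᴷ 2 (λ a b → b := a :- (a :- b)) refl (Q (u ⊝ a)) (Q (v ⊝ b)))
                   (trans (cong (λ t → Q (u ⊝ a) ⊞ ⊟ t) e) (solveᴷ 1 (λ a → a :- con 0ℤ := a) refl (Q (u ⊝ a))))))
            ∑g : ∑ g ≡ 0ℤ
            ∑g = trans (∑-× g) (trans (sym (∑-*-∑ f f)) (trans (cong (_* ∑ f) ∑f≡0) (zeroˡ _)))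
            ∑g² : ∑ (λ p → g p * g p) ≡ F²
            ∑g² = trans (∑-× λ p → g p * g p) (trans (∑-cong λ u → ∑-cong λ v →
                solve 2 (λ a b → a :* b :* (a :* b) := a :* a :* (b :* b)) refl (f u) (f v))
              (sym (∑-*-∑ (λ x → f x * f x) (λ x → f x * f x))))

          S : K → ℤ
          S t = ∑ λ w → 𝟙 (sphere? t w) * A w

          A-𝟎 : A 𝟎 ≡ ‖f‖²
          A-𝟎 = ∑-cong λ u → cong (λ x → f u * f x) (⊕-identityʳ u)

          t₀ = Q (𝟎 {n})

          S-S′ : ∀ t → S t ≡ S′ t - δ t₀ t * ‖f‖²
          S-S′ t = sym (begin
            S′ t - δ t₀ t * ‖f‖² ≡⟨ cong (_- δ t₀ t * ‖f‖²) (∑-cong split) ⟩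
            ∑ (λ w → 𝟙 (sphere? t w) * A w + δ w 𝟎 * (δ (Q w) t * A w)) - δ t₀ t * ‖f‖²
              ≡⟨ cong (_- δ t₀ t * ‖f‖²) (trans (∑-+ (λ w → 𝟙 (sphere? t w) * A w) _) (cong (_+_ (S t)) (trans (∑-δ 𝟎 _) (cong (δ t₀ t *_) A-𝟎)))) ⟩
            S t + δ t₀ t * ‖f‖² - δ t₀ t * ‖f‖² ≡⟨ solve 2 (λ a b → a :+ b :- b := a) refl (S t) _ ⟩
            S t                                                   ∎)
            where
            open ≡-Reasoning
            split : ∀ w → δ (Q w) t * A w ≡ 𝟙 (sphere? t w) * A w + δ w 𝟎 * (δ (Q w) t * A w)
            split w = trans (cong (_* A w) (go (w ≟ 𝟎))) (solve 4 (λ a b c d → (a :+ b :* c) :* d := a :* d :+ b :* (c :* d)) refl (𝟙 (sphere? t w)) (δ w 𝟎) (δ (Q w) t) (A w))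
              where
              go : (d : Dec (w ≡ 𝟎)) → δ (Q w) t ≡ 𝟙 (¬? d ×-dec Q w ≟ t) + 𝟙 d * δ (Q w) t
              go d@(yes _) = trans (solve 1 (λ a → a := con 0ℤ :+ con 1ℤ :* a) refl (δ (Q w) t)) (cong (_+ 1ℤ * δ (Q w) t)
                (sym (trans (𝟙-× (¬? d) (Q w ≟ t)) (zeroˡ _))))
              go d@(no _)  = trans (solve 1 (λ a → a := con 1ℤ :* a :+ con 0ℤ :* a) refl (δ (Q w) t)) (cong (_+ 0ℤ * δ (Q w) t)
                (sym (𝟙-× (¬? d) (Q w ≟ t))))

          -- `S` and `S′` differ only by the share `‖f‖²` of the origin, at the single norm `t₀`. It
          -- is split off by `(a - b)² ≤ 2 a² + 2 b²` and absorbed by `1 ≤ D`, so that the constant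
          -- is `2 + 2`.
          ∑S² : ∑ (λ t → S t * S t) ≤ + 4 * (D * F²)
          ∑S² = begin
            ∑ (λ t → S t * S t) ≤⟨ ∑-mono bound ⟩
            ∑ (λ t → + 2 * (S′ t * S′ t) + δ t₀ t * (+ 2 * F²))
              ≡⟨ trans (∑-+ (λ t → + 2 * (S′ t * S′ t)) _) (cong₂ _+_ (∑-* (+ 2) _) (∑-δ′ t₀ λ _ → + 2 * F²)) ⟩
            + 2 * ∑ (λ t → S′ t * S′ t) + + 2 * F²
              ≤⟨ +-mono-≤ (*-monoʳ {c = + 2} 0≤+ ∑S′²) (*-monoʳ {c = + 2} 0≤+ F²≤DF²) ⟩
            + 2 * (D * F²) + + 2 * (D * F²)
              ≡⟨ solve 1 (λ a → con (+ 2) :* a :+ con (+ 2) :* a := con (+ 4) :* a) refl (D * F²) ⟩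
            + 4 * (D * F²)                                      ∎
            where
            open ℤ.≤-Reasoning
            F²≤DF² : F² ≤ D * F²
            F²≤DF² = subst (_≤ D * F²) (*-identityˡ F²) (*-monoˡ (0≤² ‖f‖²) (0<⇒1≤ 0<D))
            bound : ∀ t → S t * S t ≤ + 2 * (S′ t * S′ t) + δ t₀ t * (+ 2 * F²)
            bound t = subst (λ s → s * s ≤ + 2 * (S′ t * S′ t) + δ t₀ t * (+ 2 * F²)) (sym (S-S′ t)) (go (t₀ ≟ t))
              where
              go : (d : Dec (t₀ ≡ t)) → (S′ t - 𝟙 d * ‖f‖²) * (S′ t - 𝟙 d * ‖f‖²) ≤ + 2 * (S′ t * S′ t) + 𝟙 d * (+ 2 * F²)
              go (yes _) = ≤-by ((S′ t + ‖f‖²) * (S′ t + ‖f‖²)) (solve 2 (λ s a → con (+ 2) :* (s :* s) :+ con 1ℤ :* (con (+ 2) :* (a :* a))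
                := (s :- con 1ℤ :* a) :* (s :- con 1ℤ :* a) :+ (s :+ a) :* (s :+ a)) refl (S′ t) ‖f‖²) (0≤² _)
              go (no _)  = ≤-by (S′ t * S′ t) (solve 2 (λ s a → con (+ 2) :* (s :* s) :+ con 0ℤ :* (con (+ 2) :* (a :* a))
                := (s :- con 0ℤ :* a) :* (s :- con 0ℤ :* a) :+ s :* s) refl (S′ t) ‖f‖²) (0≤² _)

        correlation : O n → V → ℤ
        correlation o z = ∑ λ u → f u * f (⟦ o ⟧ u ⊕ z)

        private
          -- For fixed `u` and `u′` the sum over all translations `z` depends only on the difference
          -- of the images, and it is the autocorrelation at `θ (u′ ⊝ u)`.
          ∑-correlation² : ∀ o → ∑ (λ z → correlation o z * correlation o z) ≡ ∑ λ w → A w * A (⟦ o ⟧ w)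
          ∑-correlation² o = begin
            ∑ (λ z → correlation o z * correlation o z)
              ≡⟨ ∑-cong (λ z → ∑-*-∑ (λ u → f u * f (θ u ⊕ z)) (λ u → f u * f (θ u ⊕ z))) ⟩
            ∑ (λ z → ∑ λ u → ∑ λ u′ → f u * f (θ u ⊕ z) * (f u′ * f (θ u′ ⊕ z)))
              ≡⟨ trans (∑-swap λ z u → ∑ λ u′ → f u * f (θ u ⊕ z) * (f u′ * f (θ u′ ⊕ z)))
                   (∑-cong λ u → ∑-swap λ z u′ → f u * f (θ u ⊕ z) * (f u′ * f (θ u′ ⊕ z))) ⟩
            ∑ (λ u → ∑ λ u′ → ∑ λ z → f u * f (θ u ⊕ z) * (f u′ * f (θ u′ ⊕ z)))
              ≡⟨ ∑-cong (λ u → ∑-cong λ u′ → inner u u′) ⟩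
            ∑ (λ u → ∑ λ u′ → f u * f u′ * A (θ (u′ ⊝ u)))
              ≡⟨ ∑-cong (λ u → trans (sym (∑-translate (λ u′ → f u * f u′ * A (θ (u′ ⊝ u))) u)) (∑-cong λ w →
                   cong₂ (λ x y → f u * f x * A (θ y)) (⊕-comm w u) (⊕-⊝ w u))) ⟩
            ∑ (λ u → ∑ λ w → f u * f (u ⊕ w) * A (θ w))
              ≡⟨ ∑-swap (λ u w → f u * f (u ⊕ w) * A (θ w)) ⟩
            ∑ (λ w → ∑ λ u → f u * f (u ⊕ w) * A (θ w))
              ≡⟨ ∑-cong (λ w → ∑-*ʳ (A (θ w)) λ u → f u * f (u ⊕ w)) ⟩
            ∑ (λ w → A w * A (θ w)) ∎
            where
            open ≡-Reasoning
            θ = ⟦ o ⟧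
            inner : ∀ u u′ → ∑ (λ z → f u * f (θ u ⊕ z) * (f u′ * f (θ u′ ⊕ z))) ≡ f u * f u′ * A (θ (u′ ⊝ u))
            inner u u′ = trans
              (∑-cong λ z → solve 4 (λ a b c d → a :* b :* (c :* d) := a :* c :* (b :* d)) refl (f u) (f (θ u ⊕ z)) (f u′) (f (θ u′ ⊕ z)))
              (trans (∑-* (f u * f u′) (λ z → f (θ u ⊕ z) * f (θ u′ ⊕ z))) (cong (f u * f u′ *_)
                (trans (∑-cong λ z → cong₂ (λ x y → f x * f y) (⊕-comm (θ u) z) (step z))
                  (∑-translate (λ z → f z * f (z ⊕ θ (u′ ⊝ u))) (θ u)))))
              where
              step : ∀ z → θ u′ ⊕ z ≡ (z ⊕ θ u) ⊕ θ (u′ ⊝ u)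
              step z = trans (⊕-comm (θ u′) z) (trans (cong (z ⊕_) (sym (trans (sym (Orth.θ-⊕ (orth o) u (u′ ⊝ u)))
                (cong θ (trans (⊕-comm u _) (⊝-⊕ u′ u)))))) (sym (⊕-assoc z (θ u) (θ (u′ ⊝ u)))))

          T : V → V → ℤ
          T w w′ = A w * A w′ * transporters w w′

          X : K → ℤ
          X t = ∑ λ w → ∑ λ w′ → 𝟙 (sphere? t w) * (𝟙 (sphere? t w′) * T w w′)

          spheres-cover : ∀ (w : V) → 1ℤ ≡ δ 𝟎 w + ∑ λ t → 𝟙 (sphere? t w)
          spheres-cover w with 𝟎 ≟ w
          ... | yes refl = sym (trans (cong (_+_ 1ℤ) (∑-0 λ t → 𝟙-no (sphere? t 𝟎) λ s → proj₁ s refl)) (+-identityʳ 1ℤ))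
          ... | no ne    = sym (trans (+-identityˡ _) (trans
            (∑-cong λ t → 𝟙-cong (sphere? t w) (Q w ≟ t) proj₂ (λ e → (λ p → ne (sym p)) , e)) (∑-δ-1 (Q w))))

          -- A non-zero `w` stays on its sphere under the group, which yields the terms `X t`. The
          -- origin is fixed by all of `O n`, and `A 𝟎` is `‖f‖²`, which yields the first term.
          total : ∑ (λ o → ∑ λ z → correlation o z * correlation o z) ≡ F² * ∣ O n ∣ + ∑ X
          total = begin
            ∑ (λ o → ∑ λ z → correlation o z * correlation o z) ≡⟨ ∑-cong ∑-correlation² ⟩
            ∑ (λ o → ∑ λ w → A w * A (⟦ o ⟧ w))
              ≡⟨ ∑-cong (λ o → ∑-cong λ w → sym (∑-δ′ (⟦ o ⟧ w) λ w′ → A w * A w′)) ⟩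
            ∑ (λ o → ∑ λ w → ∑ λ w′ → δ (⟦ o ⟧ w) w′ * (A w * A w′))
              ≡⟨ trans (∑-swap λ o w → ∑ λ w′ → δ (⟦ o ⟧ w) w′ * (A w * A w′))
                   (∑-cong λ w → trans (∑-swap λ o w′ → δ (⟦ o ⟧ w) w′ * (A w * A w′)) (∑-cong λ w′ →
                     trans (∑-*ʳ (A w * A w′) _) (*-comm _ (A w * A w′)))) ⟩
            ∑ (λ w → ∑ λ w′ → T w w′) ≡⟨ ∑-cong (λ w → ∑-cong λ w′ → split w w′) ⟩
            ∑ (λ w → ∑ λ w′ → δ 𝟎 w * T w w′ + ∑ λ t → 𝟙 (sphere? t w) * (𝟙 (sphere? t w′) * T w w′))
              ≡⟨ trans (∑-cong λ w → ∑-+ (λ w′ → δ 𝟎 w * T w w′) _) (∑-+ (λ w → ∑ λ w′ → δ 𝟎 w * T w w′) _) ⟩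
            ∑ (λ w → ∑ λ w′ → δ 𝟎 w * T w w′) + ∑ (λ w → ∑ λ w′ → ∑ λ t → 𝟙 (sphere? t w) * (𝟙 (sphere? t w′) * T w w′))
              ≡⟨ cong₂ _+_ zero-part (trans (∑-cong λ w → ∑-swap λ w′ t → 𝟙 (sphere? t w) * (𝟙 (sphere? t w′) * T w w′))
                   (∑-swap λ w t → ∑ λ w′ → 𝟙 (sphere? t w) * (𝟙 (sphere? t w′) * T w w′))) ⟩
            F² * ∣ O n ∣ + ∑ X                                    ∎
            where
            open ≡-Reasoning
            preserved : ∀ t w w′ → 𝟙 (sphere? t w) * transporters w w′ ≡ 𝟙 (sphere? t w) * (𝟙 (sphere? t w′) * transporters w w′)
            preserved t w w′ = 𝟙-* (sphere? t w) λ (w≢0 , Qw) → trans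
              (∑-cong λ o → trans (sym (*-identityʳ _)) (trans (𝟙-* (⟦ o ⟧ w ≟ w′) λ { refl → sym (𝟙-yes (sphere? t _) (Orth.≢𝟎 (orth o) w≢0 , trans (Orth.θ-• (orth o) w w) Qw)) })
                (*-comm _ (𝟙 (sphere? t w′)))))
              (∑-* (𝟙 (sphere? t w′)) _)
            split : ∀ w w′ → T w w′ ≡ δ 𝟎 w * T w w′ + ∑ λ t → 𝟙 (sphere? t w) * (𝟙 (sphere? t w′) * T w w′)
            split w w′ = begin
              T w w′ ≡⟨ sym (*-identityˡ _) ⟩
              1ℤ * T w w′ ≡⟨ cong (_* T w w′) (spheres-cover w) ⟩
              (δ 𝟎 w + ∑ λ t → 𝟙 (sphere? t w)) * T w w′ ≡⟨ distribʳ (T w w′) (δ 𝟎 w) _ ⟩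
              δ 𝟎 w * T w w′ + (∑ λ t → 𝟙 (sphere? t w)) * T w w′
                ≡⟨ cong (_+_ (δ 𝟎 w * T w w′)) (trans (sym (∑-*ʳ (T w w′) _)) (∑-cong λ t →
                   trans (solve 3 (λ s a r → s :* (a :* r) := a :* (s :* r)) refl (𝟙 (sphere? t w)) (A w * A w′) (transporters w w′))
                   (trans (cong (A w * A w′ *_) (preserved t w w′))
                     (solve 4 (λ s s′ a r → a :* (s :* (s′ :* r)) := s :* (s′ :* (a :* r))) refl (𝟙 (sphere? t w)) (𝟙 (sphere? t w′)) (A w * A w′) (transporters w w′))))) ⟩
              δ 𝟎 w * T w w′ + ∑ (λ t → 𝟙 (sphere? t w) * (𝟙 (sphere? t w′) * T w w′)) ∎
            zero-part : ∑ (λ w → ∑ λ w′ → δ 𝟎 w * T w w′) ≡ F² * ∣ O n ∣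
            zero-part = trans (∑-cong λ w → ∑-* (δ 𝟎 w) (T w)) (trans (∑-δ′ 𝟎 λ w → ∑ (T w))
              (trans (∑-cong λ w′ → trans (cong (A 𝟎 * A w′ *_) (trans (∑-cong λ o → cong (λ x → δ x w′) (Orth.θ-𝟎 (orth o))) (∑-const (δ 𝟎 w′))))
                 (solve 4 (λ a b d m → a :* b :* (d :* m) := d :* (a :* b :* m)) refl (A 𝟎) (A w′) (δ 𝟎 w′) ∣ O n ∣))
                (trans (∑-δ′ 𝟎 λ w′ → A 𝟎 * A w′ * ∣ O n ∣) (cong (λ a → a * a * ∣ O n ∣) A-𝟎))))

          module _ (1≤n : 1 ℕ.≤ n) where

            B = (+ 4) ^ n * + q

            0≤B : 0ℤ ≤ B
            0≤B = 0≤-* (0≤-^ {+ 4} n 0≤+) 0≤+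

            -- On a non-empty sphere of size `N` the number of transporters is constantly
            -- `∣ O n ∣ / N`, so `N * X t` is `∣ O n ∣` times the square of `S t`. This also shows
            -- that `X t` is not negative, which is needed before `sphere-large` can replace `D` by
            -- a multiple of `N`.
            X-≤ : ∀ t → D * X t ≤ B * ∣ O n ∣ * (S t * S t)
            X-≤ t with any⊎none (sphere? {n} t)
            ... | inj₂ empty = ℤ.≤-trans (ℤ.≤-reflexive (trans (cong (D *_) (∑-0 λ w → ∑-0 λ w′ →
                  trans (cong (_* (𝟙 (sphere? t w′) * T w w′)) (𝟙-no (sphere? t w) (empty w))) (zeroˡ _))) (zeroʳ D)))
                (0≤-* (0≤-* 0≤B 0≤∣O∣) (0≤² (S t)))
            ... | inj₁ (w₀ , w₀∈) = begin
              D * X t ≤⟨ *-monoˡ 0≤X (sphere-large two≢0 w₀ w₀∈ 1≤n) ⟩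
              B * N * X t ≡⟨ trans (*-assoc B N (X t)) (cong (B *_) NX) ⟩
              B * (∣ O n ∣ * (S t * S t)) ≡⟨ sym (*-assoc B ∣ O n ∣ _) ⟩
              B * ∣ O n ∣ * (S t * S t)      ∎
              where
              open ℤ.≤-Reasoning
              N = ∣S∣ n t
              1≤N : 1ℤ ≤ N
              1≤N = subst (_≤ N) (𝟙-yes (sphere? t w₀) w₀∈) (∑-single w₀ λ x → 0≤𝟙 (sphere? t x))
              NX : N * X t ≡ ∣ O n ∣ * (S t * S t)
              NX = trans (sym (∑-* N _)) (trans (∑-cong λ w → trans (sym (∑-* N _)) (∑-cong λ w′ → pointwise w w′))
                (trans (∑-cong λ w → ∑-* ∣ O n ∣ λ w′ → 𝟙 (sphere? t w) * A w * (𝟙 (sphere? t w′) * A w′)) (trans (∑-* ∣ O n ∣ _)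
                  (cong (∣ O n ∣ *_) (sym (∑-*-∑ (λ w → 𝟙 (sphere? t w) * A w) (λ w → 𝟙 (sphere? t w) * A w)))))))
                where
                pointwise : ∀ w w′ → N * (𝟙 (sphere? t w) * (𝟙 (sphere? t w′) * T w w′))
                                   ≡ ∣ O n ∣ * (𝟙 (sphere? t w) * A w * (𝟙 (sphere? t w′) * A w′))
                pointwise w w′ = trans (solve 5 (λ m s s′ a r → m :* (s :* (s′ :* (a :* r))) := a :* (s :* (s′ :* (m :* r)))) refl
                    N (𝟙 (sphere? t w)) (𝟙 (sphere? t w′)) (A w * A w′) (transporters w w′))
                  (trans (cong (A w * A w′ *_) (𝟙-* (sphere? t w) λ w∈ → 𝟙-* (sphere? t w′) λ w′∈ → orbit-stabilizer two≢0 w w′ w∈ w′∈))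
                    (solve 5 (λ s s′ a b r → a :* b :* (s :* (s′ :* r)) := r :* (s :* a :* (s′ :* b))) refl
                      (𝟙 (sphere? t w)) (𝟙 (sphere? t w′)) (A w) (A w′) ∣ O n ∣))
              0≤X : 0ℤ ≤ X t
              0≤X = *-cancel {c = N} (1≤⇒0< 1≤N)
                (subst₂ _≤_ (sym (zeroʳ N)) (sym NX) (0≤-* 0≤∣O∣ (0≤² (S t))))

        -- For f = ∣V∣ · 1_E − ∣E∣ this is, up to scaling, the variance over the rigid
        -- motions g of the number of points of E that g maps into E.
        variance : 1 ℕ.≤ n → ∑ (λ o → ∑ λ z → correlation o z * correlation o z)
                           ≤ + 5 * ((+ 4) ^ n * + q) * ∣ O n ∣ * (‖f‖² * ‖f‖²)
        variance 1≤n = *-cancel 0<D (begin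
          D * ∑ (λ o → ∑ λ z → correlation o z * correlation o z) ≡⟨ cong (D *_) total ⟩
          D * (F² * N + ∑ X) ≡⟨ trans (distribˡ D _ _) (cong (_+_ (D * (F² * N))) (sym (∑-* D X))) ⟩
          D * (F² * N) + ∑ (λ t → D * X t) ≤⟨ +-mono-≤ (≤-refl {D * (F² * N)}) (∑-mono (X-≤ 1≤n)) ⟩
          D * (F² * N) + ∑ (λ t → B′ * N * (S t * S t)) ≡⟨ cong (_+_ (D * (F² * N))) (∑-* (B′ * N) _) ⟩
          D * (F² * N) + B′ * N * ∑ (λ t → S t * S t)
            -- Since `1 ≤ B′`, the share of the origin counts as one more copy of the four from
            -- `∑S²`; hence the constant 5.
            ≤⟨ +-mono-≤ 1≤B (*-monoʳ (0≤-* (0≤B 1≤n) 0≤∣O∣) ∑S²) ⟩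
          B′ * (D * (F² * N)) + B′ * N * (+ 4 * (D * F²))
            ≡⟨ solve 4 (λ b d f m → b :* (d :* (f :* m)) :+ b :* m :* (con (+ 4) :* (d :* f))
                                                       := d :* (con (+ 5) :* b :* m :* f)) refl B′ D F² N ⟩
          D * (+ 5 * B′ * N * F²)                  ∎)
          where
          open ℤ.≤-Reasoning
          N = ∣ O n ∣
          B′ = (+ 4) ^ n * + q
          1≤B : D * (F² * N) ≤ B′ * (D * (F² * N))
          1≤B = subst (_≤ B′ * (D * (F² * N))) (*-identityˡ _) (*-monoˡ (0≤-* (0≤∣V∣ {n}) (0≤-* (0≤² ‖f‖²) 0≤∣O∣))
            (subst (_≤ B′) (*-identityˡ 1ℤ) (*-mono {1ℤ} {(+ 4) ^ n} {1ℤ} 0≤+ 0≤+ (1≤4^ n) 1≤q)))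

    -- Fixed spaces

    open Support 0F public

    Supp-✶ : ∀ {n} (J : Vec Bool n) a {x} → Supp J x → Supp J (a ✶ x)
    Supp-✶ []          a {[]}    _       = tt
    Supp-✶ (true ∷ J)  a {b ∷ x} s       = Supp-✶ J a s
    Supp-✶ (false ∷ J) a {b ∷ x} (refl , s) = solveᴷ 1 (λ a → a :* con 0ℤ := con 0ℤ) refl a , Supp-✶ J a s

    Supp-⊝ : ∀ {n} (J : Vec Bool n) {x y} → Supp J x → Supp J y → Supp J (x ⊝ y)
    Supp-⊝ []          {[]}    {[]}    _          _          = tt
    Supp-⊝ (true ∷ J)  {a ∷ x} {b ∷ y} s          t          = Supp-⊝ J s t
    Supp-⊝ (false ∷ J) {a ∷ x} {b ∷ y} (refl , s) (refl , t) = solveᴷ 0 (con 0ℤ :- con 0ℤ := con 0ℤ) refl , Supp-⊝ J s t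

    record IsSubspace {n} (P : Pred (Vec K n) 0ℓ) : Set where
      field
        ⊕-closed : ∀ {x y} → P x → P y → P (x ⊕ y)
        ✶-closed : ∀ a {x} → P x → P (a ✶ x)

    record Complement {n} (P : Pred (Vec K n) 0ℓ) : Set where
      field
        J       : Vec Bool n
        trivial : ∀ u → Supp J u → P u → u ≡ 𝟎
        decomp  : ∀ x → ∃ λ u → ∃ λ y → Supp J u × P y × x ≡ u ⊕ y

    -- Gaussian elimination: the first coordinate is left out exactly when `P` contains a pivot
    -- vector `1F ∷ w`. Searching among the `w` supported on `C.J` suffices, since a vector of `P`
    -- that violates triviality for `true ∷ C.J` can be scaled to that form.
    complement : ∀ {n} {P : Pred (Vec K n) 0ℓ} → Decidable P → P 𝟎 → IsSubspace P → Complement P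
    complement {zero}  P? P𝟎 _ = record
      { J = [] ; trivial = λ { [] _ _ → refl } ; decomp = λ { [] → [] , [] , tt , P𝟎 , refl } }
    complement {suc n} {P} P? P𝟎 sub = extend (any⊎none λ w → supp? C.J w ×-dec P? (1F ∷ w))
      where
      open IsSubspace sub
      0·0 : 0F ≡ 0F ⊞ 0F
      0·0 = solveᴷ 0 (con 0ℤ := con 0ℤ :+ con 0ℤ) refl
      tail-sub : IsSubspace (λ x → P (0F ∷ x))
      tail-sub = record
        { ⊕-closed = λ p r → subst (λ a → P (a ∷ _)) (sym 0·0) (⊕-closed p r)
        ; ✶-closed = λ a p → subst (λ b → P (b ∷ _)) (solveᴷ 1 (λ a → a :* con 0ℤ := con 0ℤ) refl a) (✶-closed a p) }
      module C = Complement (complement (λ x → P? (0F ∷ x)) P𝟎 tail-sub)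
      extend : (∃ λ w → Supp C.J w × P (1F ∷ w)) ⊎ (∀ w → ¬ (Supp C.J w × P (1F ∷ w))) → Complement P
      extend (inj₁ (w , w∈ , Pw)) = record
        { J = false ∷ C.J
        ; trivial = λ { (_ ∷ u) (refl , s) p → cong (0F ∷_) (C.trivial u s p) }
        ; decomp = dec }
        where
        dec : ∀ x → ∃ λ u → ∃ λ y → Supp (false ∷ C.J) u × P y × x ≡ u ⊕ y
        dec (a ∷ x) =
          let u , y , s , p , e = C.decomp (x ⊝ a ✶ w)
          in 0F ∷ u , (0F ∷ y) ⊕ a ✶ (1F ∷ w) , (refl , s) , ⊕-closed p (✶-closed a Pw)
           , cong₂ _∷_ (solveᴷ 1 (λ a → a := con 0ℤ :+ (con 0ℤ :+ a :* con 1ℤ)) refl a)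
               (trans (sym (⊝-⊕ x (a ✶ w))) (trans (cong (_⊕ a ✶ w) e) (⊕-assoc u y (a ✶ w))))
      extend (inj₂ none) = record
        { J = true ∷ C.J
        ; trivial = triv
        ; decomp = dec }
        where
        triv : ∀ u → Supp (true ∷ C.J) u → P u → u ≡ 𝟎
        triv (a ∷ u) s p = go (a ≟ 0F)
          where
          go : Dec (a ≡ 0F) → a ∷ u ≡ 𝟎
          go (yes refl) = cong (0F ∷_) (C.trivial u s p)
          go (no a≢0)   = contradiction
            (Supp-✶ C.J (proj₁ (inverse a≢0)) s , subst (λ b → P (b ∷ (proj₁ (inverse a≢0) ✶ u))) (proj₂ (inverse a≢0)) (✶-closed (proj₁ (inverse a≢0)) p))
            (none (proj₁ (inverse a≢0) ✶ u))
        dec : ∀ x → ∃ λ u → ∃ λ y → Supp (true ∷ C.J) u × P y × x ≡ u ⊕ y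
        dec (a ∷ x) =
          let u , y , s , p , e = C.decomp x
          in a ∷ u , 0F ∷ y , s , p , cong₂ _∷_ (solveᴷ 1 (λ a → a := a :+ con 0ℤ) refl a) e

    act-mask : ∀ {n m} (J : Vec Bool m) (M : Vec (Vec K n) m) u → Supp J u →
               act (Support.mask 𝟎 J M) u ≡ act M u
    act-mask []          []      []      _          = refl
    act-mask (true ∷ J)  (c ∷ M) (a ∷ u) s          = cong (a ✶ c ⊕_) (act-mask J M u s)
    act-mask (false ∷ J) (c ∷ M) (a ∷ u) (refl , s) =
      cong₂ _⊕_ (trans (0✶ 𝟎) (sym (0✶ c))) (act-mask J M u s)

    module _ {n : ℕ} where

      private
        V = Vec K n
        D = ∣ V ∣
        module M = Support {A = V} 𝟎

      Fix : O n → V → Set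
      Fix o y = ⟦ o ⟧ y ≡ y

      fix : O n → ℤ
      fix o = ∑ λ y → δ (⟦ o ⟧ y) y

      private
        Fix-⊝ : ∀ o {x y} → Fix o x → Fix o y → Fix o (x ⊝ y)
        Fix-⊝ o p r = trans (Orth.θ-⊝ (orth o) _ _) (cong₂ _⊝_ p r)

        C : ∀ o → Complement (Fix o)
        C o = complement (λ y → ⟦ o ⟧ y ≟ y) (Orth.θ-𝟎 (orth o)) (record
          { ⊕-closed = λ p r → trans (Orth.θ-⊕ (orth o) _ _) (cong₂ _⊕_ p r)
          ; ✶-closed = λ a p → trans (Orth.θ-✶ (orth o) a _) (cong (a ✶_) p) })

        J : O n → Vec Bool n
        J o = Complement.J (C o)

      0≤fix : ∀ o → 0ℤ ≤ fix o
      0≤fix o = 0≤-∑ λ y → 0≤𝟙 (⟦ o ⟧ y ≟ y)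

      private
        -- The fixed space and the vectors supported on `J o` meet only in the origin, so addition
        -- is injective on their product.
        fix-size : ∀ o → fix o * (+ q) ^ ∥ J o ∥ ≤ D
        fix-size o = begin
          fix o * (+ q) ^ ∥ J o ∥
            ≡⟨ cong (fix o *_) (trans (cong (_^ ∥ J o ∥) (sym ∣K∣)) (sym (∣Supp∣ (J o)))) ⟩
          fix o * ∑ (λ u → 𝟙 (supp? (J o) u)) ≡⟨ ∑-*-∑ (λ y → δ (⟦ o ⟧ y) y) (λ u → 𝟙 (supp? (J o) u)) ⟩
          ∑ (λ y → ∑ λ u → δ (⟦ o ⟧ y) y * 𝟙 (supp? (J o) u))
            ≡⟨ ∑-cong (λ y → ∑-cong λ u → trans (sym (𝟙-× (⟦ o ⟧ y ≟ y) (supp? (J o) u))) (sym (*-identityʳ _))) ⟩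
          ∑ (λ y → ∑ λ u → 𝟙 (P? (y , u)) * 1ℤ) ≡⟨ sym (∑-× λ p → 𝟙 (P? p) * 1ℤ) ⟩
          ∑ (λ p → 𝟙 (P? p) * 1ℤ) ≤⟨ ∑-inj P? inj (const 1ℤ) (λ _ → 0≤+) ⟩
          D                                                             ∎
          where
          open ℤ.≤-Reasoning
          open Complement (C o) using (trivial)
          P? : (p : V × V) → Dec (Fix o (proj₁ p) × Supp (J o) (proj₂ p))
          P? (y , u) = ⟦ o ⟧ y ≟ y ×-dec supp? (J o) u
          add : V × V → V
          add (y , u) = y ⊕ u
          exchange : ∀ {m} (y u y′ u′ : Vec K m) → y ⊕ u ≡ y′ ⊕ u′ → u ⊝ u′ ≡ y′ ⊝ y
          exchange []      []      []        []        _ = refl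
          exchange (a ∷ y) (b ∷ u) (a′ ∷ y′) (b′ ∷ u′) e = cong₂ _∷_
            (trans (solveᴷ 3 (λ a b b′ → b :- b′ := a :+ b :- (a :+ b′)) refl a b b′)
              (trans (cong (λ t → t ⊞ ⊟ (a ⊞ b′)) (cong Vec.head e)) (solveᴷ 3 (λ a a′ b′ → a′ :+ b′ :- (a :+ b′) := a′ :- a) refl a a′ b′)))
            (exchange y u y′ u′ (cong Vec.tail e))
          inj : ∀ p p′ → Fix o (proj₁ p) × Supp (J o) (proj₂ p) → Fix o (proj₁ p′) × Supp (J o) (proj₂ p′) → add p ≡ add p′ → p ≡ p′
          inj (y , u) (y′ , u′) (f , s) (f′ , s′) e =
            let d = exchange y u y′ u′ e
                z = trivial (u ⊝ u′) (Supp-⊝ (J o) s s′) (subst (Fix o) (sym d) (Fix-⊝ o f′ f))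
            in cong₂ _,_ (sym (⊝≡𝟎 (trans (sym d) z))) (⊝≡𝟎 z)

        -- The fixed space of θ is the orthogonal complement of the image of θ − 1,
        -- so θ is determined by its restriction to the coordinate complement.
        determined : ∀ o o′ → (∀ u → Supp (J o) u → ⟦ o ⟧ u ≡ ⟦ o′ ⟧ u) → J o ≡ J o′ → o ≡ o′
        determined o o′ agree-on same = O-ext λ x →
          let u , y , s , p , e = Complement.decomp (C o) x
          in begin
            ⟦ o ⟧ x ≡⟨ cong ⟦ o ⟧ e ⟩
            ⟦ o ⟧ (u ⊕ y) ≡⟨ T.θ-⊕ u y ⟩
            ⟦ o ⟧ u ⊕ ⟦ o ⟧ y ≡⟨ cong₂ _⊕_ (agree-on u s) (trans p (sym (fixed y p))) ⟩
            ⟦ o′ ⟧ u ⊕ ⟦ o′ ⟧ y ≡⟨ sym (T′.θ-⊕ u y) ⟩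
            ⟦ o′ ⟧ (u ⊕ y) ≡⟨ cong ⟦ o′ ⟧ (sym e) ⟩
            ⟦ o′ ⟧ x              ∎
          where
          open ≡-Reasoning
          module T = Orth (orth o)
          module T′ = Orth (orth o′)
          -- A vector fixed by `o` is orthogonal to the image of `⟦ o′ ⟧` minus the identity: on the
          -- part `u` of `w` the two maps agree and `o` preserves products with `y`, while the part
          -- `v` is fixed by `o′`. The decomposition is the one of `o′`, whence the requirement
          -- `J o ≡ J o′`.
          orthogonal : ∀ y → Fix o y → ∀ w → y • ⟦ o′ ⟧ w ≡ y • w
          orthogonal y p w =
            let u , v , s , r , e = Complement.decomp (C o′) w
                s′ = subst (λ I → Supp I u) (sym same) s
            in begin
              y • ⟦ o′ ⟧ w ≡⟨ cong (λ w → y • ⟦ o′ ⟧ w) e ⟩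
              y • ⟦ o′ ⟧ (u ⊕ v) ≡⟨ cong (y •_) (T′.θ-⊕ u v) ⟩
              y • (⟦ o′ ⟧ u ⊕ ⟦ o′ ⟧ v) ≡⟨ cong₂ (λ a b → y • (a ⊕ b)) (sym (agree-on u s′)) r ⟩
              y • (⟦ o ⟧ u ⊕ v) ≡⟨ dist (⟦ o ⟧ u) v ⟩
              y • ⟦ o ⟧ u ⊞ y • v ≡⟨ cong (_⊞ y • v) (trans (cong (_• ⟦ o ⟧ u) (sym p)) (T.θ-• y u)) ⟩
              y • u ⊞ y • v ≡⟨ sym (dist u v) ⟩
              y • (u ⊕ v) ≡⟨ cong (y •_) (sym e) ⟩
              y • w                         ∎
            where
            dist : ∀ a b → y • (a ⊕ b) ≡ y • a ⊞ y • b
            dist a b = trans (•-comm y _) (trans (•-⊕ a b y) (cong₂ _⊞_ (•-comm a y) (•-comm b y)))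
          fixed : ∀ y → Fix o y → Fix o′ y
          fixed y p = go ((⟦ o′ ⟧ y ⊝ y) ≟ 𝟎)
            where
            go : Dec (⟦ o′ ⟧ y ⊝ y ≡ 𝟎) → Fix o′ y
            go (yes z) = ⊝≡𝟎 z
            go (no ne) =
              let e , _ , ne′ = detect _ ne
                  w , w↦e = T′.surjective e
              in contradiction (begin
                   (⟦ o′ ⟧ y ⊝ y) • e ≡⟨ •-⊝ (⟦ o′ ⟧ y) y e ⟩
                   ⟦ o′ ⟧ y • e ⊞ ⊟ (y • e) ≡⟨ cong (λ e → ⟦ o′ ⟧ y • e ⊞ ⊟ (y • e)) (sym w↦e) ⟩
                   ⟦ o′ ⟧ y • ⟦ o′ ⟧ w ⊞ ⊟ (y • ⟦ o′ ⟧ w)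
                     ≡⟨ cong₂ (λ s t → s ⊞ ⊟ t) (T′.θ-• y w) (orthogonal y p w) ⟩
                   y • w ⊞ ⊟ (y • w) ≡⟨ solveᴷ 1 (λ a → a :- a := con 0ℤ) refl (y • w) ⟩
                   0F                                          ∎) ne′

        -- By `determined` the columns in `I` determine `o`. Masking the others leaves `∥ I ∥`
        -- columns with `D` choices each.
        count-J : ∀ I → ∑ (λ o → δ (J o) I) ≤ D ^ ∥ I ∥
        count-J I = begin
          ∑ (λ o → δ (J o) I)
            ≡⟨ ∑-cong (λ o → trans (sym (*-identityʳ _)) (cong (δ (J o) I *_) (sym (𝟙-yes (M.supp? I (h o)) (M.mask-Supp I (proj₁ o)))))) ⟩
          ∑ (λ o → δ (J o) I * 𝟙 (M.supp? I (h o)))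
            ≤⟨ ∑-inj (λ o → J o ≟ I) inj (λ N → 𝟙 (M.supp? I N)) (λ N → 0≤𝟙 (M.supp? I N)) ⟩
          ∑ (λ N → 𝟙 (M.supp? I N)) ≡⟨ trans (M.∣Supp∣ I) (cong (D ^_) (same I)) ⟩
          D ^ ∥ I ∥                                                          ∎
          where
          open ℤ.≤-Reasoning
          same : ∀ {m} (I : Vec Bool m) → M.∥ I ∥ ≡ ∥ I ∥
          same []          = refl
          same (true ∷ I)  = cong suc (same I)
          same (false ∷ I) = same I
          h : O n → Vec V n
          h o = M.mask I (proj₁ o)
          inj : ∀ o o′ → J o ≡ I → J o′ ≡ I → h o ≡ h o′ → o ≡ o′
          inj o o′ p r e = determined o o′
            (λ u s → let s′ = subst (λ I → Supp I u) p s in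
              trans (sym (act-mask I (proj₁ o) u s′)) (trans (cong (λ N → act N u) e) (act-mask I (proj₁ o′) u s′)))
            (trans p (sym r))

      -- The exponent `n` is the one for which two bounds cancel, because `q ^ n` is `D`: at most
      -- `D ^ ∥ I ∥` elements have the complement `I`, and for each of them `fix o ^ n` is at most
      -- `D ^ n / D ^ ∥ I ∥`. The factor `2 ^ n` is the number of sets `I`.
      ∑-fix^ : ∑ (λ o → fix o ^ n) ≤ (+ 2) ^ n * D ^ n
      ∑-fix^ = begin
        ∑ (λ o → fix o ^ n) ≡⟨ ∑-fibre J _ ⟩
        ∑ (λ I → ∑ λ o → δ (J o) I * fix o ^ n) ≤⟨ ∑-mono per-J ⟩
        ∑ (λ (I : Vec Bool n) → D ^ n) ≡⟨ ∑-const (D ^ n) ⟩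
        D ^ n * ∣ Vec Bool n ∣
          ≡⟨ trans (cong (D ^ n *_) (trans (∣Vec∣ n) (cong (_^ n) ∣Bool∣))) (*-comm (D ^ n) _) ⟩
        (+ 2) ^ n * D ^ n                           ∎
        where
        open ℤ.≤-Reasoning
        power : ∀ o → D ^ ∥ J o ∥ * fix o ^ n ≤ D ^ n
        power o = subst (_≤ D ^ n) (trans (^-distrib-* (fix o) ((+ q) ^ ∥ J o ∥) n)
            (trans (*-comm (fix o ^ n) _) (cong (_* fix o ^ n) (trans (^-comm (+ q) ∥ J o ∥ n) (cong (_^ ∥ J o ∥) (sym (∣V∣ n)))))))
          (^-mono n (0≤-* (0≤fix o) (0≤-^ {+ q} ∥ J o ∥ 0≤+)) (fix-size o))
        per-J : ∀ I → ∑ (λ o → δ (J o) I * fix o ^ n) ≤ D ^ n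
        per-J I = *-cancel (0<-^ ∥ I ∥ (0<∣V∣ {n})) (begin
          D ^ ∥ I ∥ * ∑ (λ o → δ (J o) I * fix o ^ n) ≡⟨ sym (∑-* (D ^ ∥ I ∥) _) ⟩
          ∑ (λ o → D ^ ∥ I ∥ * (δ (J o) I * fix o ^ n))
            ≡⟨ ∑-cong (λ o → solve 3 (λ a b c → a :* (b :* c) := b :* (a :* c)) refl (D ^ ∥ I ∥) (δ (J o) I) (fix o ^ n)) ⟩
          ∑ (λ o → δ (J o) I * (D ^ ∥ I ∥ * fix o ^ n))
            ≤⟨ ∑-mono (λ o → 𝟙-*-≤ (J o ≟ I) λ { refl → power o }) ⟩
          ∑ (λ o → δ (J o) I * D ^ n) ≡⟨ ∑-*ʳ (D ^ n) _ ⟩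
          ∑ (λ o → δ (J o) I) * D ^ n ≤⟨ *-monoˡ (0≤-^ n (0≤∣V∣ {n})) (count-J I) ⟩
          D ^ ∥ I ∥ * D ^ n                              ∎)

      -- Fixed points of rigid motions

      Motion : Set
      Motion = O n × V

      _▹_ : Motion → V → V
      (o , z) ▹ x = ⟦ o ⟧ x ⊕ z

      fixₘ : Motion → ℤ
      fixₘ g = ∑ λ x → δ (g ▹ x) x

      private
        -- Subtracting one fixed point of the motion maps all its fixed points injectively to fixed
        -- points of its linear part.
        fixₘ≤fix : ∀ o z → fixₘ (o , z) ≤ fix o
        fixₘ≤fix o z = ∑-𝟙-≤ (λ x → (o , z) ▹ x ≟ x) (0≤fix o) λ x₀ p₀ →
          subst (_≤ fix o) (∑-cong λ x → trans (𝟙-* ((o , z) ▹ x ≟ x) (λ p → 𝟙-yes (⟦ o ⟧ (x ⊝ x₀) ≟ x ⊝ x₀)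
              (trans (Orth.θ-⊝ (orth o) x x₀) (trans (sym (drop (⟦ o ⟧ x) (⟦ o ⟧ x₀) z)) (cong₂ _⊝_ p p₀))))) (*-identityʳ _))
            (∑-inj (λ x → (o , z) ▹ x ≟ x) {h = _⊝ x₀} (λ x x′ _ _ e → trans (sym (⊝-⊕ x x₀)) (trans (cong (_⊕ x₀) e) (⊝-⊕ x′ x₀)))
              (λ y → δ (⟦ o ⟧ y) y) (λ y → 0≤𝟙 (⟦ o ⟧ y ≟ y)))
          where
          drop : ∀ {m} (x y z : Vec K m) → (x ⊕ z) ⊝ (y ⊕ z) ≡ x ⊝ y
          drop []      []      []      = refl
          drop (a ∷ x) (b ∷ y) (c ∷ z) = cong₂ _∷_ (solveᴷ 3 (λ a b c → a :+ c :- (b :+ c) := a :- b) refl a b c) (drop x y z)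

        -- For a given linear part, each `x` is fixed by exactly one choice of the translation,
        -- `x ⊝ ⟦ o ⟧ x`.
        ∑-fixₘ : ∀ o → ∑ (λ z → fixₘ (o , z)) ≡ D
        ∑-fixₘ o = trans (∑-swap λ z x → δ (⟦ o ⟧ x ⊕ z) x) (∑-cong λ x → trans
          (∑-cong λ z → 𝟙-cong (⟦ o ⟧ x ⊕ z ≟ x) (z ≟ x ⊝ ⟦ o ⟧ x)
            (λ e → trans (sym (⊕-⊝ z (⟦ o ⟧ x))) (cong (_⊝ ⟦ o ⟧ x) (trans (⊕-comm z _) e)))
            (λ { refl → trans (⊕-comm (⟦ o ⟧ x) _) (⊝-⊕ x (⟦ o ⟧ x)) }))
          (∑-δ-1ʳ (x ⊝ ⟦ o ⟧ x)))

        fix≤D : ∀ o → fix o ≤ D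
        fix≤D o = ∑-mono λ y → 𝟙≤1 (⟦ o ⟧ y ≟ y)

        0≤fixₘ : ∀ g → 0ℤ ≤ fixₘ g
        0≤fixₘ g = 0≤-∑ λ x → 0≤𝟙 (g ▹ x ≟ x)

      -- Of the `suc k` factors one is kept exact, since its sum over the translations is `D`; `n`
      -- factors go into `∑-fix^`, and the remaining `k - n` are estimated by `D`.
      ∑-fixₘ^ : ∀ {k} → n ℕ.≤ k → ∑ (λ g → fixₘ g ^ suc k) ≤ (+ 2) ^ n * D ^ suc k
      ∑-fixₘ^ {k} n≤k = begin
        ∑ (λ g → fixₘ g ^ suc k) ≡⟨ ∑-× (λ g → fixₘ g ^ suc k) ⟩
        ∑ (λ o → ∑ λ z → fixₘ (o , z) * fixₘ (o , z) ^ k)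
          ≤⟨ ∑-mono (λ o → ∑-mono λ z → *-monoʳ (0≤fixₘ (o , z))
                                                                     (ℤ.≤-trans (^-mono k (0≤fixₘ (o , z)) (fixₘ≤fix o z)) (fix^k o))) ⟩
        ∑ (λ o → ∑ λ z → fixₘ (o , z) * (D^ * fix o ^ n))
          ≡⟨ ∑-cong (λ o → trans (∑-*ʳ (D^ * fix o ^ n) _) (trans (cong (_* (D^ * fix o ^ n)) (∑-fixₘ o)) (sym (*-assoc D D^ _)))) ⟩
        ∑ (λ o → D * D^ * fix o ^ n) ≡⟨ ∑-* (D * D^) _ ⟩
        D * D^ * ∑ (λ o → fix o ^ n) ≤⟨ *-monoʳ (0≤-* (0≤∣V∣ {n}) 0≤D^) ∑-fix^ ⟩
        D * D^ * ((+ 2) ^ n * D ^ n)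
          ≡⟨ solve 4 (λ d e t f → d :* e :* (t :* f) := t :* (d :* (e :* f))) refl D D^ ((+ 2) ^ n) (D ^ n) ⟩
        (+ 2) ^ n * (D * (D^ * D ^ n))
          ≡⟨ cong (λ e → (+ 2) ^ n * (D * e)) (trans (sym (^-+ D (k ℕ.∸ n) n)) (cong (D ^_) (ℕ.m∸n+n≡m n≤k))) ⟩
        (+ 2) ^ n * D ^ suc k                                    ∎
        where
        open ℤ.≤-Reasoning
        D^ = D ^ (k ℕ.∸ n)
        0≤D^ : 0ℤ ≤ D^
        0≤D^ = 0≤-^ (k ℕ.∸ n) (0≤∣V∣ {n})
        fix^k : ∀ o → fix o ^ k ≤ D^ * fix o ^ n
        fix^k o = subst (_≤ D^ * fix o ^ n) (trans (sym (^-+ (fix o) (k ℕ.∸ n) n)) (cong (fix o ^_) (ℕ.m∸n+n≡m n≤k)))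
          (*-monoˡ (0≤-^ n (0≤fix o)) (^-mono (k ℕ.∸ n) (0≤fix o) (fix≤D o)))

    -- Congruence classes

    module Configurations {n : ℕ} where

      module S = Space F n
      open S using (IsOrthogonal; _∼_)

      private
        V = Vec K n
        G = Motion {n}

      toOrth : ∀ {θ : V → V} → IsOrthogonal θ → Orth θ
      toOrth o = record { θ-⊕ = +ᴹ-homo ; θ-✶ = *ₗ-homo ; θ-• = IsOrthogonal.preserves-• o }
        where
        open ModuleMorphisms.LeftModuleMorphisms S.rawLeftModule S.rawLeftModule
        open IsLeftModuleHomomorphism (IsOrthogonal.linear o)

      toIsOrthogonal : ∀ {θ : V → V} → Orth θ → IsOrthogonal θ
      toIsOrthogonal {θ} o = record
        { linear = record
          { +ᴹ-isGroupHomomorphism = record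
            { isMonoidHomomorphism = record
              { isMagmaHomomorphism = record { isRelHomomorphism = record { cong = cong θ } ; homo = θ-⊕ }
              ; ε-homo = θ-𝟎 }
            ; ⁻¹-homo = λ x → trans (cong θ (neg-✶ x)) (trans (θ-✶ (⊟ 1F) x) (sym (neg-✶ (θ x)))) }
          ; *ₗ-homo = θ-✶ }
        ; preserves-• = θ-• }
        where open Orth o

      _⊙_ : ∀ {m} → G → Vec V m → Vec V m
      g ⊙ x = Vec.map (g ▹_) x

      private
        pointwise : ∀ {m} {f : V → V} (x y : Vec V m) → (∀ i → lookup y i ≡ f (lookup x i)) → Vec.map f x ≡ y
        pointwise []      []      h = refl
        pointwise (a ∷ x) (b ∷ y) h = cong₂ _∷_ (sym (h zero)) (pointwise x y λ i → h (suc i))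

      ∼⇒motion : ∀ {k} {x y : Vec V (suc k)} → x ∼ y → ∃ λ (g : G) → g ⊙ x ≡ y
      ∼⇒motion {x = x} {y} (θ , o , z , e) = (fromOrth (toOrth o) , z)
        , pointwise x y (λ i → trans (e i) (cong (_⊕ z) (sym (⟦fromOrth⟧ (toOrth o) (lookup x i)))))

      motion⇒∼ : ∀ {k} {x y : Vec V (suc k)} (g : G) → g ⊙ x ≡ y → x ∼ y
      motion⇒∼ {x = x} (o , z) refl = ⟦ o ⟧ , toIsOrthogonal (orth o) , z , λ i → Vec.lookup-map i ((o , z) ▹_) x

      infixr 9 _∘ₘ_

      _∘ₘ_ : G → G → G
      (o , z) ∘ₘ (p , w) = o ⋆ p , ⟦ o ⟧ w ⊕ z

      ▹-∘ₘ : ∀ g h x → (g ∘ₘ h) ▹ x ≡ g ▹ (h ▹ x)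
      ▹-∘ₘ (o , z) (p , w) x = trans (cong (_⊕ (⟦ o ⟧ w ⊕ z)) (⟦⋆⟧ o p x))
        (trans (sym (⊕-assoc _ (⟦ o ⟧ w) z)) (cong (_⊕ z) (sym (Orth.θ-⊕ (orth o) (⟦ p ⟧ x) w))))

      inverseₘ : G → G
      inverseₘ (o , z) = o ⁻¹ , ⟦ o ⁻¹ ⟧ (𝟎 ⊝ z)

      private
        ⊕-𝟎⊝ : ∀ {m} (x z : Vec K m) → (x ⊕ z) ⊕ (𝟎 ⊝ z) ≡ x
        ⊕-𝟎⊝ []      []      = refl
        ⊕-𝟎⊝ (a ∷ x) (b ∷ z) = cong₂ _∷_ (solveᴷ 2 (λ a b → a :+ b :+ (con 0ℤ :- b) := a) refl a b) (⊕-𝟎⊝ x z)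

      inverseₘ-▹ : ∀ g x → inverseₘ g ▹ (g ▹ x) ≡ x
      inverseₘ-▹ (o , z) x = trans (sym (Orth.θ-⊕ (orth (o ⁻¹)) (⟦ o ⟧ x ⊕ z) (𝟎 ⊝ z)))
        (trans (cong ⟦ o ⁻¹ ⟧ (⊕-𝟎⊝ (⟦ o ⟧ x) z)) (⟦⁻¹⟧ˡ o x))

      ▹-surjective : ∀ (g : G) y → ∃ λ x → g ▹ x ≡ y
      ▹-surjective (o , z) y = ⟦ o ⁻¹ ⟧ (y ⊝ z) , trans (cong (_⊕ z) (⟦⁻¹⟧ʳ o (y ⊝ z))) (⊝-⊕ y z)

      faithful : ∀ {g h : G} → (∀ x → g ▹ x ≡ h ▹ x) → g ≡ h
      faithful {o , z} {p , w} e = cong₂ _,_ (O-ext λ x → ⊕-cancelʳ z (trans (e x) (cong (⟦ p ⟧ x ⊕_) (sym z≡w)))) z≡w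
        where
        z≡w : z ≡ w
        z≡w = trans (sym (trans (cong (_⊕ z) (Orth.θ-𝟎 (orth o))) (⊕-identityˡ z)))
          (trans (e 𝟎) (trans (cong (_⊕ w) (Orth.θ-𝟎 (orth p))) (⊕-identityˡ w)))

      ⊙-∘ₘ : ∀ {m} g h (x : Vec V m) → (g ∘ₘ h) ⊙ x ≡ g ⊙ (h ⊙ x)
      ⊙-∘ₘ g h x = trans (Vec.map-cong (▹-∘ₘ g h) x) (Vec.map-∘ (g ▹_) (h ▹_) x)

      inverseₘ-⊙ : ∀ {m} g (x : Vec V m) → inverseₘ g ⊙ (g ⊙ x) ≡ x
      inverseₘ-⊙ g x = trans (sym (Vec.map-∘ (inverseₘ g ▹_) (g ▹_) x)) (trans (Vec.map-cong (inverseₘ-▹ g) x) (Vec.map-id x))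

      identityₘ : G
      identityₘ = fromOrth Orth-id , 𝟎

      identityₘ-⊙ : ∀ {m} (x : Vec V m) → identityₘ ⊙ x ≡ x
      identityₘ-⊙ x = trans (Vec.map-cong (λ y → trans (⊕-identityʳ _) (⟦fromOrth⟧ Orth-id y)) x) (Vec.map-id x)

      ∼-isEquivalence : ∀ {k} → IsEquivalence (_∼_ {k})
      ∼-isEquivalence = record
        { refl = λ {x} → motion⇒∼ identityₘ (identityₘ-⊙ x)
        ; sym = λ {x} {y} r → let g , e = ∼⇒motion {x = x} {y} r in
            motion⇒∼ (inverseₘ g) (trans (cong (inverseₘ g ⊙_) (sym e)) (inverseₘ-⊙ g x))
        ; trans = λ {x} {y} {z} r s → let g , e = ∼⇒motion {x = x} {y} r ; h , e′ = ∼⇒motion {x = y} {z} s in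
            motion⇒∼ (h ∘ₘ g) (trans (⊙-∘ₘ h g x) (trans (cong (h ⊙_) e) e′)) }

      module _ {k : ℕ} (_≈?_ : Binary.Decidable (_∼_ {k})) where

        private
          W = Vec V (suc k)
          module R = Representatives _≈?_ ∼-isEquivalence

        stab : W → ℤ
        stab y = ∑ λ g → δ (g ⊙ y) y

        private
          -- Composition with the inverse of one motion from `x` to `y` embeds all such motions into
          -- the stabilizer of `y`.
          transport-≤ : ∀ (x y : W) → ∑ (λ g → δ (g ⊙ x) y) ≤ 𝟙 (x ≈? y) * stab y
          transport-≤ x y = ∑-𝟙-≤ (λ g → g ⊙ x ≟ y) 0≤ λ g₀ e₀ →
            subst₂ _≤_ (∑-cong λ g → trans (𝟙-* (g ⊙ x ≟ y) (λ e → 𝟙-yes ((g ∘ₘ inverseₘ g₀) ⊙ y ≟ y) (back g₀ e₀ g e))) (*-identityʳ _))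
              (sym (trans (cong (_* stab y) (𝟙-yes (x ≈? y) (motion⇒∼ g₀ e₀))) (*-identityˡ (stab y))))
              (∑-inj (λ g → g ⊙ x ≟ y) {h = _∘ₘ inverseₘ g₀} (λ g g′ _ _ e → right-cancel (inverseₘ g₀) e)
                (λ g → δ (g ⊙ y) y) (λ g → 0≤𝟙 (g ⊙ y ≟ y)))
            where
            0≤ : 0ℤ ≤ 𝟙 (x ≈? y) * stab y
            0≤ = 0≤-* (0≤𝟙 (x ≈? y)) (0≤-∑ λ g → 0≤𝟙 (g ⊙ y ≟ y))
            back : ∀ g₀ → g₀ ⊙ x ≡ y → ∀ g → g ⊙ x ≡ y → (g ∘ₘ inverseₘ g₀) ⊙ y ≡ y
            back g₀ e₀ g e = trans (⊙-∘ₘ g (inverseₘ g₀) y)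
              (trans (cong (g ⊙_) (trans (cong (inverseₘ g₀ ⊙_) (sym e₀)) (inverseₘ-⊙ g₀ x))) e)
            right-cancel : ∀ {g g′ : G} (s : G) → g ∘ₘ s ≡ g′ ∘ₘ s → g ≡ g′
            right-cancel {g} {g′} s e = faithful λ y → let x , sx≡y = ▹-surjective s y in
              subst (λ y → g ▹ y ≡ g′ ▹ y) sx≡y (trans (sym (▹-∘ₘ g s x)) (trans (cong (_▹ x) e) (▹-∘ₘ g′ s x)))

          δ-⊙ : ∀ {m} (g : G) (y : Vec V m) → δ (g ⊙ y) y ≡ ∏ (λ u → δ (g ▹ u) u) y
          δ-⊙ g []      = refl
          δ-⊙ g (u ∷ y) = trans (𝟙-cong (g ⊙ (u ∷ y) ≟ u ∷ y) (g ▹ u ≟ u ×-dec g ⊙ y ≟ y)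
              (λ e → cong Vec.head e , cong Vec.tail e) (λ (p , e) → cong₂ _∷_ p e))
            (trans (𝟙-× (g ▹ u ≟ u) (g ⊙ y ≟ y)) (cong (δ (g ▹ u) u *_) (δ-⊙ g y)))

        ∑-stab : ∑ stab ≡ ∑ λ g → fixₘ g ^ suc k
        ∑-stab = trans (∑-swap λ y g → δ (g ⊙ y) y) (∑-cong λ g → trans (∑-cong (δ-⊙ g)) (∑-∏ (suc k) λ u → δ (g ▹ u) u))

        -- Burnside's bound for the number of orbits.
        orbits-≤ : ∀ xs → + length (R.reps xs) * ∣ O n × V ∣ ≤ ∑ λ g → fixₘ g ^ suc k
        orbits-≤ xs = begin
          + length (R.reps xs) * ∣ O n × V ∣
            ≡⟨ trans (cong (_* ∣ O n × V ∣) (sym (sum-1 (R.reps xs)))) (sym (sum-*ʳ (R.reps xs) ∣ O n × V ∣ _)) ⟩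
          sum (R.reps xs) (λ r → 1ℤ * ∣ O n × V ∣)
            ≡⟨ sum-cong (R.reps xs) (λ r → trans (*-identityˡ _) (trans (∑-cong λ g → sym (∑-δ-1 (g ⊙ r))) (∑-swap λ g y → δ (g ⊙ r) y))) ⟩
          sum (R.reps xs) (λ r → ∑ λ y → ∑ λ g → δ (g ⊙ r) y)
            ≤⟨ sum-mono (R.reps xs) (λ r → ∑-mono λ y → transport-≤ r y) ⟩
          sum (R.reps xs) (λ r → ∑ λ y → 𝟙 (r ≈? y) * stab y)
            ≡⟨ trans (sum-cong (R.reps xs) λ r → ∑-def _) (trans (sum-swap (R.reps xs) (Finite.list (Finite-Vec {V} {{Finite-Vec}} {suc k})) λ r y → 𝟙 (r ≈? y) * stab y) (sym (∑-def _))) ⟩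
          ∑ (λ y → sum (R.reps xs) λ r → 𝟙 (r ≈? y) * stab y)
            ≡⟨ ∑-cong (λ y → sum-*ʳ (R.reps xs) (stab y) _) ⟩
          ∑ (λ y → sum (R.reps xs) (λ r → 𝟙 (r ≈? y)) * stab y)
            ≤⟨ ∑-mono (λ y → *-monoˡ (0≤-∑ λ g → 0≤𝟙 (g ⊙ y ≟ y)) (R.reps-≤1 xs y)) ⟩
          ∑ (λ y → 1ℤ * stab y) ≡⟨ ∑-cong (λ y → *-identityˡ (stab y)) ⟩
          ∑ stab ≡⟨ ∑-stab ⟩
          ∑ (λ g → fixₘ g ^ suc k)                                 ∎
          where open ℤ.≤-Reasoning

      module _ {E : Pred V 0ℓ} (E? : Decidable E) where

        e : ℤ
        e = ∑ λ u → 𝟙 (E? u)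

        e≡ : + S.∣ E? ∣ ≡ e
        e≡ = trans (length-filter E? S.points) (sym (∑-def _))

        incidences : G → ℤ
        incidences g = ∑ λ u → 𝟙 (E? u) * 𝟙 (E? (g ▹ u))

        private
          w : ∀ {m} → Vec V m → ℤ
          w x = 𝟙 (All.all? E? x)

          w-∷ : ∀ {m} u (x : Vec V m) → w (u ∷ x) ≡ 𝟙 (E? u) * w x
          w-∷ u x = trans (𝟙-cong (All.all? E? (u ∷ x)) (E? u ×-dec All.all? E? x) (λ { (p ∷ ps) → p , ps }) (λ (p , ps) → p ∷ ps))
            (𝟙-× (E? u) (All.all? E? x))

          w-∏ : ∀ {m} (x : Vec V m) → w x ≡ ∏ (λ u → 𝟙 (E? u)) x
          w-∏ []      = refl
          w-∏ (u ∷ x) = trans (w-∷ u x) (cong (𝟙 (E? u) *_) (w-∏ x))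

          w-pair : ∀ {m} g (x : Vec V m) → w x * w (g ⊙ x) ≡ ∏ (λ u → 𝟙 (E? u) * 𝟙 (E? (g ▹ u))) x
          w-pair g []      = *-identityˡ 1ℤ
          w-pair g (u ∷ x) = trans (cong₂ _*_ (w-∷ u x) (w-∷ (g ▹ u) (g ⊙ x)))
            (trans (solve 4 (λ a b c d → a :* b :* (c :* d) := a :* c :* (b :* d)) refl (𝟙 (E? u)) (w x) (𝟙 (E? (g ▹ u))) (w (g ⊙ x)))
              (cong (𝟙 (E? u) * 𝟙 (E? (g ▹ u)) *_) (w-pair g x)))

        -- Cauchy–Schwarz: few classes force many congruent pairs.
        classes-≥ : ∀ k (_≈?_ : Binary.Decidable (_∼_ {k})) →
          e ^ suc k * e ^ suc k ≤ + length (deduplicate _≈?_ (S.configurations k E?)) * ∑ λ g → incidences g ^ suc k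
        classes-≥ k _≈?_ = begin
          e ^ suc k * e ^ suc k ≡⟨ cong₂ _*_ total total ⟩
          ∑ w * ∑ w
            ≤⟨ *-mono (0≤-∑ 0≤w) (0≤-sum rs λ r → 0≤-∑ λ x → 0≤-* (0≤w x) (0≤𝟙 (r ≈? x))) covered covered ⟩
          sum rs c * sum rs c ≤⟨ cauchy-schwarz rs c ⟩
          + length rs * sum rs (λ r → c r * c r) ≤⟨ *-monoʳ {c = + length rs} 0≤+ pairs ⟩
          + length rs * ∑ (λ g → incidences g ^ suc k)             ∎
          where
          open ℤ.≤-Reasoning
          W = Vec V (suc k)
          module R = Representatives _≈?_ ∼-isEquivalence
          0≤w : (x : W) → 0ℤ ≤ w x
          0≤w x = 0≤𝟙 (All.all? E? x)
          rs = R.reps (S.configurations k E?)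
          c : W → ℤ
          c r = ∑ λ x → w x * 𝟙 (r ≈? x)
          total : e ^ suc k ≡ ∑ {W} w
          total = sym (trans (∑-cong w-∏) (∑-∏ (suc k) λ u → 𝟙 (E? u)))
          exchange : (φ : W → W → ℤ) → sum rs (λ r → ∑ (φ r)) ≡ ∑ λ x → sum rs λ r → φ r x
          exchange φ = trans (sum-cong rs λ r → ∑-def (φ r)) (trans (sum-swap rs (Finite.list (Finite-Vec {V} {{Finite-Vec}} {suc k})) φ) (sym (∑-def _)))
          covered : ∑ w ≤ sum rs c
          covered = begin
            ∑ w ≡⟨ ∑-cong (λ x → sym (*-identityʳ (w x))) ⟩
            ∑ (λ x → w x * 1ℤ) ≤⟨ ∑-mono (λ x → 𝟙-*-≤ (All.all? E? x) λ p →
                                                                R.reps-≥1 (S.configurations k E?) x (∈-filter⁺ (All.all? E?) (∈-vectors S.∈-points x) p)) ⟩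
            ∑ (λ x → w x * sum rs λ r → 𝟙 (r ≈? x))
              ≡⟨ ∑-cong (λ x → sym (sum-* rs (w x) λ r → 𝟙 (r ≈? x))) ⟩
            ∑ (λ x → sum rs λ r → w x * 𝟙 (r ≈? x)) ≡⟨ sym (exchange λ r x → w x * 𝟙 (r ≈? x)) ⟩
            sum rs c                                       ∎
          merge : ∀ r x y → w x * 𝟙 (r ≈? x) * (w y * 𝟙 (r ≈? y)) ≤ w x * w y * 𝟙 (x ≈? y) * 𝟙 (r ≈? x)
          merge r x y = subst₂ _≤_
            (trans (cong (w x * w y *_) (𝟙-× (r ≈? x) (r ≈? y))) (solve 4 (λ a b s t → a :* b :* (s :* t) := a :* s :* (b :* t)) refl (w x) (w y) (𝟙 (r ≈? x)) (𝟙 (r ≈? y))))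
            (trans (cong (w x * w y *_) (𝟙-× (x ≈? y) (r ≈? x))) (sym (*-assoc (w x * w y) (𝟙 (x ≈? y)) (𝟙 (r ≈? x)))))
            (*-monoʳ (0≤-* (0≤w x) (0≤w y)) (𝟙-mono (r ≈? x ×-dec r ≈? y) (x ≈? y ×-dec r ≈? x)
              λ (r∼x , r∼y) → IsEquivalence.trans ∼-isEquivalence {x} {r} {y} (IsEquivalence.sym ∼-isEquivalence {r} {x} r∼x) r∼y , r∼x))
          -- Counting a congruent pair once for each motion that joins its members can only increase
          -- the count.
          some-motion : ∀ (x y : W) → 𝟙 (x ≈? y) ≤ ∑ λ g → δ (g ⊙ x) y
          some-motion x y = go (x ≈? y)
            where
            go : (d : Dec (x ∼ y)) → 𝟙 d ≤ ∑ λ g → δ (g ⊙ x) y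
            go (no _)  = 0≤-∑ λ g → 0≤𝟙 (g ⊙ x ≟ y)
            go (yes p) = let g , eq = ∼⇒motion {x = x} {y} p in
              subst (_≤ ∑ λ g → δ (g ⊙ x) y) (𝟙-yes (g ⊙ x ≟ y) eq) (∑-single g λ g → 0≤𝟙 (g ⊙ x ≟ y))
          pairs : sum rs (λ r → c r * c r) ≤ ∑ λ g → incidences g ^ suc k
          pairs = begin
            sum rs (λ r → c r * c r)
              ≡⟨ sum-cong rs (λ r → ∑-*-∑ (λ x → w x * 𝟙 (r ≈? x)) (λ x → w x * 𝟙 (r ≈? x))) ⟩
            sum rs (λ r → ∑ λ x → ∑ λ y → w x * 𝟙 (r ≈? x) * (w y * 𝟙 (r ≈? y)))
              ≤⟨ sum-mono rs (λ r → ∑-mono λ x → ∑-mono λ y → merge r x y) ⟩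
            sum rs (λ r → ∑ λ x → ∑ λ y → w x * w y * 𝟙 (x ≈? y) * 𝟙 (r ≈? x))
              ≡⟨ sum-cong rs (λ r → ∑-cong λ x → ∑-*ʳ (𝟙 (r ≈? x)) λ y → w x * w y * 𝟙 (x ≈? y)) ⟩
            sum rs (λ r → ∑ λ x → ∑ (λ y → w x * w y * 𝟙 (x ≈? y)) * 𝟙 (r ≈? x))
              ≡⟨ trans (exchange λ r x → ∑ (λ y → w x * w y * 𝟙 (x ≈? y)) * 𝟙 (r ≈? x)) (∑-cong λ x → sum-* rs _ λ r → 𝟙 (r ≈? x)) ⟩
            ∑ (λ x → ∑ (λ y → w x * w y * 𝟙 (x ≈? y)) * sum rs λ r → 𝟙 (r ≈? x))
              ≤⟨ ∑-mono (λ x → *-monoʳ (0≤-∑ λ y → 0≤-* (0≤-* (0≤w x) (0≤w y)) (0≤𝟙 (x ≈? y))) (R.reps-≤1 (S.configurations k E?) x)) ⟩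
            ∑ (λ x → ∑ (λ y → w x * w y * 𝟙 (x ≈? y)) * 1ℤ)
              ≡⟨ ∑-cong (λ x → *-identityʳ _) ⟩
            ∑ (λ x → ∑ λ y → w x * w y * 𝟙 (x ≈? y))
              ≤⟨ ∑-mono (λ x → ∑-mono λ y → *-monoʳ (0≤-* (0≤w x) (0≤w y)) (some-motion x y)) ⟩
            ∑ (λ x → ∑ λ y → w x * w y * ∑ λ g → δ (g ⊙ x) y)
              ≡⟨ ∑-cong (λ x → trans (∑-cong λ y → sym (∑-* (w x * w y) λ g → δ (g ⊙ x) y)) (∑-swap λ y g → w x * w y * δ (g ⊙ x) y)) ⟩
            ∑ (λ x → ∑ λ g → ∑ λ y → w x * w y * δ (g ⊙ x) y)
              ≡⟨ ∑-cong (λ x → ∑-cong λ g → trans (∑-cong λ y → *-comm (w x * w y) _) (∑-δ′ (g ⊙ x) λ y → w x * w y)) ⟩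
            ∑ (λ x → ∑ λ g → w x * w (g ⊙ x))
              ≡⟨ ∑-swap (λ x g → w x * w (g ⊙ x)) ⟩
            ∑ (λ g → ∑ λ (x : W) → w x * w (g ⊙ x))
              ≡⟨ ∑-cong (λ g → trans (∑-cong (w-pair g)) (∑-∏ (suc k) λ u → 𝟙 (E? u) * 𝟙 (E? (g ▹ u)))) ⟩
            ∑ (λ g → incidences g ^ suc k) ∎

    -- Moments of the incidences and the bound for one set

    module Bounds (two≢0 : 2F ≢ 0F) {n : ℕ} (1≤n : 1 ℕ.≤ n) {E : Pred (Vec K n) 0ℓ} (E? : Decidable E) where

      open Configurations {n} hiding (e)

      private
        V = Vec K n
        D = ∣ V ∣
        N = ∣ O n ∣
        e = Configurations.e E?
        λ′ = incidences E?

        1E : V → ℤ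
        1E u = 𝟙 (E? u)

        0≤e : 0ℤ ≤ e
        0≤e = 0≤-∑ λ u → 0≤𝟙 (E? u)

        f : V → ℤ
        f u = D * 1E u + (- e)

        ∑f : ∑ f ≡ 0ℤ
        ∑f = trans (∑-+ (λ u → D * 1E u) _) (trans (cong₂ _+_ (∑-* D 1E) (∑-const (- e)))
          (solve 2 (λ d e → d :* e :+ :- e :* d := con 0ℤ) refl D e))

        ‖f‖²≤ : ‖f‖² two≢0 f ∑f ≤ D * (D * e)
        ‖f‖²≤ = ≤-by (D * (e * e)) (sym (trans (cong (_+ D * (e * e)) value)
            (solve 2 (λ d e → d :* d :* e :+ :- (con (+ 2) :* d :* e) :* e :+ e :* e :* d :+ d :* (e :* e) := d :* (d :* e)) refl D e)))
          (0≤-* (0≤∣V∣ {n}) (0≤² e))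
          where
          idem : ∀ u → 1E u * 1E u ≡ 1E u
          idem u = trans (𝟙-* (E? u) (𝟙-yes (E? u))) (*-identityʳ _)
          value : ‖f‖² two≢0 f ∑f ≡ D * D * e + (- (+ 2 * D * e)) * e + e * e * D
          value = trans (∑-cong λ u → trans (solve 3 (λ d e x → (d :* x :+ :- e) :* (d :* x :+ :- e) := d :* d :* (x :* x) :+ :- (con (+ 2) :* d :* e) :* x :+ e :* e) refl D e (1E u))
              (cong (λ t → D * D * t + (- (+ 2 * D * e)) * 1E u + e * e) (idem u)))
            (trans (∑-+ (λ u → D * D * 1E u + (- (+ 2 * D * e)) * 1E u) _) (cong₂ _+_
              (trans (∑-+ (λ u → D * D * 1E u) _) (cong₂ _+_ (∑-* (D * D) 1E) (∑-* (- (+ 2 * D * e)) 1E))) (∑-const (e * e))))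

        ∑-image : ∀ g → ∑ (λ u → 1E (g ▹ u)) ≡ e
        ∑-image g = ∑-bij (g ▹_) (inverseₘ g ▹_) (inverseₘ-▹ g)
          (λ y → let x , gx≡y = ▹-surjective g y in
            trans (cong (λ y → g ▹ (inverseₘ g ▹ y)) (sym gx≡y)) (trans (cong (g ▹_) (inverseₘ-▹ g x)) gx≡y)) 1E

        -- `D` times the deviation of `λ′ g` from its mean `e * e / D`.
        deviation : Motion → ℤ
        deviation g = D * λ′ g - e * e

        correlation≡ : ∀ o z → correlation two≢0 f ∑f o z ≡ D * deviation (o , z)
        correlation≡ o z = begin
          ∑ (λ u → f u * f (g ▹ u))
            ≡⟨ ∑-cong (λ u → solve 4 (λ d e x y → (d :* x :+ :- e) :* (d :* y :+ :- e) := d :* d :* (x :* y) :+ :- (d :* e) :* x :+ :- (d :* e) :* y :+ e :* e) refl D e (1E u) (1E (g ▹ u))) ⟩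
          ∑ (λ u → D * D * (1E u * 1E (g ▹ u)) + (- (D * e)) * 1E u + (- (D * e)) * 1E (g ▹ u) + e * e)
            ≡⟨ trans (∑-+ (λ u → D * D * (1E u * 1E (g ▹ u)) + (- (D * e)) * 1E u + (- (D * e)) * 1E (g ▹ u)) _) (cong₂ _+_
                 (trans (∑-+ (λ u → D * D * (1E u * 1E (g ▹ u)) + (- (D * e)) * 1E u) _) (cong₂ _+_
                   (trans (∑-+ (λ u → D * D * (1E u * 1E (g ▹ u))) _) (cong₂ _+_ (∑-* (D * D) _) (∑-* (- (D * e)) 1E)))
                   (trans (∑-* (- (D * e)) _) (cong ((- (D * e)) *_) (∑-image g))))) (∑-const (e * e))) ⟩
          D * D * λ′ g + (- (D * e)) * e + (- (D * e)) * e + e * e * D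
            ≡⟨ solve 3 (λ d e l → d :* d :* l :+ :- (d :* e) :* e :+ :- (d :* e) :* e :+ e :* e :* d := d :* (d :* l :- e :* e)) refl D e (λ′ g) ⟩
          D * deviation g ∎
          where
          open ≡-Reasoning
          g = o , z

        B = (+ 4) ^ n * + q

        ∑-deviation² : ∑ (λ g → deviation g * deviation g) ≤ + 5 * B * N * (D * e * (D * e))
        ∑-deviation² = *-cancel (0<-* (0<∣V∣ {n}) (0<∣V∣ {n})) (begin
          D * D * ∑ (λ g → deviation g * deviation g)
            ≡⟨ trans (sym (∑-* (D * D) _)) (trans (∑-× {O n} {V} _) (∑-cong λ o → ∑-cong λ z → trans
                 (solve 2 (λ d h → d :* d :* (h :* h) := d :* h :* (d :* h)) refl D (deviation (o , z)))
                 (sym (cong₂ _*_ (correlation≡ o z) (correlation≡ o z))))) ⟩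
          ∑ (λ o → ∑ λ z → correlation two≢0 f ∑f o z * correlation two≢0 f ∑f o z)
            ≤⟨ variance two≢0 f ∑f 1≤n ⟩
          + 5 * B * N * (‖f‖² two≢0 f ∑f * ‖f‖² two≢0 f ∑f)
            ≤⟨ *-monoʳ (0≤-* (0≤-* {+ 5} 0≤+ (0≤-* (0≤-^ {+ 4} n 0≤+) 0≤+)) 0≤∣O∣)
                 (*-mono (0≤-∑ λ x → 0≤² (f x)) (0≤-* (0≤∣V∣ {n}) (0≤-* (0≤∣V∣ {n}) 0≤e)) ‖f‖²≤ ‖f‖²≤) ⟩
          + 5 * B * N * (D * (D * e) * (D * (D * e)))
            ≡⟨ solve 3 (λ b d e → b :* (d :* (d :* e) :* (d :* (d :* e))) := d :* d :* (b :* (d :* e :* (d :* e)))) refl (+ 5 * B * N) D e ⟩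
          D * D * (+ 5 * B * N * (D * e * (D * e))) ∎)
          where open ℤ.≤-Reasoning

        0≤λ : ∀ g → 0ℤ ≤ λ′ g
        0≤λ g = 0≤-∑ λ u → 0≤-* (0≤𝟙 (E? u)) (0≤𝟙 (E? (g ▹ u)))

        λ≤e : ∀ g → λ′ g ≤ e
        λ≤e g = ∑-mono λ u → subst (1E u * 1E (g ▹ u) ≤_) (*-identityʳ (1E u)) (*-monoʳ (0≤𝟙 (E? u)) (𝟙≤1 (E? (g ▹ u))))

        ∣G∣ : ∣ O n × V ∣ ≡ N * D
        ∣G∣ = trans (∑-× {O n} {V} _) (trans (∑-const D) (*-comm D N))

      -- `large` is the lower bound for the size of `E` with `1 / β` in place of `c`, raised to the
      -- power `suc k` to clear the denominator of the exponent. Writing `k` as `suc j` provides the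
      -- exponent `suc (suc j)` that `power-bound` requires.
      module _ {j : ℕ} (β : ℕ) (n≤k : n ℕ.≤ suc j)
               (large : q ℕ.* (q ℕ.^ n) ℕ.^ suc j ℕ.≤ (β ℕ.* S.∣ E? ∣) ℕ.^ suc (suc j)) where

        private
          k = suc j
          X = e ^ suc k

          large′ : + q * D ^ k ≤ (+ β) ^ suc k * X
          large′ = subst₂ _≤_
            (trans (pos-* q _) (cong (+ q *_) (trans (pos-^ (q ℕ.^ n) k) (cong (_^ k) (trans (pos-^ q n) (sym (∣V∣ n)))))))
            (trans (pos-^ (β ℕ.* S.∣ E? ∣) (suc k)) (trans (cong (_^ suc k) (trans (pos-* β _) (cong (+ β *_) (e≡ E?)))) (^-distrib-* (+ β) e (suc k))))
            (+≤+ large)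

          0<X : 0ℤ < X
          0<X = ℤ.≰⇒> λ X≤0 → ℤ.<⇒≱ (0<-* 0<q (0<-^ k (0<∣V∣ {n})))
            (ℤ.≤-trans large′ (subst ((+ β) ^ suc k * X ≤_) (zeroʳ ((+ β) ^ suc k)) (*-monoʳ (0≤-^ {+ β} (suc k) 0≤+) X≤0)))

          0≤X = ℤ.<⇒≤ 0<X

          -- The first summand stems from the motions with at most twice the mean, the second from
          -- the others; 20 is the 4 of `power-bound` times the 5 of `variance`.
          constant = (+ 2) ^ suc k + + 20 * (+ 4) ^ n * (+ β) ^ suc k

          moments : ∑ (λ g → (D * λ′ g) ^ suc k) ≤ N * D * (X * X) * constant
          moments = begin
            ∑ (λ g → (D * λ′ g) ^ suc k)
              ≤⟨ ∑-mono (λ g → power-bound j (0≤-* (0≤∣V∣ {n}) (0≤λ g)) (*-monoʳ (0≤∣V∣ {n}) (λ≤e g)) (0≤² e)) ⟩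
            ∑ (λ g → (+ 2 * (e * e)) ^ suc k + + 4 * M ^ j * (deviation g * deviation g))
              ≡⟨ trans (∑-+ (λ g → (+ 2 * (e * e)) ^ suc k) _) (cong₂ _+_ (trans (∑-const _) (cong ((+ 2 * (e * e)) ^ suc k *_) ∣G∣)) (∑-* (+ 4 * M ^ j) _)) ⟩
            (+ 2 * (e * e)) ^ suc k * (N * D) + + 4 * M ^ j * ∑ (λ g → deviation g * deviation g)
              ≤⟨ +-mono-≤ (≤-refl {(+ 2 * (e * e)) ^ suc k * (N * D)}) (*-monoʳ (0≤-* {+ 4} 0≤+ (0≤-^ j (0≤-* (0≤∣V∣ {n}) 0≤e))) ∑-deviation²) ⟩
            (+ 2 * (e * e)) ^ suc k * (N * D) + + 4 * M ^ j * (+ 5 * B * N * (M * M))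
              ≡⟨ cong₂ _+_ (cong (_* (N * D)) (trans (^-distrib-* (+ 2) (e * e) (suc k)) (cong ((+ 2) ^ suc k *_) (^-distrib-* e e (suc k)))))
                   (trans (solve 5 (λ m p q′ r s → con (+ 4) :* m :* (con (+ 5) :* (p :* q′) :* r :* (s :* s)) := con (+ 20) :* p :* r :* (q′ :* (s :* (s :* m)))) refl (M ^ j) ((+ 4) ^ n) (+ q) N M)
                     (cong (λ t → + 20 * (+ 4) ^ n * N * (+ q * t)) (^-distrib-* D e (suc k)))) ⟩
            (+ 2) ^ suc k * (X * X) * (N * D) + + 20 * (+ 4) ^ n * N * (+ q * (D * D ^ k * X))
              ≡⟨ cong (_+_ ((+ 2) ^ suc k * (X * X) * (N * D))) (solve 5 (λ a q′ d dk x → a :* (q′ :* (d :* dk :* x)) := a :* d :* x :* (q′ :* dk)) refl (+ 20 * (+ 4) ^ n * N) (+ q) D (D ^ k) X) ⟩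
            (+ 2) ^ suc k * (X * X) * (N * D) + + 20 * (+ 4) ^ n * N * D * X * (+ q * D ^ k)
              -- Here the size of `E` enters: `q * D ^ k` is traded for a second factor `X`, which
              -- brings the variance term to the shape of the mean term.
              ≤⟨ +-mono-≤ (≤-refl {(+ 2) ^ suc k * (X * X) * (N * D)}) (*-monoʳ (0≤-* (0≤-* (0≤-* (0≤-* {+ 20} 0≤+ (0≤-^ {+ 4} n 0≤+)) 0≤∣O∣) (0≤∣V∣ {n})) 0≤X) large′) ⟩
            (+ 2) ^ suc k * (X * X) * (N * D) + + 20 * (+ 4) ^ n * N * D * X * ((+ β) ^ suc k * X)
              ≡⟨ solve 6 (λ t x n d f b → t :* (x :* x) :* (n :* d) :+ con (+ 20) :* f :* n :* d :* x :* (b :* x) := n :* d :* (x :* x) :* (t :+ con (+ 20) :* f :* b)) refl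
                   ((+ 2) ^ suc k) X N D ((+ 4) ^ n) ((+ β) ^ suc k) ⟩
            N * D * (X * X) * constant ∎
            where
            open ℤ.≤-Reasoning
            M = D * e

          -- Multiplying `classes-≥` by `D ^ suc k` turns each `λ′ g` into the `D * λ′ g` of
          -- `moments`. Both sides then contain the square of `X`, which cancels, and with it the
          -- size of `E`.
          many-classes : D ^ suc k ≤ + S.∣Δ k ∣ E? * (N * D) * constant
          many-classes = *-cancel (0<-* 0<X 0<X) (begin
            X * X * D ^ suc k ≤⟨ *-monoˡ (0≤-^ (suc k) (0≤∣V∣ {n})) (classes-≥ E? k S._∼?_) ⟩
            + S.∣Δ k ∣ E? * ∑ (λ g → λ′ g ^ suc k) * D ^ suc k
              ≡⟨ solve 3 (λ a b c → a :* b :* c := a :* (c :* b)) refl (+ S.∣Δ k ∣ E?) (∑ (λ g → λ′ g ^ suc k)) (D ^ suc k) ⟩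
            + S.∣Δ k ∣ E? * (D ^ suc k * ∑ (λ g → λ′ g ^ suc k))
              ≡⟨ cong (+ S.∣Δ k ∣ E? *_) (trans (sym (∑-* (D ^ suc k) _)) (∑-cong λ g → sym (^-distrib-* D (λ′ g) (suc k)))) ⟩
            + S.∣Δ k ∣ E? * ∑ (λ g → (D * λ′ g) ^ suc k) ≤⟨ *-monoʳ {c = + S.∣Δ k ∣ E?} 0≤+ moments ⟩
            + S.∣Δ k ∣ E? * (N * D * (X * X) * constant)
              ≡⟨ solve 4 (λ a g x c → a :* (g :* (x :* x) :* c) := x :* x :* (a :* g :* c)) refl (+ S.∣Δ k ∣ E?) (N * D) X constant ⟩
            X * X * (+ S.∣Δ k ∣ E? * (N * D) * constant)                   ∎)
            where open ℤ.≤-Reasoning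

        classes-bound : + S.∣Δ k ∣ U? ≤ (+ 2) ^ n * constant * + S.∣Δ k ∣ E?
        classes-bound = *-cancel (0<-* 0<∣O∣ (0<∣V∣ {n})) (begin
          N * D * + S.∣Δ k ∣ U? ≡⟨ trans (*-comm (N * D) _) (cong (+ S.∣Δ k ∣ U? *_) (sym ∣G∣)) ⟩
          + S.∣Δ k ∣ U? * ∣ O n × V ∣ ≤⟨ orbits-≤ S._∼?_ (S.configurations k U?) ⟩
          ∑ (λ g → fixₘ g ^ suc k) ≤⟨ ∑-fixₘ^ n≤k ⟩
          (+ 2) ^ n * D ^ suc k ≤⟨ *-monoʳ (0≤-^ {+ 2} n 0≤+) many-classes ⟩
          (+ 2) ^ n * (+ S.∣Δ k ∣ E? * (N * D) * constant)
            ≡⟨ solve 4 (λ t a g c → t :* (a :* g :* c) := g :* (t :* c :* a)) refl ((+ 2) ^ n) (+ S.∣Δ k ∣ E?) (N * D) constant ⟩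
          N * D * ((+ 2) ^ n * constant * + S.∣Δ k ∣ E?)       ∎)
          where open ℤ.≤-Reasoning

open import Data.Integer.GCD using (gcd)
import Data.Integer.Properties as ℤ
import Data.Nat.Properties as ℕ
open import Data.Rational using (ℚ; 0ℚ; ½; _/_; _*_; _-_; _≤_; _<_)
open import Data.Rational as ℚ using (mkℚ; 1ℚ; *<*; ↥_; ↧_; ↧ₙ_; toℚᵘ; nonNegative)
import Data.Rational.Properties as ℚ
open import Data.Rational.Unnormalised as ℚᵘ using (mkℚᵘ; *≡*)
import Data.Rational.Unnormalised.Properties as ℚᵘ
open Counting
  using (module Field; odd; pos-+; pos-*; pos-^; +-homo; *-homo; -‿homo;
         solve; con; _:+_; _:*_; :-_; _:=_)
  renaming (_+_ to _+ᶻ_; _*_ to _*ᶻ_)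

-- Rational constants and exponents

ι : ℕ → ℚ
ι n = + n / 1

toℚᵘ-ι : ∀ n → toℚᵘ (ι n) ℚᵘ.≃ mkℚᵘ (+ n) 0
toℚᵘ-ι n = ℚ.toℚᵘ-fromℚᵘ (mkℚᵘ (+ n) 0)

ι-* : ∀ m n → ι (m ℕ.* n) ≡ ι m * ι n
ι-* m n = ℚ.toℚᵘ-injective (begin
  toℚᵘ (ι (m ℕ.* n))                      ≈⟨ toℚᵘ-ι (m ℕ.* n) ⟩
  mkℚᵘ (+ (m ℕ.* n)) 0                    ≈⟨ *≡* (cong (ℤ._* + 1) (ℤ.pos-* m n)) ⟩
  mkℚᵘ (+ m) 0 ℚᵘ.* mkℚᵘ (+ n) 0          ≈⟨ ℚᵘ.*-cong (toℚᵘ-ι m) (toℚᵘ-ι n) ⟨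
  toℚᵘ (ι m) ℚᵘ.* toℚᵘ (ι n)              ≈⟨ ℚ.toℚᵘ-homo-* (ι m) (ι n) ⟨
  toℚᵘ (ι m * ι n)                        ∎)
  where open import Relation.Binary.Reasoning.Setoid ℚᵘ.≃-setoid

ι-^ : ∀ m n → ι (m ℕ.^ n) ≡ ι m ^ℚ n
ι-^ m zero    = refl
ι-^ m (suc n) = trans (ι-* m (m ℕ.^ n)) (cong (ι m *_) (ι-^ m n))

ι-mono : ∀ {m n} → m ℕ.≤ n → ι m ≤ ι n
ι-mono {m} {n} m≤n = ℚ.toℚᵘ-cancel-≤ (ℚᵘ.≤-respˡ-≃ (ℚᵘ.≃-sym (toℚᵘ-ι m)) (ℚᵘ.≤-respʳ-≃ (ℚᵘ.≃-sym (toℚᵘ-ι n))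
  (ℚᵘ.*≤* (ℤ.*-monoʳ-≤-nonNeg (+ 1) (+≤+ m≤n)))))

ι-cancel : ∀ {m n} → ι m ≤ ι n → m ℕ.≤ n
ι-cancel {m} {n} h with ℚᵘ.≤-respˡ-≃ (toℚᵘ-ι m) (ℚᵘ.≤-respʳ-≃ (toℚᵘ-ι n) (ℚ.toℚᵘ-mono-≤ h))
... | ℚᵘ.*≤* p = ℤ.drop‿+≤+ (ℤ.*-cancelʳ-≤-pos (+ m) (+ n) (+ 1) p)

0≤ι : ∀ n → 0ℚ ≤ ι n
0≤ι n = ι-mono {0} {n} z≤n

*-monoʳ-≤ : ∀ {r x y} → 0ℚ ≤ r → x ≤ y → r * x ≤ r * y
*-monoʳ-≤ {r} p q = ℚ.*-monoˡ-≤-nonNeg r {{nonNegative p}} q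

^ℚ-distrib-* : ∀ x y n → (x * y) ^ℚ n ≡ x ^ℚ n * y ^ℚ n
^ℚ-distrib-* x y zero    = refl
^ℚ-distrib-* x y (suc n) = begin
  x * y * (x * y) ^ℚ n         ≡⟨ cong (x * y *_) (^ℚ-distrib-* x y n) ⟩
  x * y * (x ^ℚ n * y ^ℚ n)    ≡⟨ ℚ.*-assoc x y _ ⟩
  x * (y * (x ^ℚ n * y ^ℚ n))  ≡⟨ cong (x *_) (trans (sym (ℚ.*-assoc y (x ^ℚ n) (y ^ℚ n))) (trans (cong (_* y ^ℚ n) (ℚ.*-comm y (x ^ℚ n))) (ℚ.*-assoc (x ^ℚ n) y (y ^ℚ n)))) ⟩
  x * (x ^ℚ n * (y * y ^ℚ n))  ≡⟨ sym (ℚ.*-assoc x (x ^ℚ n) _) ⟩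
  x ^ℚ suc n * y ^ℚ suc n      ∎
  where open ≡-Reasoning

1≤^ℚ : ∀ {x} n → 1ℚ ≤ x → 1ℚ ≤ x ^ℚ n
1≤^ℚ zero    p = ℚ.≤-refl
1≤^ℚ {x} (suc n) p = ℚ.≤-trans p (subst (_≤ x * x ^ℚ n) (ℚ.*-identityʳ x)
  (*-monoʳ-≤ (ℚ.≤-trans (ι-mono {0} {1} z≤n) p) (1≤^ℚ n p)))

-- The product is the numerator of `c`, a positive integer. This permits replacing `c` by the
-- reciprocal of its denominator.
1≤c*↧ : ∀ c → 0ℚ < c → 1ℚ ≤ c * ι (↧ₙ c)
1≤c*↧ c@(mkℚ (+ zero)   b _) (*<* (+<+ ()))
1≤c*↧ c@(mkℚ (+ suc a)  b _) _ = ℚ.toℚᵘ-cancel-≤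
  (ℚᵘ.≤-respʳ-≃ (ℚᵘ.≃-sym (ℚᵘ.≃-trans (ℚ.toℚᵘ-homo-* c (ι (suc b))) (ℚᵘ.*-congˡ (toℚᵘ-ι (suc b)))))
    (ℚᵘ.*≤* (subst₂ ℤ._≤_ refl refl (ℤ.≤-trans (ℤ.≤-reflexive (cong +_ (trans (ℕ.*-identityˡ _) (ℕ.*-identityʳ (suc b)))))
      (+≤+ (subst (suc b ℕ.≤_) (sym (ℕ.*-identityʳ _)) (ℕ.m≤n*m (suc b) (suc a))))))))
1≤c*↧ c@(mkℚ -[1+ a ]   b _) (*<* ())

0<½^ : ∀ n → 0ℚ < ½ ^ℚ n
0<½^ zero    = *<* (+<+ (s≤s z≤n))
0<½^ (suc n) = subst (_< ½ * ½ ^ℚ n) (ℚ.*-zeroʳ ½) (ℚ.*-monoʳ-<-pos ½ (0<½^ n))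

½^*2^ : ∀ n → ½ ^ℚ n * ι (2 ℕ.^ n) ≡ 1ℚ
½^*2^ n = trans (cong (½ ^ℚ n *_) (ι-^ 2 n)) (trans (sym (^ℚ-distrib-* ½ (ι 2) n)) (ones n))
  where
  ones : ∀ n → 1ℚ ^ℚ n ≡ 1ℚ
  ones zero    = refl
  ones (suc n) = trans (ℚ.*-identityˡ _) (ones n)

halves : ∀ m n {a b} → a ℕ.≤ 2 ℕ.^ m ℕ.* 2 ℕ.^ n ℕ.* b → ½ ^ℚ m * ½ ^ℚ n * ι a ≤ ι b
halves m n {a} {b} h = ℚ.≤-trans (*-monoʳ-≤ 0≤h (ι-mono h)) (ℚ.≤-reflexive (begin
  x * y * ι (2 ℕ.^ m ℕ.* 2 ℕ.^ n ℕ.* b)  ≡⟨ cong (x * y *_) (trans (ι-* (2 ℕ.^ m ℕ.* 2 ℕ.^ n) b) (cong (_* ι b) (ι-* (2 ℕ.^ m) (2 ℕ.^ n)))) ⟩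
  x * y * (X * Y * ι b)                  ≡⟨ sym (ℚ.*-assoc (x * y) (X * Y) (ι b)) ⟩
  x * y * (X * Y) * ι b                  ≡⟨ cong (_* ι b) (trans (ℚ.*-assoc x y (X * Y)) (cong (x *_) (trans (cong (y *_) (ℚ.*-comm X Y)) (trans (sym (ℚ.*-assoc y Y X))
                                              (trans (cong (_* X) (½^*2^ n)) (ℚ.*-identityˡ X)))))) ⟩
  x * X * ι b                            ≡⟨ cong (_* ι b) (½^*2^ m) ⟩
  1ℚ * ι b                               ≡⟨ ℚ.*-identityˡ (ι b) ⟩
  ι b                                    ∎))
  where
  open ≡-Reasoning
  x = ½ ^ℚ m
  y = ½ ^ℚ n
  X = ι (2 ℕ.^ m)
  Y = ι (2 ℕ.^ n)
  0≤h : 0ℚ ≤ x * y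
  0≤h = subst (_≤ x * y) (ℚ.*-zeroʳ x) (*-monoʳ-≤ (ℚ.<⇒≤ (0<½^ m)) (ℚ.<⇒≤ (0<½^ n)))

-- In dimension `suc d` the exponent times `suc k` is an integer, so the power `suc k` of the size
-- bound contains no root.
exponent≡ : ∀ d k → (+ suc d / 1) - (+ d / suc k) ≡ + suc (suc d ℕ.* k) / suc k
exponent≡ d k = ℚ.toℚᵘ-injective (begin
  toℚᵘ (u - v)                                 ≈⟨ ℚ.toℚᵘ-homo-+ u (ℚ.- v) ⟩
  toℚᵘ u ℚᵘ.+ toℚᵘ (ℚ.- v)                     ≈⟨ ℚᵘ.+-cong (ℚ.toℚᵘ-fromℚᵘ (mkℚᵘ (+ suc d) 0))
                                                    (ℚᵘ.≃-trans (ℚ.toℚᵘ-homo‿- v) (ℚᵘ.-‿cong (ℚ.toℚᵘ-fromℚᵘ (mkℚᵘ (+ d) k)))) ⟩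
  mkℚᵘ (+ suc d) 0 ℚᵘ.- mkℚᵘ (+ d) k           ≈⟨ *≡* cross ⟩
  mkℚᵘ (+ suc (suc d ℕ.* k)) k                 ≈⟨ ℚ.toℚᵘ-fromℚᵘ (mkℚᵘ (+ suc (suc d ℕ.* k)) k) ⟨
  toℚᵘ (+ suc (suc d ℕ.* k) / suc k)           ∎)
  where
  open import Relation.Binary.Reasoning.Setoid ℚᵘ.≃-setoid
  u = + suc d / 1
  v = + d / suc k
  numerator : + suc d ℤ.* + suc k ℤ.+ (ℤ.- + d) ℤ.* + 1 ≡ + suc (suc d ℕ.* k)
  numerator = trans (trans (+-homo (+ suc d ℤ.* + suc k) ((ℤ.- + d) ℤ.* + 1)) (cong₂ _+ᶻ_
      (trans (*-homo (+ suc d) (+ suc k)) (cong₂ _*ᶻ_ (pos-+ 1 d) (pos-+ 1 k))) (trans (*-homo (ℤ.- + d) (+ 1)) (cong (_*ᶻ + 1) (-‿homo (+ d))))))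
    (trans (solve 2 (λ d k → (con (+ 1) :+ d) :* (con (+ 1) :+ k) :+ :- d :* con (+ 1) := con (+ 1) :+ (con (+ 1) :+ d) :* k) refl (+ d) (+ k))
      (sym (trans (pos-+ 1 (suc d ℕ.* k)) (cong (+ 1 +ᶻ_) (trans (pos-* (suc d) k) (cong (_*ᶻ + k) (pos-+ 1 d)))))))
  cross : (+ suc d ℤ.* + suc k ℤ.+ (ℤ.- + d) ℤ.* + 1) ℤ.* + suc k ≡ + suc (suc d ℕ.* k) ℤ.* + suc (k ℕ.+ 0)
  cross = cong₂ ℤ._*_ numerator (cong (λ k → + suc k) (sym (ℕ.+-identityʳ k)))

^-cancelʳ-≤ : ∀ {m n} b → 1 ℕ.≤ b → m ℕ.^ b ℕ.≤ n ℕ.^ b → m ℕ.≤ n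
^-cancelʳ-≤ {m} {n} (suc b) _ h = ℕ.≮⇒≥ λ n<m → ℕ.<⇒≱ (ℕ.^-monoˡ-< (suc b) n<m) h

cross-multiply : ∀ {i k} s → s ≡ + i / suc k → ↥ s ℤ.* + suc k ≡ + i ℤ.* ↧ s
cross-multiply {i} {k} s refl = trans (cong (↥ s ℤ.*_) (sym (ℚ.↧-/ (+ i) (suc k))))
  (trans (swap (↥ s) (↧ s) (gcd (+ i) (+ suc k))) (cong (ℤ._* ↧ s) (ℚ.↥-/ (+ i) (suc k))))
  where
  swap : ∀ x y z → x ℤ.* (y ℤ.* z) ≡ x ℤ.* z ℤ.* y
  swap x y z = trans (cong (x ℤ.*_) (ℤ.*-comm y z)) (sym (ℤ.*-assoc x z y))

-- The exponent s is given in lowest terms, the bound is not.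
threshold : ∀ {N c q i k} s → 0ℚ < c → s ≡ + i / suc k → N ≥ c ∙ q ↑ s → q ℕ.^ i ℕ.≤ (↧ₙ c ℕ.* N) ℕ.^ suc k
threshold {N} {c} {q} {i} {k} s@(mkℚ (+ a) b′ _) 0<c s≡ h = ^-cancelʳ-≤ b (s≤s z≤n) (begin
  (q ℕ.^ i) ℕ.^ b                ≡⟨ ℕ.^-*-assoc q i b ⟩
  q ℕ.^ (i ℕ.* b)                ≡⟨ cong (q ℕ.^_) (sym cross) ⟩
  q ℕ.^ (a ℕ.* suc k)            ≡⟨ sym (ℕ.^-*-assoc q a (suc k)) ⟩
  (q ℕ.^ a) ℕ.^ suc k            ≤⟨ ℕ.^-monoˡ-≤ (suc k) reduced ⟩
  ((β ℕ.* N) ℕ.^ b) ℕ.^ suc k    ≡⟨ trans (ℕ.^-*-assoc (β ℕ.* N) b (suc k)) (trans (cong ((β ℕ.* N) ℕ.^_) (ℕ.*-comm b (suc k))) (sym (ℕ.^-*-assoc (β ℕ.* N) (suc k) b))) ⟩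
  ((β ℕ.* N) ℕ.^ suc k) ℕ.^ b    ∎)
  where
  open ℕ.≤-Reasoning
  b = suc b′
  β = ↧ₙ c
  cross : a ℕ.* suc k ≡ i ℕ.* b
  cross = ℤ.+-injective (trans (ℤ.pos-* a (suc k)) (trans (cross-multiply {i} {k} s s≡) (sym (ℤ.pos-* i b))))
  reduced : q ℕ.^ a ℕ.≤ (β ℕ.* N) ℕ.^ b
  reduced = ι-cancel (ℚ.≤-trans (subst (_≤ (c * ι β) ^ℚ b * ι (q ℕ.^ a)) (ℚ.*-identityˡ _) scale)
    (ℚ.≤-trans (ℚ.≤-reflexive regroup) (ℚ.≤-trans (*-monoʳ-≤ (subst (0ℚ ≤_) (ι-^ β b) (0≤ι (β ℕ.^ b))) h) (ℚ.≤-reflexive collect))))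
    where
    scale : 1ℚ * ι (q ℕ.^ a) ≤ (c * ι β) ^ℚ b * ι (q ℕ.^ a)
    scale = subst₂ _≤_ (ℚ.*-comm (ι (q ℕ.^ a)) 1ℚ) (ℚ.*-comm (ι (q ℕ.^ a)) _) (*-monoʳ-≤ (0≤ι (q ℕ.^ a)) (1≤^ℚ b (1≤c*↧ c 0<c)))
    regroup : (c * ι β) ^ℚ b * ι (q ℕ.^ a) ≡ ι β ^ℚ b * (c ^ℚ b * ι (q ℕ.^ a))
    regroup = trans (cong (_* ι (q ℕ.^ a)) (trans (^ℚ-distrib-* c (ι β) b) (ℚ.*-comm (c ^ℚ b) (ι β ^ℚ b)))) (ℚ.*-assoc (ι β ^ℚ b) (c ^ℚ b) _)
    collect : ι β ^ℚ b * ι (N ℕ.^ b) ≡ ι ((β ℕ.* N) ℕ.^ b)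
    collect = trans (cong (ι β ^ℚ b *_) (ι-^ N b)) (trans (sym (^ℚ-distrib-* (ι β) (ι N) b))
      (trans (cong (_^ℚ b) (sym (ι-* β N))) (sym (ι-^ (β ℕ.* N) b))))
threshold {i = i} {k} s@(mkℚ -[1+ a ] b′ _) 0<c s≡ h =
  contradiction (trans (cross-multiply {i} {k} s s≡) (sym (ℤ.pos-* i (suc b′)))) λ ()

-- The constant and its independence of k

module _ (d β : ℕ) where

  -- The logarithm to the base 2 of the reciprocal of the constant C.
  log-constant : ℕ
  log-constant = d ℕ.+ 5 ℕ.+ 2 ℕ.* d ℕ.+ 2 ℕ.* β ℕ.+ (2 ℕ.* β) ℕ.* (2 ℕ.* β)

  n≤2^n : ∀ n → n ℕ.≤ 2 ℕ.^ n
  n≤2^n zero    = z≤n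
  n≤2^n (suc n) = ℕ.≤-trans (ℕ.+-mono-≤ (ℕ.m^n>0 2 n) (n≤2^n n)) (ℕ.≤-reflexive (cong (2 ℕ.^ n ℕ.+_) (sym (ℕ.+-identityʳ _))))

  -- This moves a factor `2 ^ (a * k)`, exponential in `k`, into `2 ^ (k * k)` at the price of
  -- `2 ^ (a * a)`, which is free of `k`; it is the origin of the square in `log-constant`.
  a*k≤ : ∀ a k → a ℕ.* k ℕ.≤ a ℕ.* a ℕ.+ k ℕ.* k
  a*k≤ a k with ℕ.≤-total a k
  ... | inj₁ a≤k = ℕ.≤-trans (ℕ.*-monoˡ-≤ k a≤k) (ℕ.m≤n+m _ (a ℕ.* a))
  ... | inj₂ k≤a = ℕ.≤-trans (ℕ.*-monoʳ-≤ a k≤a) (ℕ.m≤m+n _ (k ℕ.* k))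

  constant-≤ : ∀ k → 1 ℕ.≤ β →
    2 ℕ.^ d ℕ.* (2 ℕ.^ suc k ℕ.+ 20 ℕ.* 4 ℕ.^ d ℕ.* β ℕ.^ suc k) ℕ.≤ 2 ℕ.^ log-constant ℕ.* 2 ℕ.^ (k ℕ.^ 2)
  constant-≤ k 1≤β = begin
    2 ℕ.^ d ℕ.* (2 ℕ.^ suc k ℕ.+ 20 ℕ.* 4 ℕ.^ d ℕ.* β ℕ.^ suc k)
      ≤⟨ ℕ.*-monoʳ-≤ (2 ℕ.^ d) (ℕ.+-mono-≤ first (ℕ.*-monoʳ-≤ (20 ℕ.* 4 ℕ.^ d) (ℕ.^-monoˡ-≤ (suc k) {β} {a} (ℕ.m≤n*m β 2)))) ⟩
    2 ℕ.^ d ℕ.* (4 ℕ.^ d ℕ.* A ℕ.+ 20 ℕ.* 4 ℕ.^ d ℕ.* A)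
      ≡⟨ cong (2 ℕ.^ d ℕ.*_) (trans (cong (4 ℕ.^ d ℕ.* A ℕ.+_) (ℕ.*-assoc 20 (4 ℕ.^ d) A)) refl) ⟩
    2 ℕ.^ d ℕ.* (21 ℕ.* (4 ℕ.^ d ℕ.* A))
      -- The sum `1 + 20` of the coefficients is rounded up to `2 ^ 5`, which gives the 5 in
      -- `log-constant`.
      ≤⟨ ℕ.*-monoʳ-≤ (2 ℕ.^ d) (ℕ.*-mono-≤ {21} {32} (ℕ.m≤m+n 21 11) (ℕ.*-monoʳ-≤ (4 ℕ.^ d) A≤)) ⟩
    2 ℕ.^ d ℕ.* (2 ℕ.^ 5 ℕ.* (4 ℕ.^ d ℕ.* 2 ℕ.^ (a ℕ.+ (a ℕ.* a ℕ.+ k ℕ.* k))))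
      ≡⟨ cong (λ t → 2 ℕ.^ d ℕ.* (2 ℕ.^ 5 ℕ.* (t ℕ.* 2 ℕ.^ (a ℕ.+ (a ℕ.* a ℕ.+ k ℕ.* k))))) (ℕ.^-*-assoc 2 2 d) ⟩
    2 ℕ.^ d ℕ.* (2 ℕ.^ 5 ℕ.* (2 ℕ.^ (2 ℕ.* d) ℕ.* 2 ℕ.^ (a ℕ.+ (a ℕ.* a ℕ.+ k ℕ.* k))))
      ≡⟨ sym (trans (ℕ.^-distribˡ-+-* 2 d (5 ℕ.+ (2 ℕ.* d ℕ.+ r))) (cong (2 ℕ.^ d ℕ.*_) (trans (ℕ.^-distribˡ-+-* 2 5 (2 ℕ.* d ℕ.+ r)) (cong (2 ℕ.^ 5 ℕ.*_) (ℕ.^-distribˡ-+-* 2 (2 ℕ.* d) r))))) ⟩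
    2 ℕ.^ (d ℕ.+ (5 ℕ.+ (2 ℕ.* d ℕ.+ (a ℕ.+ (a ℕ.* a ℕ.+ k ℕ.* k)))))
      ≡⟨ cong (2 ℕ.^_) reassociate ⟩
    2 ℕ.^ (log-constant ℕ.+ k ℕ.^ 2)
      ≡⟨ ℕ.^-distribˡ-+-* 2 log-constant (k ℕ.^ 2) ⟩
    2 ℕ.^ log-constant ℕ.* 2 ℕ.^ (k ℕ.^ 2) ∎
    where
    open ℕ.≤-Reasoning
    -- At least as large as both 2 and `β`, so that the single power `A` dominates both summands.
    a = 2 ℕ.* β
    A = a ℕ.^ suc k
    r = a ℕ.+ (a ℕ.* a ℕ.+ k ℕ.* k)
    first : 2 ℕ.^ suc k ℕ.≤ 4 ℕ.^ d ℕ.* A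
    first = ℕ.≤-trans (ℕ.^-monoˡ-≤ (suc k) {2} {a} (ℕ.*-monoʳ-≤ 2 {1} {β} 1≤β)) (ℕ.m≤n*m A (4 ℕ.^ d) {{ℕ.m^n≢0 4 d}})
    A≤ : A ℕ.≤ 2 ℕ.^ (a ℕ.+ (a ℕ.* a ℕ.+ k ℕ.* k))
    A≤ = ℕ.≤-trans (ℕ.^-monoˡ-≤ (suc k) (n≤2^n a)) (ℕ.≤-trans (ℕ.≤-reflexive (trans (ℕ.^-*-assoc 2 a (suc k)) (cong (2 ℕ.^_) (ℕ.*-suc a k))))
      (ℕ.^-monoʳ-≤ 2 (ℕ.+-monoʳ-≤ a (a*k≤ a k))))
    reassociate : d ℕ.+ (5 ℕ.+ (2 ℕ.* d ℕ.+ (a ℕ.+ (a ℕ.* a ℕ.+ k ℕ.* k)))) ≡ log-constant ℕ.+ k ℕ.^ 2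
    reassociate = trans (cong (λ t → d ℕ.+ (5 ℕ.+ (2 ℕ.* d ℕ.+ (a ℕ.+ (a ℕ.* a ℕ.+ t))))) (cong (k ℕ.*_) (sym (ℕ.*-identityʳ k))))
      (trans (sym (ℕ.+-assoc d 5 _)) (trans (sym (ℕ.+-assoc (d ℕ.+ 5) (2 ℕ.* d) _))
        (trans (sym (ℕ.+-assoc (d ℕ.+ 5 ℕ.+ 2 ℕ.* d) a _)) (sym (ℕ.+-assoc (d ℕ.+ 5 ℕ.+ 2 ℕ.* d ℕ.+ a) (a ℕ.* a) _)))))

theorem2 : ∀ (d : ℕ) → 2 ℕ.≤ d → (c : ℚ) → 0ℚ < c →
  ∃ λ (C : ℚ) → 0ℚ < C ×
    (∀ (k : ℕ) → d ℕ.≤ k →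
     ∀ (q p n : ℕ) → Prime p → p ≢ 2 → 1 ℕ.≤ n → q ≡ p ℕ.^ n →
     (F : FiniteField q) →
     let open Space F d
         s = (+ d / 1) - (+ (d ∸ 1) / suc k)
     in
     {E : Pred Point 0ℓ} (E? : Decidable E) →
     ∣ E? ∣ ≥ c ∙ q ↑ s →
     C * (½ ^ℚ (k ℕ.^ 2)) * (+ (∣Δ k ∣ U?) / 1) ≤ + (∣Δ k ∣ E?) / 1)
theorem2 (suc zero) (s≤s ())
theorem2 d@(suc d′@(suc _)) _ c 0<c = ½ ^ℚ log-constant d β , 0<½^ (log-constant d β) , bound
  where
  β = ↧ₙ c
  bound : ∀ (k : ℕ) → d ℕ.≤ k →
    ∀ (q p n : ℕ) → Prime p → p ≢ 2 → 1 ℕ.≤ n → q ≡ p ℕ.^ n →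
    (F : FiniteField q) → let open Space F d in
    {E : Pred Point 0ℓ} (E? : Decidable E) →
    ∣ E? ∣ ≥ c ∙ q ↑ ((+ d / 1) - (+ (d ∸ 1) / suc k)) →
    ½ ^ℚ log-constant d β * (½ ^ℚ (k ℕ.^ 2)) * (+ (∣Δ k ∣ U?) / 1) ≤ + (∣Δ k ∣ E?) / 1
  bound k@(suc j) d≤k q p n p-prime p≢2 _ q≡p^n F E? big =
    halves (log-constant d β) (k ℕ.^ 2) (ℕ.≤-trans count (ℕ.*-monoˡ-≤ (∣Δ k ∣ E?) (constant-≤ d β k (s≤s z≤n))))
    where
    open Space F d using (∣_∣; ∣Δ_∣)
    open Field.Bounds F (Field.2≢0 F (odd {n = n} p-prime p≢2 q≡p^n)) {d} (s≤s z≤n) E? using (classes-bound)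
    large : q ℕ.* (q ℕ.^ d) ℕ.^ k ℕ.≤ (β ℕ.* ∣ E? ∣) ℕ.^ suc k
    large = subst (ℕ._≤ (β ℕ.* ∣ E? ∣) ℕ.^ suc k) (cong (q ℕ.*_) (sym (ℕ.^-*-assoc q d k)))
      (threshold {i = suc (d ℕ.* k)} {k} ((+ d / 1) - (+ d′ / suc k)) 0<c (exponent≡ d′ k) big)
    count : ∣Δ k ∣ U? ℕ.≤ 2 ℕ.^ d ℕ.* (2 ℕ.^ suc k ℕ.+ 20 ℕ.* 4 ℕ.^ d ℕ.* β ℕ.^ suc k) ℕ.* ∣Δ k ∣ E?
    count = ℤ.drop‿+≤+ (subst (+ ∣Δ k ∣ U? ℤ.≤_) (sym (trans (pos-* _ (∣Δ k ∣ E?)) (cong (_*ᶻ + ∣Δ k ∣ E?)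
      (trans (pos-* (2 ℕ.^ d) _) (cong₂ _*ᶻ_ (pos-^ 2 d) (trans (pos-+ (2 ℕ.^ suc k) _) (cong₂ _+ᶻ_ (pos-^ 2 (suc k))
        (trans (pos-* (20 ℕ.* 4 ℕ.^ d) _) (cong₂ _*ᶻ_ (trans (pos-* 20 _) (cong (+ 20 *ᶻ_) (pos-^ 4 d))) (pos-^ β (suc k)))))))))))
      (classes-bound β d≤k large))
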